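{- Let $\mathcal{D}$ be a class of finite or countable posets such that for every $P\in\mathcal D$: the order of $P$ is the intersection of two linear orders on its vertex set, every module of $P$ distinct from the whole vertex set is totally ordered, and the incomparability graph $\mathrm{Inc}(P)$ is connected. Let $\widehat{\mathcal{D}}$ be the class of all lexicographical sums $\sum_{i\in I}P_i$, where $I$ is a nonempty finite or countable chain and each $P_i\in\mathcal D$, and let $\widehat{\mathcal{D}}_{<\omega}$ be the subclass of finite members of $\widehat{\mathcal D}$. Then: (1) $\widehat{\mathcal{D}}$ is bqo if and only if $o^{ -1}\langle \widehat{\mathcal{D}}\rangle$ is bqo; (2) $\widehat{\mathcal{D}}_{<\omega}$ is wqo (resp. bqo) if and only if $\mathrm{Inc}\langle \widehat{\mathcal{D}}_{<\omega}\rangle$ is wqo (resp. bqo).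
   Context: All classes are quasi-ordered by embeddability: a structure $R$ embeds in $R'$ if $R$ is isomorphic to an induced substructure of $R'$. A quasi-order is wqo if every infinite sequence has an infinite increasing subsequence. A quasi-order $Q$ is bqo if the class $Q^{<\omega_1}$ of maps $f:\alpha\to Q$ ($\alpha$ a countable ordinal), quasi-ordered by $f\le g$ iff there is a one-to-one order-preserving $h$ from $\mathrm{dom}(f)$ into $\mathrm{dom}(g)$ with $f(\gamma)\le g(h(\gamma))$ for all $\gamma$, is wqo. A module of a poset $P=(V,\le)$ is a set $A\subseteq V$ such that every $v\in V\setminus A$ is either above all of $A$, below all of $A$, or incomparable to all of $A$. The lexicographical sum $\sum_{i\in I}P_i$ over a chain $I$ of pairwise disjoint posets $P_i$ is the union of the $P_i$ with $x\le y$ iff $x,y$ lie in the same $P_i$ and $x\le y$ there, or $x\in P_i$, $y\in P_j$ with $i<j$ in $I$. A bichain is a structure $B=(V,(\le_1,\le_2))$ with $\le_1,\le_2$ linear orders on $V$; $o(B):=(V,\le_1\cap\le_2)$. For a class $\mathcal C$ of posets, $o^{ -1}\langle\mathcal C\rangle$ is the class of bichains $B$ with $o(B)\in\mathcal C$, and $\mathrm{Inc}\langle\mathcal C\rangle:=\{\mathrm{Inc}(P):P\in\mathcal C\}$, where $\mathrm{Inc}(P)$ is the graph on $V$ whose edges are the pairs of distinct incomparable elements. -}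

module Defs where

open import Level using (Level; _⊔_; 0ℓ) renaming (suc to lsuc)
open import Data.Nat using (ℕ) renaming (_<_ to _<ℕ_)
open import Data.Fin using (Fin)
open import Data.Product using (Σ; _×_; _,_; proj₁; proj₂)
open import Data.Sum using (_⊎_; inj₁; inj₂)
open import Relation.Nullary using (¬_)
open import Relation.Binary.PropositionalEquality using (_≡_; _≢_)
open import Relation.Binary.Construct.Closure.ReflexiveTransitive using (Star)
open import Induction.WellFounded using (WellFounded)

Injective : {A : Set} {B : Set} → (A → B) → Set
Injective f = ∀ {x y} → f x ≡ f y → x ≡ y

record Countable (A : Set) : Set where
  field
    enc     : A → ℕ
    enc-inj : Injective enc

Finite : Set → Set
Finite A = Σ ℕ λ n → Σ (A → Fin n) Injective

record IsLinear {A : Set} (_≤_ : A → A → Set) : Set where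
  field
    refl    : ∀ x → x ≤ x
    trans   : ∀ {x y z} → x ≤ y → y ≤ z → x ≤ z
    antisym : ∀ {x y} → x ≤ y → y ≤ x → x ≡ y
    total   : ∀ x y → x ≤ y ⊎ y ≤ x

IsWqo : ∀ {a r} {Q : Set a} → (Q → Q → Set r) → Set (a ⊔ r)
IsWqo {Q = Q} _≼_ =
  (f : ℕ → Q) → Σ (ℕ → ℕ) λ φ →
    (∀ {i j} → i <ℕ j → φ i <ℕ φ j) × (∀ {i j} → i <ℕ j → f (φ i) ≼ f (φ j))

record CtblOrd : Set₁ where
  field
    Carrier   : Set
    countable : Countable Carrier
    _<_       : Carrier → Carrier → Set
    irrefl    : ∀ x → ¬ (x < x)
    trans     : ∀ {x y z} → x < y → y < z → x < z
    trichot   : ∀ x y → x < y ⊎ (x ≡ y ⊎ y < x)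
    wf        : WellFounded _<_

Seq : ∀ {a} → Set a → Set (lsuc 0ℓ ⊔ a)
Seq Q = Σ CtblOrd λ α → CtblOrd.Carrier α → Q

SeqLe : ∀ {a r} {Q : Set a} → (Q → Q → Set r) → Seq Q → Seq Q → Set r
SeqLe _≼_ (α , f) (β , g) =
  Σ (CtblOrd.Carrier α → CtblOrd.Carrier β) λ h →
    Injective h ×
    (∀ x y → CtblOrd._<_ α x y → CtblOrd._<_ β (h x) (h y)) ×
    (∀ γ → f γ ≼ g (h γ))

IsBqo : ∀ {a r} {Q : Set a} → (Q → Q → Set r) → Set (lsuc 0ℓ ⊔ a ⊔ r)
IsBqo _≼_ = IsWqo (SeqLe _≼_)

record Poset : Set₁ where
  field
    Carrier   : Set
    countable : Countable Carrier
    _≤_       : Carrier → Carrier → Set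
    refl      : ∀ x → x ≤ x
    trans     : ∀ {x y z} → x ≤ y → y ≤ z → x ≤ z
    antisym   : ∀ {x y} → x ≤ y → y ≤ x → x ≡ y

record Bichain : Set₁ where
  field
    Carrier   : Set
    countable : Countable Carrier
    _≤₁_      : Carrier → Carrier → Set
    _≤₂_      : Carrier → Carrier → Set
    lin₁      : IsLinear _≤₁_
    lin₂      : IsLinear _≤₂_

record Graph : Set₁ where
  field
    Carrier   : Set
    countable : Countable Carrier
    Edge      : Carrier → Carrier → Set

o : Bichain → Poset
o B = record
  { Carrier   = Carrier
  ; countable = countable
  ; _≤_       = λ x y → (x ≤₁ y) × (x ≤₂ y)
  ; refl      = λ x → IsLinear.refl lin₁ x , IsLinear.refl lin₂ x
  ; trans     = λ p q → IsLinear.trans lin₁ (proj₁ p) (proj₁ q) , IsLinear.trans lin₂ (proj₂ p) (proj₂ q)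
  ; antisym   = λ p q → IsLinear.antisym lin₁ (proj₁ p) (proj₁ q)
  }
  where open Bichain B

Incomparable : (P : Poset) → Poset.Carrier P → Poset.Carrier P → Set
Incomparable P x y = ¬ (Poset._≤_ P x y) × ¬ (Poset._≤_ P y x)

Inc : Poset → Graph
Inc P = record
  { Carrier   = Poset.Carrier P
  ; countable = Poset.countable P
  ; Edge      = λ x y → x ≢ y × Incomparable P x y
  }

_≼P_ : Poset → Poset → Set
P ≼P P' = Σ (Poset.Carrier P → Poset.Carrier P') λ h → Injective h ×
  (∀ x y → (Poset._≤_ P x y → Poset._≤_ P' (h x) (h y)) × (Poset._≤_ P' (h x) (h y) → Poset._≤_ P x y))

_≼B_ : Bichain → Bichain → Set
B ≼B B' = Σ (Bichain.Carrier B → Bichain.Carrier B') λ h → Injective h ×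
  (∀ x y → (Bichain._≤₁_ B x y → Bichain._≤₁_ B' (h x) (h y)) × (Bichain._≤₁_ B' (h x) (h y) → Bichain._≤₁_ B x y)) ×
  (∀ x y → (Bichain._≤₂_ B x y → Bichain._≤₂_ B' (h x) (h y)) × (Bichain._≤₂_ B' (h x) (h y) → Bichain._≤₂_ B x y))

_≼G_ : Graph → Graph → Set
G ≼G G' = Σ (Graph.Carrier G → Graph.Carrier G') λ h → Injective h ×
  (∀ x y → (Graph.Edge G x y → Graph.Edge G' (h x) (h y)) × (Graph.Edge G' (h x) (h y) → Graph.Edge G x y))

PosetClass : Set₂
PosetClass = Poset → Set₁

EmbC : (C : PosetClass) → Σ Poset C → Σ Poset C → Set
EmbC C (P , _) (P' , _) = P ≼P P'

o⁻¹ : PosetClass → Set₁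
o⁻¹ C = Σ Bichain λ B → C (o B)

Embo⁻¹ : (C : PosetClass) → o⁻¹ C → o⁻¹ C → Set
Embo⁻¹ C (B , _) (B' , _) = B ≼B B'

-- Inc⟨C⟩ = {Inc(P) : P ∈ C} (indexed by C), quasi-ordered by graph embeddability
EmbInc : (C : PosetClass) → Σ Poset C → Σ Poset C → Set
EmbInc C (P , _) (P' , _) = Inc P ≼G Inc P'

IsModule : (P : Poset) → (Poset.Carrier P → Set) → Set
IsModule P A = ∀ v → ¬ A v →
  (∀ a → A a → Poset._≤_ P a v) ⊎ ((∀ a → A a → Poset._≤_ P v a) ⊎ (∀ a → A a → Incomparable P v a))

IsIntersectionOfTwoLinear : Poset → Set₁
IsIntersectionOfTwoLinear P =
  Σ (Poset.Carrier P → Poset.Carrier P → Set) λ _≤₁_ →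
  Σ (Poset.Carrier P → Poset.Carrier P → Set) λ _≤₂_ →
    IsLinear _≤₁_ × IsLinear _≤₂_ ×
    (∀ x y → (Poset._≤_ P x y → (x ≤₁ y) × (x ≤₂ y)) × ((x ≤₁ y) × (x ≤₂ y) → Poset._≤_ P x y))

ProperModulesAreChains : Poset → Set₁
ProperModulesAreChains P = (A : Poset.Carrier P → Set) → IsModule P A → ¬ (∀ v → A v) →
  ∀ a b → A a → A b → Poset._≤_ P a b ⊎ Poset._≤_ P b a

IncConnected : Poset → Set
IncConnected P = ∀ x y → Star (Graph.Edge (Inc P)) x y

IsChain : Poset → Set
IsChain I = ∀ i j → Poset._≤_ I i j ⊎ Poset._≤_ I j i

module _ (I : Poset) (Q : Poset.Carrier I → Poset) where
  LexCarrier : Set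
  LexCarrier = Σ (Poset.Carrier I) λ i → Poset.Carrier (Q i)

  data LexLe : LexCarrier → LexCarrier → Set where
    inside : ∀ {i a b} → Poset._≤_ (Q i) a b → LexLe (i , a) (i , b)
    across : ∀ {i j a b} → Poset._≤_ I i j → i ≢ j → LexLe (i , a) (j , b)

IsLexSumOf : (Poset → Set) → Poset → Set₁
IsLexSumOf 𝒟 P =
  Σ Poset λ I → IsChain I × Poset.Carrier I ×
  Σ (Poset.Carrier I → Poset) λ Q → (∀ i → 𝒟 (Q i)) ×
  Σ (Poset.Carrier P → LexCarrier I Q) λ φ →
    Injective φ × (∀ s → Σ (Poset.Carrier P) λ x → φ x ≡ s) ×
    (∀ x y → (Poset._≤_ P x y → LexLe I Q (φ x) (φ y)) × (LexLe I Q (φ x) (φ y) → Poset._≤_ P x y))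

Hat : (Poset → Set) → PosetClass
Hat 𝒟 = IsLexSumOf 𝒟

HatFin : (Poset → Set) → PosetClass
HatFin 𝒟 P = IsLexSumOf 𝒟 P × Finite (Poset.Carrier P)

{-# OPTIONS --safe #-}
-- A sum is a countable chain labelled by its blocks P ∈ 𝒟, and by Laver's theorem it suffices to prove the labels
-- better-quasi-ordered.
-- By Gallai's theory of transitive orientations, a P ∈ 𝒟 has only two realizers, exchanged by swapping the linear orders,
-- and for finite P the graph Inc(P) determines P up to duality.  Hence the order of the labels and the coarser order that
-- is given differ by a sign: the coarser one is the union of the finer one and a second relation whose square is finer.
-- Passing to trees whose children increase, on which a single sign can be chosen, shows that such a double cover inherits
-- bqo.  Here bqo is used as the absence of bad locally constant arrays on [ω]^ω.  It follows from the definition by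
-- transfinite sequences because trees are coded by hereditarily indecomposable sequences, and it implies the definition by
-- Laver's theorem, as transfinite sequences of labelled chains are chains of chains.  Laver's theorem is proved by a
-- minimal bad array of terms for sums over ω, ω* and a coloured dense chain; Hausdorff's condensation argument shows that
-- every countable labelled chain is equimorphic to the value of a term.
module Submission where

open import Defs
open import Level using (Level; _⊔_; Lift; lift; lower) renaming (suc to lsuc; zero to lzero)
open import Axiom.ExcludedMiddle using (ExcludedMiddle)
open import Data.Nat hiding (_⊔_)
open import Data.Nat using () renaming (_⊔_ to _⊔ℕ_)
open import Data.Nat.Properties
open import Data.Nat.Induction using (<-wellFounded)
open import Data.Bool using (Bool; true; false; T; if_then_else_)
open import Data.List using (List; []; _∷_; _∷ʳ_; length; replicate)
open import Data.List.Properties using (length-replicate; ∷ʳ-injective)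
open import Data.Maybe using (Maybe; just; nothing)
open import Data.Product
open import Data.Sum using (_⊎_; inj₁; inj₂)
open import Data.Empty using (⊥; ⊥-elim)
open import Data.Unit using (⊤; tt)
open import Relation.Nullary
open import Relation.Nullary.Decidable using (dec-true; dec-false)
open import Relation.Binary.Definitions using (tri<; tri≈; tri>)
open import Relation.Binary.PropositionalEquality hiding ([_])
open import Function using (_∘_; id; case_of_)
open import Induction.WellFounded
open import Relation.Binary.Construct.Closure.Transitive as Trans using (TransClosure)
open import Relation.Binary.Construct.Closure.ReflexiveTransitive using (ε; _◅_)
open import Data.Fin using (toℕ)
open import Data.Fin.Properties using (toℕ-injective; toℕ<n)
open import Function.Bundles using (_⇔_; mk⇔)

private
  variable
    ℓ ℓ' ℓ″ : Level

-- For sequences a double cover is harmless: Ramsey's theorem makes the sign constant, and over i <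
-- j < k two negative comparisons compose to a positive one. For arrays this fails. Badness forbids
-- only f X ≤ f (X ∘ suc), while two negative steps give f X ≤ f (X ∘ suc ∘ suc), which does not
-- contradict it. The children of a node form a sequence again, so in a tree the sequence argument
-- works at every level. This is why the hypothesis enters through `bqo⇒trees-good`, as a statement
-- on trees.
--
-- Incomparability graphs add an obstacle of their own. Vertices with the same neighbours in Inc(P),
-- called twins, can be permuted without changing the graph, so the graph fixes, up to reversal,
-- only the order of comparable pairs that are not twins (`Cross`). To compare P with another order
-- on the same graph, each twin class has to be sorted anew. Two linear orders on one infinite set,
-- such as ω and ω*, need not embed in each other; this is one place where finiteness enters in (2).

module _ (lem : (ℓ : Level) → ExcludedMiddle ℓ) where

  -- Classical logic, increasing sequences and enumerations

  em : (P : Set ℓ) → Dec P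
  em {ℓ} P = lem ℓ

  byContra : {P : Set ℓ} → ¬ ¬ P → P
  byContra {P = P} nn with em P
  ... | yes p = p
  ... | no np = ⊥-elim (nn np)

  ¬∀⇒∃¬ : {A : Set ℓ} {P : A → Set ℓ'} → ¬ (∀ x → P x) → Σ A λ x → ¬ P x
  ¬∀⇒∃¬ h = byContra λ n → h λ x → byContra λ np → n (x , np)

  least : (P : ℕ → Set ℓ) → Σ ℕ P → Σ ℕ λ n → P n × (∀ m → m < n → ¬ P m)
  least P (n , p) = go n (<-wellFounded n) p
    where
    go : ∀ n → Acc _<_ n → P n → Σ ℕ λ n → P n × (∀ m → m < n → ¬ P m)
    go n (acc rs) p with em (Σ ℕ λ m → m < n × P m)
    ... | yes (m , m<n , pm) = go m (rs m<n) pm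
    ... | no none = n , p , λ m m<n pm → none (m , m<n , pm)

  minimal : {A : Set ℓ} {_⊏_ : A → A → Set ℓ'} → WellFounded _⊏_ → (P : A → Set ℓ″) →
    Σ A P → Σ A λ x → P x × (∀ y → y ⊏ x → ¬ P y)
  minimal {A = A} {_⊏_} wf P (x , p) = go x (wf x) p
    where
    go : ∀ x → Acc _⊏_ x → P x → Σ A λ x → P x × (∀ y → y ⊏ x → ¬ P y)
    go x (acc rs) p with em (Σ A λ y → y ⊏ x × P y)
    ... | yes (y , y⊏x , py) = go y (rs y⊏x) py
    ... | no none = x , p , λ y y⊏x py → none (y , y⊏x , py)

  Pt : Set
  Pt = ℕ → ℕ

  Mono : Pt → Set
  Mono φ = ∀ {i j} → i < j → φ i < φ j

  mono-step : (φ : Pt) → (∀ n → φ n < φ (suc n)) → Mono φ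
  mono-step φ h {i} {suc j} (s≤s i≤j) with m≤n⇒m<n∨m≡n i≤j
  ... | inj₁ i<j = <-trans (mono-step φ h i<j) (h j)
  ... | inj₂ refl = h j

  mono-≤ : ∀ {φ} → Mono φ → ∀ {i j} → i ≤ j → φ i ≤ φ j
  mono-≤ m i≤j with m≤n⇒m<n∨m≡n i≤j
  ... | inj₁ i<j = <⇒≤ (m i<j)
  ... | inj₂ refl = ≤-refl

  mono-infl : ∀ {φ} → Mono φ → ∀ i → i ≤ φ i
  mono-infl m zero = z≤n
  mono-infl m (suc i) = ≤-<-trans (mono-infl m i) (m (n<1+n i))

  mono-reflect : ∀ {φ} → Mono φ → ∀ {i j} → φ i < φ j → i < j
  mono-reflect {φ} m {i} {j} p with i <? j
  ... | yes q = q
  ... | no q = ⊥-elim (<-irrefl refl (<-≤-trans p (mono-≤ m (≮⇒≥ q))))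

  mono-inj : ∀ {φ} → Mono φ → ∀ {i j} → φ i ≡ φ j → i ≡ j
  mono-inj {φ} m {i} {j} e with <-cmp i j
  ... | tri< p _ _ = ⊥-elim (<-irrefl e (m p))
  ... | tri≈ _ p _ = p
  ... | tri> _ _ p = ⊥-elim (<-irrefl (sym e) (m p))

  mono-shift : ∀ {φ} → Mono φ → Mono (φ ∘ suc)
  mono-shift m = m ∘ s≤s

  tail : Pt → ℕ → Pt
  tail N i j = N (suc i + j)

  mono-tail : ∀ {N} i → Mono N → Mono (tail N i)
  mono-tail i m = m ∘ +-monoʳ-< (suc i)

  greedy : (P : ℕ → ℕ → Set ℓ) → (∀ n k → Σ ℕ λ m → k ≤ m × P n m) →
    Σ Pt λ h → Mono h × (∀ n → P n (h n))
  greedy P step = h , mono-step h (λ n → proj₁ (proj₂ (step (suc n) (suc (h n))))) , ok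
    where
    h : Pt
    h zero = proj₁ (step zero zero)
    h (suc n) = proj₁ (step (suc n) (suc (h n)))
    ok : ∀ n → P n (h n)
    ok zero = proj₂ (proj₂ (step zero zero))
    ok (suc n) = proj₂ (proj₂ (step (suc n) (suc (h n))))

  frequently : (P : ℕ → Set ℓ) → (∀ k → Σ ℕ λ m → k ≤ m × P m) → Σ Pt λ h → Mono h × (∀ n → P (h n))
  frequently P inf = greedy (λ _ m → P m) (λ _ → inf)

  often : (P : ℕ → Set ℓ) → (∀ k → Σ ℕ λ m → k ≤ m × P m) ⊎ Σ ℕ (λ k → ∀ m → k ≤ m → ¬ P m)
  often P with em (∀ k → Σ ℕ λ m → k ≤ m × P m)
  ... | yes i = inj₁ i
  ... | no n with ¬∀⇒∃¬ n
  ...   | k , q = inj₂ (k , λ m k≤m p → q (m , k≤m , p))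

  pigeon : (c : ℕ → Bool) → Σ Bool λ b → ∀ k → Σ ℕ λ m → k ≤ m × c m ≡ b
  pigeon c with often (λ m → c m ≡ true)
  ... | inj₁ i = true , i
  ... | inj₂ (k , q) = false , λ k' → k ⊔ℕ k' , m≤n⊔m k k' , lemma (c (k ⊔ℕ k')) (q _ (m≤m⊔n k k'))
    where
    lemma : ∀ b → ¬ b ≡ true → b ≡ false
    lemma true n = ⊥-elim (n refl)
    lemma false n = refl

  -- The walk (0,0), (1,0), (0,1), (2,0), (1,1), (0,2), … through the antidiagonals.
  diag-step : ℕ × ℕ → ℕ × ℕ
  diag-step (zero , b) = suc b , zero
  diag-step (suc a , b) = a , suc b

  diag : ℕ → ℕ × ℕ
  diag zero = 0 , 0
  diag (suc n) = diag-step (diag n)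

  diag-surj : ∀ a b → Σ ℕ λ n → diag n ≡ (a , b)
  diag-surj a b = go (a + b) a b refl
    where
    along : ∀ s a b → a + b ≡ s → Σ ℕ (λ n → diag n ≡ (s , 0)) → Σ ℕ λ n → diag n ≡ (a , b)
    along s a zero e h = subst (λ x → Σ ℕ λ n → diag n ≡ (x , 0)) (trans (sym e) (+-identityʳ a)) h
    along s a (suc b) e h with along s (suc a) b (trans (sym (+-suc a b)) e) h
    ... | n , p = suc n , cong diag-step p
    go : ∀ s a b → a + b ≡ s → Σ ℕ λ n → diag n ≡ (a , b)
    go zero zero zero e = 0 , refl
    go (suc s) a b e = along (suc s) a b e (let n , p = go s 0 s refl in suc n , cong diag-step p)

  pair : ℕ → ℕ → ℕ
  pair a b = proj₁ (diag-surj a b)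

  diag-pair : ∀ a b → diag (pair a b) ≡ (a , b)
  diag-pair a b = proj₂ (diag-surj a b)

  diag-≥ : ∀ n → proj₁ (diag n) + proj₂ (diag n) ≤ n
  diag-≥ zero = z≤n
  diag-≥ (suc n) with diag n | diag-≥ n
  ... | zero , b | h = s≤s (subst (_≤ n) (sym (+-identityʳ b)) h)
  ... | suc a , b | h = ≤-trans (≤-reflexive (+-suc a b)) (m≤n⇒m≤1+n h)

  -- Takes every value infinitely often. It schedules the children of a tree, the colours of index
  -- chains and the members of recurrent sums.
  recur : ℕ → ℕ
  recur n = proj₁ (diag n)

  recur-inf : ∀ a k → Σ ℕ λ m → k ≤ m × recur m ≡ a
  recur-inf a k = pair a k , ≤-trans (subst (λ p → k ≤ proj₁ p + proj₂ p) (sym (diag-pair a k)) (m≤n+m k a)) (diag-≥ (pair a k)) ,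
    cong proj₁ (diag-pair a k)

  pair-inj : ∀ a b a' b' → pair a b ≡ pair a' b' → (a , b) ≡ (a' , b')
  pair-inj a b a' b' e = trans (sym (diag-pair a b)) (trans (cong diag e) (diag-pair a' b'))

  countable-Σ : {A : Set} {B : A → Set} → Countable A → (∀ a → Countable (B a)) → Countable (Σ A B)
  countable-Σ {A} {B} cA cB = record
    { enc = λ (a , b) → pair (Countable.enc cA a) (Countable.enc (cB a) b) ; enc-inj = inj }
    where
    inj : Injective {Σ A B} λ (a , b) → pair (Countable.enc cA a) (Countable.enc (cB a) b)
    inj {a , b} {a' , b'} e with pair-inj (Countable.enc cA a) (Countable.enc (cB a) b) (Countable.enc cA a') (Countable.enc (cB a') b') e
    ... | e' with Countable.enc-inj cA {a} {a'} (cong proj₁ e')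
    ...   | refl with Countable.enc-inj (cB a) {b} {b'} (cong proj₂ e')
    ...     | refl = refl

  -- Shortlex enumeration of all bit strings (least significant bit first).
  next : List Bool → List Bool
  next [] = false ∷ []
  next (false ∷ l) = true ∷ l
  next (true ∷ l) = false ∷ next l

  en : ℕ → List Bool
  en zero = []
  en (suc n) = next (en n)

  -- Bijective base two: `false` and `true` are the digits 1 and 2.
  idx : List Bool → ℕ
  idx [] = 0
  idx (false ∷ l) = suc (idx l + idx l)
  idx (true ∷ l) = suc (suc (idx l + idx l))

  en-odd : ∀ n → en (suc (n + n)) ≡ false ∷ en n
  en-odd zero = refl
  en-odd (suc n) rewrite +-suc n n | en-odd n = refl

  en-idx : ∀ l → en (idx l) ≡ l
  en-idx [] = refl
  en-idx (false ∷ l) = trans (en-odd (idx l)) (cong (false ∷_) (en-idx l))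
  en-idx (true ∷ l) = trans (cong next (en-odd (idx l))) (cong (true ∷_) (en-idx l))

  next-length : ∀ l → length l ≤ length (next l)
  next-length [] = z≤n
  next-length (false ∷ l) = ≤-refl
  next-length (true ∷ l) = s≤s (next-length l)

  -- Shortlex order is chosen for this: a later stage of the minimal bad array treats a string at
  -- least as long, so its reindexing, which fixes the numbers below that length, respects the
  -- earlier cylinders.
  en-mono : ∀ {m n} → m ≤ n → length (en m) ≤ length (en n)
  en-mono {m} {n} m≤n with m≤n⇒m<n∨m≡n m≤n
  ... | inj₂ refl = ≤-refl
  en-mono {m} {suc n} _ | inj₁ (s≤s p) = ≤-trans (en-mono p) (next-length (en n))

  infixr 5 _◂_
  _◂_ : ℕ → Pt → Pt
  (k ◂ X) zero = k
  (k ◂ X) (suc n) = X n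

  mono-◂ : ∀ {k X} → k < X 0 → Mono X → Mono (k ◂ X)
  mono-◂ {k} {X} p m = mono-step (k ◂ X) λ { zero → p ; (suc n) → m (n<1+n n) }

  _⊂_ : Pt → Pt → Set
  Y ⊂ M = ∀ i → Σ ℕ λ j → Y i ≡ M j

  ⊂-trans : ∀ {X Y Z} → X ⊂ Y → Y ⊂ Z → X ⊂ Z
  ⊂-trans p q i = let j , e = p i ; k , e' = q j in k , trans e e'

  ⊂-refl : ∀ {X} → X ⊂ X
  ⊂-refl i = i , refl

  ⊂-∘ : ∀ {M} φ → (M ∘ φ) ⊂ M
  ⊂-∘ φ i = φ i , refl

  ⊂-index : ∀ {Y M} → Mono Y → Mono M → (s : Y ⊂ M) → Mono (proj₁ ∘ s)
  ⊂-index {Y} {M} mY mM s i<j = mono-reflect mM (subst₂ _<_ (proj₂ (s _)) (proj₂ (s _)) (mY i<j))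

  ⊂-above : ∀ {Y M} → Mono Y → Mono M → (s : Y ⊂ M) → ∀ {i} j → proj₁ (s i) < proj₁ (s j) →
    Σ ℕ λ k → Y j ≡ tail M (proj₁ (s i)) k
  ⊂-above {Y} {M} mY mM s {i} j p = proj₁ (s j) ∸ suc (proj₁ (s i)) ,
    trans (proj₂ (s j)) (cong M (sym (m+[n∸m]≡n p)))

  ⊂-tails : ∀ {Y M} → Mono Y → Mono M → (s : Y ⊂ M) → ∀ i → tail Y i ⊂ tail M (proj₁ (s i))
  ⊂-tails mY mM s i j = ⊂-above mY mM s {i} (suc i + j) (⊂-index mY mM s (s≤s (m≤m+n i j)))

  -- Countability stands in for choice: the representative is the class member of least code.
  module Representatives {A : Set} (c : Countable A) (_∼_ : A → A → Set ℓ) (∼-refl : ∀ x → x ∼ x)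
    (∼-sym : ∀ {x y} → x ∼ y → y ∼ x) (∼-trans : ∀ {x y z} → x ∼ y → y ∼ z → x ∼ z) where

    open Countable c

    first : ∀ x → Σ ℕ λ n → (Σ A λ y → enc y ≡ n × x ∼ y) × (∀ m → m < n → ¬ (Σ A λ y → enc y ≡ m × x ∼ y))
    first x = least (λ n → Σ A λ y → enc y ≡ n × x ∼ y) (_ , x , refl , ∼-refl x)

    rep : A → A
    rep x = proj₁ (proj₁ (proj₂ (first x)))

    ∼rep : ∀ x → x ∼ rep x
    ∼rep x = proj₂ (proj₂ (proj₁ (proj₂ (first x))))

    rep-≤ : ∀ {x y} → x ∼ y → enc (rep x) ≤ enc (rep y)
    rep-≤ {x} {y} h = ≮⇒≥ λ l → proj₂ (proj₂ (first x)) _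
      (subst (enc (rep y) <_) (proj₁ (proj₂ (proj₁ (proj₂ (first x))))) l) (rep y , refl , ∼-trans h (∼rep y))

    rep-eq : ∀ {x y} → x ∼ y → rep x ≡ rep y
    rep-eq h = enc-inj (≤-antisym (rep-≤ h) (rep-≤ (∼-sym h)))

  -- Arrays and clopen sets on [ω]^ω

  -- A point stands for the infinite set that it enumerates increasingly; only Mono points matter.
  Above : ℕ → Pt → Set
  Above m X = Mono X × m ≤ X 0

  Agree : ℕ → Pt → Pt → Set
  Agree n X Y = ∀ i → i < n → X i ≡ Y i

  LC : {R : Set ℓ} → (Pt → R) → Set ℓ
  LC f = ∀ X → Mono X → Σ ℕ λ n → ∀ Y → Mono Y → Agree n X Y → f X ≡ f Y

  -- Points are compared entry by entry, and local constancy is what makes an array respect this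
  -- equality.
  lc-ext : {R : Set ℓ} {f : Pt → R} → LC f → ∀ {X Y} → Mono X → Mono Y → (∀ i → X i ≡ Y i) → f X ≡ f Y
  lc-ext lc {X} {Y} mX mY e = proj₂ (lc X mX) Y mY (λ i _ → e i)

  lc-∘ : {R : Set ℓ} {f : Pt → R} → LC f → ∀ {N} → Mono N → LC (λ X → f (N ∘ X))
  lc-∘ lc {N} mN X mX = let n , h = lc (N ∘ X) (mN ∘ mX) in n , λ Y mY a → h (N ∘ Y) (mN ∘ mY) λ i p → cong N (a i p)

  lc-map : {R : Set ℓ} {S : Set ℓ'} {f : Pt → R} (g : R → S) → LC f → LC (g ∘ f)
  lc-map g lc X mX = let n , h = lc X mX in n , λ Y mY a → cong g (h Y mY a)

  lc-shift : {R : Set ℓ} {f : Pt → R} → LC f → LC (λ X → f (X ∘ suc))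
  lc-shift lc X mX = let n , h = lc (X ∘ suc) (mono-shift mX) in
    suc n , λ Y mY a → h (Y ∘ suc) (mono-shift mY) λ i p → a (suc i) (s≤s p)

  lc-zip : {R : Set ℓ} {S : Set ℓ'} {U : Set ℓ″} {f : Pt → R} {g : Pt → S} (c : R → S → U) → LC f → LC g → LC (λ X → c (f X) (g X))
  lc-zip c lf lg X mX = let n , h = lf X mX ; n' , h' = lg X mX in
    n ⊔ℕ n' , λ Y mY a → cong₂ c (h Y mY λ i p → a i (<-≤-trans p (m≤m⊔n n n'))) (h' Y mY λ i p → a i (<-≤-trans p (m≤n⊔m n n')))

  -- The well-founded tree of a front: `done` where the value no longer depends on the rest of the
  -- point, `more` where it branches on the next entry. The number m bounds that entry from below.
  data Bar {R : Set ℓ} : ℕ → (Pt → R) → Set ℓ where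
    done : ∀ {m f} → (∀ X Y → Above m X → Above m Y → f X ≡ f Y) → Bar m f
    more : ∀ {m f} → (∀ k → m ≤ k → Bar (suc k) (λ X → f (k ◂ X))) → Bar m f

  -- Without a bar, entries can be chosen forever so that the sections stay unbarred. They form a
  -- point X, and local constancy at X makes one of these sections constant.
  bar : {R : Set ℓ} {f : Pt → R} → LC f → Bar 0 f
  bar {R = R} {f} lc = byContra escape
    where
    extend : ∀ {m} {g : Pt → R} → ¬ Bar m g → Σ ℕ λ k → m ≤ k × ¬ Bar (suc k) (λ X → g (k ◂ X))
    extend nb with ¬∀⇒∃¬ (nb ∘ more)
    ... | k , q with ¬∀⇒∃¬ q
    ...   | m≤k , q' = k , m≤k , q'
    escape : ¬ ¬ Bar 0 f
    escape nb = proj₂ (proj₂ (st n)) (done λ Y Z aY aZ →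
        trans (sym (h _ (p-mono n Y aY) (p-agree n Y))) (h _ (p-mono n Z aZ) (p-agree n Z)))
      where
      -- The map p prepends the entries chosen so far.
      st : ℕ → Σ ℕ λ m → Σ (Pt → Pt) λ p → ¬ Bar m (f ∘ p)
      st zero = 0 , id , nb
      st (suc n) with st n
      ... | m , p , q = let k , _ , q' = extend q in suc k , (λ X → p (k ◂ X)) , q'
      X : Pt
      X n = proj₁ (extend (proj₂ (proj₂ (st n))))
      X≥ : ∀ n → proj₁ (st n) ≤ X n
      X≥ n = proj₁ (proj₂ (extend (proj₂ (proj₂ (st n)))))
      p : ℕ → Pt → Pt
      p n = proj₁ (proj₂ (st n))
      p-mono : ∀ n Y → Above (proj₁ (st n)) Y → Mono (p n Y)
      p-mono zero Y a = proj₁ a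
      p-mono (suc n) Y (mY , a) = p-mono n (X n ◂ Y) (mono-◂ a mY , X≥ n)
      p-rest : ∀ n Y j → p n Y (n + j) ≡ Y j
      p-rest zero Y j = refl
      p-rest (suc n) Y j = trans (cong (p n (X n ◂ Y)) (sym (+-suc n j))) (p-rest n (X n ◂ Y) (suc j))
      p-agree : ∀ n Y → Agree n X (p n Y)
      p-agree (suc n) Y i (s≤s i≤n) with m≤n⇒m<n∨m≡n i≤n
      ... | inj₁ i<n = p-agree n (X n ◂ Y) i i<n
      ... | inj₂ refl = sym (trans (cong (p n (X n ◂ Y)) (sym (+-identityʳ n))) (p-rest n (X n ◂ Y) 0))
      mX : Mono X
      mX = mono-step X λ n → X≥ (suc n)
      n = proj₁ (lc X mX)
      h = proj₂ (lc X mX)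

  -- Diagonalisation: each stage drops the first entry of its set and thins the rest with respect to
  -- that entry; N collects the dropped entries. A tail of N lies inside the corresponding stage, so
  -- heredity carries `G` to it.
  module Fusion (m : ℕ) (G : ℕ → Pt → Set ℓ)
    (her : ∀ {k M M'} → Mono M → Mono M' → M' ⊂ M → G k M → G k M')
    (thin : ∀ k M → m ≤ k → Above (suc k) M → Σ Pt λ M' → Mono M' × M' ⊂ M × G k M')
    where
    fusion : ∀ M → Above m M → Σ Pt λ N → Mono N × N ⊂ M × (∀ i → G (N i) (tail N i))
    fusion M (mM , m≤M) = N , mN , (λ i → let j , e = ⊂-0 i 0 in j , e) ,
        λ i → her (proj₁ (proj₂ (st (suc i)))) (mono-tail i mN) (λ j → ⊂-+ (suc i) j 0) (good i)
      where
      mutual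
        st : ℕ → Σ Pt λ M → Mono M × m ≤ M 0
        st zero = M , mM , m≤M
        st (suc n) = let M' , m' , s , _ = step n in M' , m' ,
          ≤-trans (proj₂ (proj₂ (st n))) (subst (proj₁ (st n) 0 ≤_) (sym (proj₂ (s 0))) (mono-≤ (proj₁ (proj₂ (st n))) z≤n))
        step : ∀ n → Σ Pt λ M' → Mono M' × M' ⊂ (proj₁ (st n) ∘ suc) × G (proj₁ (st n) 0) M'
        step n = let M , mM , b = st n in thin (M 0) (M ∘ suc) b (mono-shift mM , mM (s≤s z≤n))
      N : Pt
      N n = proj₁ (st n) 0
      good : ∀ i → G (N i) (proj₁ (st (suc i)))
      good i = proj₂ (proj₂ (proj₂ (step i)))
      sub : ∀ i → proj₁ (st (suc i)) ⊂ (proj₁ (st i) ∘ suc)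
      sub i = proj₁ (proj₂ (proj₂ (step i)))
      ⊂-+ : ∀ i j → proj₁ (st (i + j)) ⊂ proj₁ (st i)
      ⊂-+ i zero = subst (λ x → proj₁ (st x) ⊂ proj₁ (st i)) (sym (+-identityʳ i)) ⊂-refl
      ⊂-+ i (suc j) = subst (λ x → proj₁ (st x) ⊂ proj₁ (st i)) (sym (+-suc i j))
        (⊂-trans (sub (i + j)) (⊂-trans (⊂-∘ suc) (⊂-+ i j)))
      ⊂-0 : ∀ i → proj₁ (st i) ⊂ M
      ⊂-0 i = ⊂-+ 0 i
      mN : Mono N
      mN = mono-step N λ n → subst (N n <_) (sym (proj₂ (sub n 0))) (proj₁ (proj₂ (st n)) (s≤s z≤n))

  -- Nash-Williams' partition theorem by induction on the bar. Fusion yields a set on which the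
  -- colour of a point depends only on its first entry, and the pigeonhole principle keeps
  -- infinitely many first entries of one colour.
  ramsey-bar : ∀ {m} {f : Pt → Bool} → Bar m f →
    (∀ X Y → Above m X → Above m Y → (∀ i → X i ≡ Y i) → f X ≡ f Y) → ∀ M → Above m M →
    Σ Pt λ N → Mono N × N ⊂ M × Σ Bool λ c → ∀ Y → Mono Y → Y ⊂ N → f Y ≡ c
  ramsey-bar {m} (done h) ext M (mM , b) = M , mM , ⊂-refl , _ , λ Y mY s →
    h Y M (mY , ≤-trans b (subst (M 0 ≤_) (sym (proj₂ (s 0))) (mono-≤ mM z≤n))) (mM , b)
  ramsey-bar {m} {f} (more h) ext M aM@(mM , b) = N ∘ φ , mN ∘ mφ , ⊂-trans (⊂-∘ φ) N⊂M , c , final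
    where
    G : ℕ → Pt → Set
    G k M = Σ Bool λ c → ∀ Y → Mono Y → Y ⊂ M → f (k ◂ Y) ≡ c
    thin : ∀ k M → m ≤ k → Above (suc k) M → Σ Pt λ M' → Mono M' × M' ⊂ M × G k M'
    thin k M m≤k aM = ramsey-bar (h k m≤k)
      (λ X Y (mX , bX) (mY , bY) e → ext (k ◂ X) (k ◂ Y) (mono-◂ bX mX , m≤k) (mono-◂ bY mY , m≤k)
        λ { zero → refl ; (suc i) → e i }) M aM
    fus = Fusion.fusion m G (λ _ _ s (c , g) → c , λ Y mY t → g Y mY (⊂-trans t s)) thin M aM
    N = proj₁ fus
    mN = proj₁ (proj₂ fus)
    N⊂M = proj₁ (proj₂ (proj₂ fus))
    col = proj₂ (proj₂ (proj₂ fus))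
    pg = pigeon (λ i → proj₁ (col i))
    c = proj₁ pg
    fr = frequently (λ i → proj₁ (col i) ≡ c) (proj₂ pg)
    φ = proj₁ fr
    mφ = proj₁ (proj₂ fr)
    final : ∀ Y → Mono Y → Y ⊂ (N ∘ φ) → f Y ≡ c
    final Y mY s = trans (ext Y (k ◂ (Y ∘ suc)) (mY , m≤Y) (mono-◂ k<Y (mono-shift mY) , subst (m ≤_) e m≤Y)
        λ { zero → e ; (suc i) → refl })
        (trans (proj₂ (col (φ j)) (Y ∘ suc) (mono-shift mY) Ys) (proj₂ (proj₂ fr) j))
      where
      j = proj₁ (s 0)
      k = N (φ j)
      e : Y 0 ≡ k
      e = proj₂ (s 0)
      k<Y : k < Y 1
      k<Y = subst (_< Y 1) e (mY (s≤s z≤n))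
      s' : Y ⊂ N
      s' = ⊂-trans s (⊂-∘ φ)
      Ys : (Y ∘ suc) ⊂ tail N (φ j)
      Ys i = ⊂-above mY mN s' {0} (suc i) (⊂-index mY mN s' (s≤s z≤n))
      m≤Y : m ≤ Y 0
      m≤Y = ≤-trans b (let l , e' = N⊂M (φ j) in subst (M 0 ≤_) (sym (trans e e')) (mono-≤ mM z≤n))

  ramsey : {P : Pt → Set ℓ} → LC P → Σ Pt λ N → Mono N ×
    ((∀ X → Mono X → P (N ∘ X)) ⊎ (∀ X → Mono X → ¬ P (N ∘ X)))
  ramsey {P = P} lc = finish (ramsey-bar (bar lc') (λ X Y aX aY → lc-ext lc' (proj₁ aX) (proj₁ aY)) id (id , z≤n))
    where
    lc' : LC (λ X → does (em (P X)))
    lc' = lc-map (λ A → does (em A)) lc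
    absurd : ¬ true ≡ false
    absurd ()
    finish : (Σ Pt λ N → Mono N × N ⊂ id × Σ Bool λ c → ∀ Y → Mono Y → Y ⊂ N → does (em (P Y)) ≡ c) →
      Σ Pt λ N → Mono N × ((∀ X → Mono X → P (N ∘ X)) ⊎ (∀ X → Mono X → ¬ P (N ∘ X)))
    finish (N , mN , _ , true , h) = N , mN , inj₁ λ X mX → byContra λ n →
      absurd (trans (sym (h (N ∘ X) (mN ∘ mX) (⊂-∘ X))) (dec-false (em _) n))
    finish (N , mN , _ , false , h) = N , mN , inj₂ λ X mX p →
      absurd (trans (sym (dec-true (em _) p)) (h (N ∘ X) (mN ∘ mX) (⊂-∘ X)))

  -- The case of sets that depend only on the first two points.
  ramsey₂ : (P : ℕ → ℕ → Set ℓ) → Σ Pt λ N → Mono N ×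
    ((∀ {i j} → i < j → P (N i) (N j)) ⊎ (∀ {i j} → i < j → ¬ P (N i) (N j)))
  ramsey₂ P with ramsey {P = λ X → P (X 0) (X 1)}
    (λ X _ → 2 , λ Y _ a → cong₂ P (a 0 (s≤s z≤n)) (a 1 (s≤s (s≤s z≤n))))
  ... | N , mN , r = N , mN , ready r
    where
    through : ∀ {i j} → i < j → Mono (i ◂ λ n → n + j)
    through {i} {j} p = mono-◂ p (+-monoˡ-< j)
    ready : ((∀ X → Mono X → P (N (X 0)) (N (X 1))) ⊎ (∀ X → Mono X → ¬ P (N (X 0)) (N (X 1)))) →
      ((∀ {i j} → i < j → P (N i) (N j)) ⊎ (∀ {i j} → i < j → ¬ P (N i) (N j)))
    ready (inj₁ h) = inj₁ λ p → h _ (through p)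
    ready (inj₂ h) = inj₂ λ p → h _ (through p)

  -- Minimal bad arrays

  mem : Pt → ℕ → Bool
  mem X i = does (em (Σ ℕ λ j → X j ≡ i))

  does-cong : {P : Set ℓ} {Q : Set ℓ'} → (P → Q) → (Q → P) → does (em P) ≡ does (em Q)
  does-cong {P = P} {Q} f g with em P | em Q
  ... | yes _ | yes _ = refl
  ... | yes p | no q = ⊥-elim (q (f p))
  ... | no p | yes q = ⊥-elim (p (g q))
  ... | no _ | no _ = refl

  -- Cylinders record the set that a point enumerates and not its first entries: n bits decide
  -- membership below n, and a reindexing that fixes the numbers below n preserves them.
  trace : Pt → ℕ → List Bool
  trace X zero = []
  trace X (suc n) = mem X n ∷ trace X n

  -- The point X belongs to the cylinder of σ: it meets [0, |σ|) in the set coded by σ.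
  In : List Bool → Pt → Set
  In σ X = trace X (length σ) ≡ σ

  trace-length : ∀ X n → length (trace X n) ≡ n
  trace-length X zero = refl
  trace-length X (suc n) = cong suc (trace-length X n)

  In-trace : ∀ X n → In (trace X n) X
  In-trace X n = cong (trace X) (trace-length X n)

  trace-cong : ∀ {X Y} n → (∀ i → i < n → mem X i ≡ mem Y i) → trace X n ≡ trace Y n
  trace-cong zero h = refl
  trace-cong (suc n) h = cong₂ _∷_ (h n (n<1+n n)) (trace-cong n λ i p → h i (m<n⇒m<1+n p))

  ∷-head : ∀ {a b : Bool} {s t} → a ∷ s ≡ b ∷ t → a ≡ b
  ∷-head refl = refl

  ∷-tail : ∀ {a b : Bool} {s t} → a ∷ s ≡ b ∷ t → s ≡ t
  ∷-tail refl = refl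

  trace-mem : ∀ {X Y} n → trace X n ≡ trace Y n → ∀ i → i < n → mem X i ≡ mem Y i
  trace-mem (suc n) e i (s≤s i≤n) with m≤n⇒m<n∨m≡n i≤n
  ... | inj₁ i<n = trace-mem n (∷-tail e) i i<n
  ... | inj₂ refl = ∷-head e

  mem-∈ : ∀ {X Y i} → mem X i ≡ mem Y i → (Σ ℕ λ j → X j ≡ i) → Σ ℕ λ j → Y j ≡ i
  mem-∈ {X} {Y} {i} e x with em (Σ ℕ λ j → Y j ≡ i)
  ... | yes y = y
  ... | no n with trans (sym (dec-true (em (Σ ℕ λ j → X j ≡ i)) x)) e
  ...   | ()

  agree-mem : ∀ {X Y n} → Mono X → Mono Y → Agree n X Y → ∀ i → i < n → mem X i ≡ mem Y i
  agree-mem {X} {Y} mX mY a i i<n = does-cong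
    (λ (j , e) → j , trans (sym (a j (≤-<-trans (mono-infl mX j) (subst (_< _) (sym e) i<n)))) e)
    (λ (j , e) → j , trans (a j (≤-<-trans (mono-infl mY j) (subst (_< _) (sym e) i<n))) e)

  -- Increasing maps are inflationary, so no entry from K upward is moved below K.
  fix-mem : ∀ {φ K} X → Mono φ → (∀ i → i < K → φ i ≡ i) → ∀ i → i < K → mem (φ ∘ X) i ≡ mem X i
  fix-mem {φ} {K} X mφ fx i i<K = does-cong
    (λ (j , e) → j , trans (sym (fx (X j) (≤-<-trans (mono-infl mφ (X j)) (subst (_< K) (sym e) i<K)))) e)
    (λ (j , e) → j , trans (cong φ e) (fx i i<K))

  -- Stage m treats the cylinder of en m: if a bad array below the current one, unchanged on
  -- the frozen cylinders, is strictly lower on that cylinder, pass to it; otherwise freeze the cylinder.  Passing reindexes by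
  -- a map fixing the numbers below |en m|, so the reindexings converge.  Well-foundedness puts every point in a frozen cylinder.
  module MinimalBadArray {R : Set ℓ} (_≼_ : R → R → Set ℓ') (_⊏_ : R → R → Set ℓ″)
    (≼-trans : ∀ {x y z} → x ≼ y → y ≼ z → x ≼ z) (⊏-trans : ∀ {x y z} → x ⊏ y → y ⊏ z → x ⊏ z)
    (⊏-wf : WellFounded _⊏_) (⊏⇒≼ : ∀ {x y} → x ⊏ y → x ≼ y) where

    Bad : (Pt → R) → Set ℓ'
    Bad f = ∀ X → Mono X → ¬ (f X ≼ f (X ∘ suc))

    _⊑_ : R → R → Set (ℓ ⊔ ℓ″)
    x ⊑ y = x ≡ y ⊎ x ⊏ y

    ⊑-trans : ∀ {x y z} → x ⊑ y → y ⊑ z → x ⊑ z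
    ⊑-trans (inj₁ refl) q = q
    ⊑-trans (inj₂ p) (inj₁ refl) = inj₂ p
    ⊑-trans (inj₂ p) (inj₂ q) = inj₂ (⊏-trans p q)

    ⊏-⊑-trans : ∀ {x y z} → x ⊏ y → y ⊑ z → x ⊏ z
    ⊏-⊑-trans p (inj₁ refl) = p
    ⊏-⊑-trans p (inj₂ q) = ⊏-trans p q

    no-descent : (a : ℕ → R) → (∀ n → a (suc n) ⊑ a n) → (∀ k → Σ ℕ λ m → k ≤ m × a (suc m) ⊏ a m) → ⊥
    no-descent a dec inf = go 0 (⊏-wf (a 0))
      where
      down : ∀ k j → a (k + j) ⊑ a k
      down k zero = inj₁ (cong a (+-identityʳ k))
      down k (suc j) = ⊑-trans (subst (λ x → a x ⊑ a (k + j)) (sym (+-suc k j)) (dec (k + j))) (down k j)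
      go : ∀ k → Acc _⊏_ (a k) → ⊥
      go k (acc rs) with inf k
      ... | m , k≤m , s = go (suc m) (rs (⊏-⊑-trans s (subst (λ x → a x ⊑ a k) (m+[n∸m]≡n k≤m) (down k (m ∸ k)))))

    record Stage : Set (lsuc lzero ⊔ ℓ ⊔ ℓ' ⊔ ℓ″) where
      field
        arr : Pt → R
        arr-lc : LC arr
        arr-bad : Bad arr
        Frozen : List Bool → Set

    record Lower (s : Stage) (σ : List Bool) : Set (ℓ ⊔ ℓ' ⊔ ℓ″) where
      open Stage s
      field
        φ : Pt
        φ-mono : Mono φ
        φ-fix : ∀ i → i < length σ → φ i ≡ i
        g : Pt → R
        g-lc : LC g
        g-bad : Bad g
        below : ∀ X → Mono X → g X ⊑ arr (φ ∘ X)
        same : ∀ τ X → Frozen τ → Mono X → In τ X → g X ≡ arr (φ ∘ X)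
        strict : ∀ X → Mono X → In σ X → g X ⊏ arr (φ ∘ X)

    module Construction (f₀ : Pt → R) (lc₀ : LC f₀) (bad₀ : Bad f₀) where

      open Stage

      advance : ∀ s σ → Dec (Lower s σ) → Stage
      advance s σ (yes l) = record { arr = Lower.g l ; arr-lc = Lower.g-lc l ; arr-bad = Lower.g-bad l ; Frozen = Frozen s }
      advance s σ (no _) = record { arr = arr s ; arr-lc = arr-lc s ; arr-bad = arr-bad s ; Frozen = λ τ → Frozen s τ ⊎ τ ≡ σ }

      stage : ℕ → Stage
      stage zero = record { arr = f₀ ; arr-lc = lc₀ ; arr-bad = bad₀ ; Frozen = λ _ → ⊥ }
      stage (suc m) = advance (stage m) (en m) (em (Lower (stage m) (en m)))

      f : ℕ → Pt → R
      f m = arr (stage m)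

      Fr : ℕ → List Bool → Set
      Fr m = Frozen (stage m)

      Low : ℕ → Set _
      Low m = Lower (stage m) (en m)

      move-of : ∀ {m} → Dec (Low m) → Pt
      move-of (yes l) = Lower.φ l
      move-of (no _) = id

      move : ℕ → Pt
      move m = move-of {m} (em (Low m))

      K : ℕ → ℕ
      K m = length (en m)

      move-mono : ∀ m → Mono (move m)
      move-mono m with em (Low m)
      ... | yes l = Lower.φ-mono l
      ... | no _ = id

      move-fix : ∀ m i → i < K m → move m i ≡ i
      move-fix m i p with em (Low m)
      ... | yes l = Lower.φ-fix l i p
      ... | no _ = refl

      step-⊑ : ∀ m X → Mono X → f (suc m) X ⊑ f m (move m ∘ X)
      step-⊑ m X mX with em (Low m)
      ... | yes l = Lower.below l X mX
      ... | no _ = inj₁ refl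

      step-frozen : ∀ m τ X → Fr m τ → Mono X → In τ X → f (suc m) X ≡ f m (move m ∘ X)
      step-frozen m τ X fr mX i with em (Low m)
      ... | yes l = Lower.same l τ X fr mX i
      ... | no _ = refl

      step-idle : ∀ m X → ¬ Low m → f (suc m) X ≡ f m (move m ∘ X)
      step-idle m X nl with em (Low m)
      ... | yes l = ⊥-elim (nl l)
      ... | no _ = refl

      step-strict : ∀ m X → Low m → Mono X → In (en m) X → f (suc m) X ⊏ f m (move m ∘ X)
      step-strict m X lo mX i with em (Low m)
      ... | yes l = Lower.strict l X mX i
      ... | no n = ⊥-elim (n lo)

      frozen-keep : ∀ m {τ} → Fr m τ → Fr (suc m) τ
      frozen-keep m fr with em (Low m)
      ... | yes l = fr
      ... | no _ = inj₁ fr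

      frozen-new : ∀ m → ¬ Low m → Fr (suc m) (en m)
      frozen-new m nl with em (Low m)
      ... | yes l = ⊥-elim (nl l)
      ... | no _ = inj₂ refl

      frozen-src : ∀ m {τ} → Fr m τ → Σ ℕ λ j → j < m × τ ≡ en j × ¬ Low j
      frozen-src (suc m) fr with em (Low m)
      frozen-src (suc m) fr | yes l = let j , p , q = frozen-src m fr in j , m<n⇒m<1+n p , q
      frozen-src (suc m) (inj₁ fr) | no _ = let j , p , q = frozen-src m fr in j , m<n⇒m<1+n p , q
      frozen-src (suc m) (inj₂ e) | no nl = m , n<1+n m , e , nl

      frozen-length : ∀ m {τ} → Fr m τ → length τ ≤ K m
      frozen-length m fr with frozen-src m fr
      ... | j , j<m , refl , _ = en-mono (<⇒≤ j<m)

      -- The first stage whose string is longer than i; from then on every move fixes i.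
      time : ℕ → ℕ
      time i = idx (replicate (suc i) false)

      move-late : ∀ n i → time i ≤ n → move n i ≡ i
      move-late n i t = move-fix n i (subst (_≤ K n)
        (trans (cong length (en-idx (replicate (suc i) false))) (length-replicate (suc i))) (en-mono t))

      comp : ℕ → ℕ → Pt
      comp m zero = id
      comp m (suc j) = move m ∘ comp (suc m) j

      comp-mono : ∀ m j → Mono (comp m j)
      comp-mono m zero = id
      comp-mono m (suc j) = move-mono m ∘ comp-mono (suc m) j

      comp-snoc : ∀ m j i → comp m (suc j) i ≡ comp m j (move (m + j) i)
      comp-snoc m zero i = cong (λ x → move x i) (sym (+-identityʳ m))
      comp-snoc m (suc j) i = cong (move m) (trans (comp-snoc (suc m) j i)
        (cong (λ x → comp (suc m) j (move x i)) (sym (+-suc m j))))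

      comp-stable : ∀ m i j → comp m (time i + j) i ≡ comp m (time i) i
      comp-stable m i zero = cong (λ x → comp m x i) (+-identityʳ (time i))
      comp-stable m i (suc j) = trans (cong (λ x → comp m x i) (+-suc (time i) j))
        (trans (comp-snoc m (time i + j) i) (trans (cong (comp m (time i + j))
          (move-late _ i (≤-trans (m≤m+n (time i) j) (m≤n+m _ m)))) (comp-stable m i j)))

      comp-fix : ∀ m j i → i < K m → comp m j i ≡ i
      comp-fix m zero i p = refl
      comp-fix m (suc j) i p = trans (cong (move m) (comp-fix (suc m) j i (<-≤-trans p (next-length (en m))))) (move-fix m i p)

      -- The composite of all moves from stage m on. It converges because at i only the first
      -- `time i` factors matter.
      Φ : ℕ → Pt
      Φ m i = comp m (time i) i

      Φ-late : ∀ m i k → time i ≤ k → Φ m i ≡ comp m k i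
      Φ-late m i k t = sym (trans (cong (λ x → comp m x i) (sym (m+[n∸m]≡n t))) (comp-stable m i (k ∸ time i)))

      Φ-mono : ∀ m → Mono (Φ m)
      Φ-mono m {i} {j} p = subst₂ _<_ (sym (Φ-late m i k (m≤m⊔n (time i) (time j)))) (sym (Φ-late m j k (m≤n⊔m (time i) (time j))))
        (comp-mono m k p)
        where k = time i ⊔ℕ time j

      Φ-step : ∀ m i → move m (Φ (suc m) i) ≡ Φ m i
      Φ-step m i = sym (Φ-late m i (suc (time i)) (n≤1+n _))

      Φ-fix : ∀ m i → i < K m → Φ m i ≡ i
      Φ-fix m i = comp-fix m (time i) i

      In-fix : ∀ {φ} τ n X → Mono φ → (∀ i → i < n → φ i ≡ i) → length τ ≤ n → In τ X → In τ (φ ∘ X)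
      In-fix τ n X mφ fx le = trans (trace-cong (length τ) λ i p → fix-mem X mφ fx i (<-≤-trans p le))

      In-Φ : ∀ τ m X → length τ ≤ K m → In τ X → In τ (Φ m ∘ X)
      In-Φ τ m X = In-fix τ (K m) X (Φ-mono m) (Φ-fix m)

      -- The array of stage m seen through all later reindexings, so that all stages can be compared
      -- at one and the same point.
      v : ℕ → Pt → R
      v m X = f m (Φ m ∘ X)

      v-eq : ∀ m X → Mono X → f m (move m ∘ Φ (suc m) ∘ X) ≡ v m X
      v-eq m X mX = lc-ext (arr-lc (stage m)) (move-mono m ∘ Φ-mono (suc m) ∘ mX) (Φ-mono m ∘ mX) λ i → Φ-step m (X i)

      v-step : ∀ m X → Mono X → v (suc m) X ⊑ v m X
      v-step m X mX = subst (v (suc m) X ⊑_) (v-eq m X mX) (step-⊑ m (Φ (suc m) ∘ X) (Φ-mono (suc m) ∘ mX))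

      v-≥ : ∀ {m n} X → Mono X → m ≤ n → v n X ⊑ v m X
      v-≥ {m} {n} X mX m≤n with m≤n⇒m<n∨m≡n m≤n
      ... | inj₂ refl = inj₁ refl
      v-≥ {m} {suc n} X mX _ | inj₁ (s≤s p) = ⊑-trans (v-step n X mX) (v-≥ X mX p)

      v-frozen : ∀ {m n} τ X → Mono X → Fr m τ → In τ X → m ≤ n → Fr n τ × v n X ≡ v m X
      v-frozen {m} {n} τ X mX fr i m≤n with m≤n⇒m<n∨m≡n m≤n
      ... | inj₂ refl = fr , refl
      v-frozen {m} {suc n} τ X mX fr i _ | inj₁ (s≤s p) with v-frozen τ X mX fr i p
      ... | fr' , e = frozen-keep n fr' , trans (step-frozen n τ (Φ (suc n) ∘ X) fr' (Φ-mono (suc n) ∘ mX)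
              (In-Φ τ (suc n) X (≤-trans (frozen-length n fr') (next-length (en n))) i)) (trans (v-eq n X mX) e)

      Cov : Pt → Set _
      Cov X = Σ ℕ λ m → ¬ Low m × In (en m) X

      v-cov : ∀ {n} X → Mono X → ((m , _) : Cov X) → m ≤ n → v n X ≡ v m X
      v-cov {n} X mX (m , nl , i) m≤n with m≤n⇒m<n∨m≡n m≤n
      ... | inj₂ refl = refl
      ... | inj₁ m<n = trans (proj₂ (v-frozen (en m) X mX (frozen-new m nl) i m<n))
              (trans (step-idle m (Φ (suc m) ∘ X) nl) (v-eq m X mX))

      cover : ∀ X → Mono X → Cov X
      cover X mX = byContra λ nc → no-descent (λ n → v n X) (λ n → v-step n X mX) (inf nc)
        where
        inf : ¬ Cov X → ∀ k → Σ ℕ λ m → k ≤ m × v (suc m) X ⊏ v m X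
        inf nc k = m , k≤m , subst (v (suc m) X ⊏_) (v-eq m X mX) (step-strict m (Φ (suc m) ∘ X)
            (byContra λ nl → nc (m , nl , i)) (Φ-mono (suc m) ∘ mX) (In-Φ (en m) (suc m) X (next-length (en m)) i))
          where
          -- A cylinder around X with a string longer than that of stage k, hence treated after
          -- stage k.
          m = idx (trace X (suc (K k)))
          i : In (en m) X
          i = subst (λ σ → In σ X) (sym (en-idx _)) (In-trace X (suc (K k)))
          long : K m ≡ suc (K k)
          long = trans (cong length (en-idx (trace X (suc (K k))))) (trace-length X (suc (K k)))
          k≤m : k ≤ m
          k≤m = ≮⇒≥ λ m<k → <-irrefl refl (subst (_≤ K k) long (en-mono (<⇒≤ m<k)))

      lim-of : ∀ X → Dec (Cov X) → R
      lim-of X (yes (m , _)) = v m X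
      -- A default for functions that are not increasing.
      lim-of X (no _) = v 0 X

      lim : Pt → R
      lim X = lim-of X (em (Cov X))

      lim-eq : ∀ {n} X → Mono X → ((m , _) : Cov X) → m ≤ n → lim X ≡ v n X
      lim-eq {n} X mX c@(m , _) m≤n with em (Cov X)
      ... | no nc = ⊥-elim (nc c)
      ... | yes c'@(m' , _) = trans (sym (v-cov X mX c' (m≤m⊔n m' n)))
              (trans (v-cov X mX c (≤-trans m≤n (m≤n⊔m m' n))) (sym (v-cov X mX c m≤n)))

      lim-lc : LC lim
      lim-lc X mX = n ⊔ℕ K m , λ Y mY a →
          let i' = trans (sym (trace-cong (K m) λ j p → agree-mem mX mY a j (<-≤-trans p (m≤n⊔m n (K m))))) i
          in trans (lim-eq X mX c ≤-refl) (trans (h (Φ m ∘ Y) (Φ-mono m ∘ mY) λ j p → cong (Φ m) (a j (<-≤-trans p (m≤m⊔n n (K m)))))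
            (sym (lim-eq Y mY (m , nl , i') ≤-refl)))
        where
        c = cover X mX
        m = proj₁ c
        nl = proj₁ (proj₂ c)
        i = proj₂ (proj₂ c)
        n = proj₁ (arr-lc (stage m) (Φ m ∘ X) (Φ-mono m ∘ mX))
        h = proj₂ (arr-lc (stage m) (Φ m ∘ X) (Φ-mono m ∘ mX))

      lim-bad : Bad lim
      lim-bad X mX p = go (cover X mX) (cover (X ∘ suc) (mono-shift mX))
        where
        go : Cov X → Cov (X ∘ suc) → ⊥
        go c@(m , _) c'@(m' , _) = arr-bad (stage (m ⊔ℕ m')) (Φ (m ⊔ℕ m') ∘ X) (Φ-mono (m ⊔ℕ m') ∘ mX)
          (subst₂ _≼_ (lim-eq X mX c (m≤m⊔n m m')) (lim-eq (X ∘ suc) (mono-shift mX) c' (m≤n⊔m m m')) p)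

      Compat : Pt → ℕ → Set _
      Compat c m = ¬ Low m × Σ Pt λ Y → Mono Y × In (en m) (c ∘ Y)

      -- An array g strictly below the limit on the set c would have been found at the first stage m that froze a cylinder
      -- meeting c: take g on c, and the limit elsewhere.
      module Mixture (c : Pt) (g : Pt → R) (mc : Mono c) (lg : LC g) (bg : Bad g)
        (lower : ∀ X → Mono X → g X ⊏ lim (c ∘ X))
        (m : ℕ) (Y₀ : Pt) (iY₀ : In (en m) (c ∘ Y₀)) (earliest : ∀ j → j < m → ¬ Compat c j) where
        k = K m
        -- The identity below k and c from k on: it respects cylinders of length at most k, and it
        -- sends the points of the cylinder of `en m` to subsets of c.
        φ-of : ∀ i → Dec (i < k) → ℕ
        φ-of i (yes _) = i
        φ-of i (no _) = c i
        φ : Pt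
        φ i = φ-of i (i <? k)
        φ-low : ∀ i → i < k → φ i ≡ i
        φ-low i p with i <? k
        ... | yes _ = refl
        ... | no n = ⊥-elim (n p)
        φ-high : ∀ i → k ≤ i → φ i ≡ c i
        φ-high i p with i <? k
        ... | yes q = ⊥-elim (<-irrefl refl (<-≤-trans q p))
        ... | no _ = refl
        mφ : Mono φ
        mφ {i} {j} p with i <? k | j <? k
        ... | yes _ | yes _ = p
        ... | yes _ | no _ = <-≤-trans p (mono-infl mc j)
        ... | no n | yes q = ⊥-elim (n (<-trans p q))
        ... | no _ | no _ = mc p
        index : ∀ {X} → Mono X → (s : (φ ∘ X) ⊂ c) → Mono (proj₁ ∘ s)
        index mX s = ⊂-index (mφ ∘ mX) mc s
        G-of : ∀ X → Dec ((φ ∘ X) ⊂ c) → R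
        G-of X (yes s) = g (proj₁ ∘ s)
        G-of X (no _) = lim (φ ∘ X)
        G : Pt → R
        G X = G-of X (em ((φ ∘ X) ⊂ c))
        G-yes : ∀ X → Mono X → (s : (φ ∘ X) ⊂ c) → G X ≡ g (proj₁ ∘ s)
        G-yes X mX s with em ((φ ∘ X) ⊂ c)
        ... | no n = ⊥-elim (n s)
        ... | yes s' = lc-ext lg (index mX s') (index mX s) λ i → mono-inj mc (trans (sym (proj₂ (s' i))) (proj₂ (s i)))
        G-no : ∀ X → ¬ ((φ ∘ X) ⊂ c) → G X ≡ lim (φ ∘ X)
        G-no X n with em ((φ ∘ X) ⊂ c)
        ... | no _ = refl
        ... | yes s = ⊥-elim (n s)
        lower' : ∀ X → Mono X → (s : (φ ∘ X) ⊂ c) → g (proj₁ ∘ s) ⊏ lim (φ ∘ X)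
        lower' X mX s = subst (g (proj₁ ∘ s) ⊏_) (lc-ext lim-lc (mc ∘ index mX s) (mφ ∘ mX) λ i → sym (proj₂ (s i)))
          (lower (proj₁ ∘ s) (index mX s))
        carry : ∀ {X Y} → Mono Y → Agree k X Y → (φ ∘ X) ⊂ c → (φ ∘ Y) ⊂ c
        carry {X} {Y} mY a s i with i <? k
        ... | yes p = subst (λ x → Σ ℕ λ j → φ x ≡ c j) (a i p) (s i)
        ... | no n = Y i , φ-high (Y i) (≤-trans (≮⇒≥ n) (mono-infl mY i))
        G-lc : LC G
        G-lc X mX with em ((φ ∘ X) ⊂ c)
        ... | yes s = let n , h = lg (proj₁ ∘ s) (index mX s) in n ⊔ℕ k , λ Y mY a →
                let s' = carry mY (λ i p → a i (<-≤-trans p (m≤n⊔m n k))) s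
                in trans (h (proj₁ ∘ s') (index mY s') λ i p → mono-inj mc (trans (sym (proj₂ (s i)))
                     (trans (cong φ (a i (<-≤-trans p (m≤m⊔n n k)))) (proj₂ (s' i))))) (sym (G-yes Y mY s'))
        ... | no ns = let n , h = lc-∘ lim-lc mφ X mX in n ⊔ℕ k , λ Y mY a →
                trans (h Y mY λ i p → a i (<-≤-trans p (m≤m⊔n n k)))
                  (sym (G-no Y λ s → ns (carry mX (λ i p → sym (a i (<-≤-trans p (m≤n⊔m n k)))) s)))
        G-bad : Bad G
        G-bad X mX p = decide (em ((φ ∘ X) ⊂ c)) (em ((φ ∘ X ∘ suc) ⊂ c))
          where
          mX' = mono-shift mX
          decide : Dec ((φ ∘ X) ⊂ c) → Dec ((φ ∘ X ∘ suc) ⊂ c) → ⊥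
          decide (yes s) _ = bg (proj₁ ∘ s) (index mX s) (subst₂ _≼_ (G-yes X mX s) (G-yes (X ∘ suc) mX' (s ∘ suc)) p)
          -- The only mixed case, since a subset of c stays one without its first entry. The value
          -- of g lies below the limit, so the limit itself would be good at φ ∘ X.
          decide (no n) (yes s) = lim-bad (φ ∘ X) (mφ ∘ mX)
            (≼-trans (subst₂ _≼_ (G-no X n) (G-yes (X ∘ suc) mX' s) p) (⊏⇒≼ (lower' (X ∘ suc) mX' s)))
          decide (no n) (no n') = lim-bad (φ ∘ X) (mφ ∘ mX) (subst₂ _≼_ (G-no X n) (G-no (X ∘ suc) n') p)
        lim⊑v : ∀ X → Mono X → lim X ⊑ v m X
        lim⊑v X mX = let c' = cover X mX in subst (_⊑ v m X) (sym (lim-eq X mX c' (m≤m⊔n _ m))) (v-≥ X mX (m≤n⊔m (proj₁ c') m))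
        G⊑v : ∀ X → Mono X → G X ⊑ v m (φ ∘ X)
        G⊑v X mX with em ((φ ∘ X) ⊂ c)
        ... | yes s = inj₂ (⊏-⊑-trans (lower' X mX s) (lim⊑v (φ ∘ X) (mφ ∘ mX)))
        ... | no _ = lim⊑v (φ ∘ X) (mφ ∘ mX)
        same : ∀ τ X → Fr m τ → Mono X → In τ X → G X ≡ v m (φ ∘ X)
        same τ X fr mX i with frozen-src m fr
        -- A point of a cylinder frozen at an earlier stage j is not sent into c, for then c would
        -- meet that cylinder, against the choice of m.
        ... | j , j<m , refl , nlj = trans (G-no X λ s → earliest j j<m (nlj , proj₁ ∘ s , index mX s ,
                trans (trace-cong (K j) λ l _ → does-cong (λ (a , e) → a , trans (proj₂ (s a)) e)
                  (λ (a , e) → a , trans (sym (proj₂ (s a))) e)) i'))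
                (lim-eq (φ ∘ X) (mφ ∘ mX) (j , nlj , i') (<⇒≤ j<m))
          where
          i' : In (en j) (φ ∘ X)
          i' = In-fix (en j) k X mφ φ-low (en-mono (<⇒≤ j<m)) i
        within : ∀ X → Mono X → In (en m) X → (φ ∘ X) ⊂ c
        within X mX i a = at (X a <? k)
          where
          at : Dec (X a < k) → Σ ℕ λ j → φ (X a) ≡ c j
          at (yes p) = let b , e = mem-∈ {X} {c ∘ Y₀} (trace-mem k (trans i (sym iY₀)) (X a) p) (a , refl)
                       in Y₀ b , trans (φ-low (X a) p) (sym e)
          at (no n) = X a , φ-high (X a) (≮⇒≥ n)
        strict : ∀ X → Mono X → In (en m) X → G X ⊏ v m (φ ∘ X)
        strict X mX i = let s = within X mX i in subst (_⊏ v m (φ ∘ X)) (sym (G-yes X mX s))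
          (⊏-⊑-trans (lower' X mX s) (lim⊑v (φ ∘ X) (mφ ∘ mX)))
        low : Low m
        low = record { φ = Φ m ∘ φ ; φ-mono = Φ-mono m ∘ mφ
          ; φ-fix = λ i p → trans (cong (Φ m) (φ-low i p)) (Φ-fix m i p)
          ; g = G ; g-lc = G-lc ; g-bad = G-bad ; below = G⊑v ; same = same ; strict = strict }

      lim-min : ∀ c g → Mono c → LC g → Bad g → ¬ (∀ X → Mono X → g X ⊏ lim (c ∘ X))
      lim-min c g mc lg bg lower =
        let m , (nl , Y₀ , _ , i) , earliest = least (Compat c) (let m , nl , i = cover c mc in m , nl , id , id , i)
        in nl (Mixture.low c g mc lg bg lower m Y₀ i earliest)

    minimal-bad : ∀ f → LC f → Bad f → Σ (Pt → R) λ g → LC g × Bad g ×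
      (∀ c h → Mono c → LC h → Bad h → ¬ (∀ X → Mono X → h X ⊏ g (c ∘ X)))
    minimal-bad f lf bf = lim , lim-lc , lim-bad , lim-min
      where open Construction f lf bf

  -- Sequences and trees

  data Lex {A : Set} {B : A → Set} (_<A_ : A → A → Set) (_<B_ : ∀ a → B a → B a → Set) : Σ A B → Σ A B → Set where
    outer : ∀ {a b a' b'} → a <A a' → Lex _<A_ _<B_ (a , b) (a' , b')
    inner : ∀ {a b b'} → _<B_ a b b' → Lex _<A_ _<B_ (a , b) (a , b')

  module _ {A : Set} {B : A → Set} {_<A_ : A → A → Set} {_<B_ : ∀ a → B a → B a → Set} where

    Lex-irrefl : (∀ a → ¬ a <A a) → (∀ a (b : B a) → ¬ _<B_ a b b) → ∀ p → ¬ Lex _<A_ _<B_ p p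
    Lex-irrefl iA iB p (outer h) = iA _ h
    Lex-irrefl iA iB p (inner h) = iB _ _ h

    Lex-trans : (∀ {a b c} → a <A b → b <A c → a <A c) → (∀ a {x y z : B a} → _<B_ a x y → _<B_ a y z → _<B_ a x z) →
      ∀ {p q s} → Lex _<A_ _<B_ p q → Lex _<A_ _<B_ q s → Lex _<A_ _<B_ p s
    Lex-trans tA tB (outer h) (outer k) = outer (tA h k)
    Lex-trans tA tB (outer h) (inner k) = outer h
    Lex-trans tA tB (inner h) (outer k) = outer k
    Lex-trans tA tB (inner h) (inner k) = inner (tB _ h k)

    Lex-tri : (∀ a b → a <A b ⊎ (a ≡ b ⊎ b <A a)) → (∀ a (x y : B a) → _<B_ a x y ⊎ (x ≡ y ⊎ _<B_ a y x)) →
      ∀ p q → Lex _<A_ _<B_ p q ⊎ (p ≡ q ⊎ Lex _<A_ _<B_ q p)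
    Lex-tri tA tB (a , x) (b , y) with tA a b
    ... | inj₁ h = inj₁ (outer h)
    ... | inj₂ (inj₂ h) = inj₂ (inj₂ (outer h))
    ... | inj₂ (inj₁ refl) with tB a x y
    ...   | inj₁ h = inj₁ (inner h)
    ...   | inj₂ (inj₁ refl) = inj₂ (inj₁ refl)
    ...   | inj₂ (inj₂ h) = inj₂ (inj₂ (inner h))

    Lex-wf : WellFounded _<A_ → (∀ a → WellFounded (_<B_ a)) → WellFounded (Lex _<A_ _<B_)
    Lex-wf wA wB (a , b) = go a (wA a) b (wB a b)
      where
      go : ∀ a → Acc _<A_ a → ∀ b → Acc (_<B_ a) b → Acc (Lex _<A_ _<B_) (a , b)
      go' : ∀ a → Acc _<A_ a → ∀ b → Acc (_<B_ a) b → ∀ {q} → Lex _<A_ _<B_ q (a , b) → Acc (Lex _<A_ _<B_) q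
      go a x b y = acc (go' a x b y)
      go' a (acc rs) b y {a' , b'} (outer h) = go a' (rs h) b' (wB a' b')
      go' a x b (acc rs) {_ , b'} (inner h) = go a x b' (rs h)

  sumOrd : (ℕ → CtblOrd) → CtblOrd
  sumOrd F = record
    { Carrier = Σ ℕ λ n → CtblOrd.Carrier (F n)
    ; countable = countable-Σ (record { enc = id ; enc-inj = id }) (λ n → CtblOrd.countable (F n))
    ; _<_ = Lex _<_ (λ n → CtblOrd._<_ (F n))
    ; irrefl = Lex-irrefl (λ n → <-irrefl refl) (λ n → CtblOrd.irrefl (F n))
    ; trans = Lex-trans <-trans (λ n → CtblOrd.trans (F n))
    ; trichot = Lex-tri <-tri (λ n → CtblOrd.trichot (F n))
    ; wf = Lex-wf <-wellFounded (λ n → CtblOrd.wf (F n))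
    }
    where
    <-tri : ∀ m n → m < n ⊎ (m ≡ n ⊎ n < m)
    <-tri m n with <-cmp m n
    ... | tri< p _ _ = inj₁ p
    ... | tri≈ _ p _ = inj₂ (inj₁ p)
    ... | tri> _ _ p = inj₂ (inj₂ p)

  unitOrd : CtblOrd
  unitOrd = record
    { Carrier = ⊤ ; countable = record { enc = λ _ → 0 ; enc-inj = λ _ → refl } ; _<_ = λ _ _ → ⊥
    ; irrefl = λ _ () ; trans = λ () ; trichot = λ _ _ → inj₂ (inj₁ refl) ; wf = λ _ → acc λ () }

  sumSeq : {Q : Set ℓ} → (ℕ → Seq Q) → Seq Q
  sumSeq F = sumOrd (proj₁ ∘ F) , λ (n , x) → proj₂ (F n) x

  SeqEmb : {Q : Set ℓ} → (Q → Q → Set ℓ') → Seq Q → Seq Q → Set ℓ'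
  SeqEmb r (α , f) (β , g) = Σ (CtblOrd.Carrier α → CtblOrd.Carrier β) λ h →
    (∀ x y → CtblOrd._<_ α x y → CtblOrd._<_ β (h x) (h y)) × (∀ γ → r (f γ) (g (h γ)))

  data Tree (Q : Set ℓ) : Set ℓ where
    leaf : Q → Tree Q
    node : (ℕ → Tree Q) → Tree Q

  -- The domination order on hereditarily countable sets with atoms from Q: each element of the
  -- smaller set lies below an element of the larger one.
  TreeLe : {Q : Set ℓ} → (Q → Q → Set ℓ') → Tree Q → Tree Q → Set ℓ'
  TreeLe r (leaf x) (leaf y) = r x y
  TreeLe r (leaf x) (node v) = Σ ℕ λ j → TreeLe r (leaf x) (v j)
  TreeLe r (node u) (leaf y) = Lift _ ⊥
  TreeLe r (node u) (node v) = ∀ i → Σ ℕ λ j → TreeLe r (u i) (v j)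

  -- A hereditarily indecomposable sequence: every child of a node is repeated cofinally.
  seqOf : {Q : Set ℓ} → Tree Q → Seq Q
  seqOf (leaf q) = unitOrd , λ _ → q
  seqOf (node u) = sumSeq λ n → seqOf (u (recur n))

  Pos : {Q : Set ℓ} → Tree Q → Set
  Pos x = CtblOrd.Carrier (proj₁ (seqOf x))

  first-pos : {Q : Set ℓ} (x : Tree Q) → Pos x
  first-pos (leaf q) = tt
  first-pos (node u) = 0 , first-pos (u (recur 0))

  module _ {Q : Set ℓ} where


    block-≤ : (G : ℕ → Seq Q) → ∀ p q → CtblOrd._<_ (proj₁ (sumSeq G)) p q → proj₁ p ≤ proj₁ q
    block-≤ G p q (outer h) = <⇒≤ h
    block-≤ G p q (inner h) = ≤-refl

    into : (G : ℕ → Seq Q) → ∀ {n} (p : CtblOrd.Carrier (proj₁ (sumSeq G))) → proj₁ p ≡ n → CtblOrd.Carrier (proj₁ (G n))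
    into G p refl = proj₂ p

    into-mono : (G : ℕ → Seq Q) → ∀ {n} p q (e : proj₁ p ≡ n) (e' : proj₁ q ≡ n) → CtblOrd._<_ (proj₁ (sumSeq G)) p q →
      CtblOrd._<_ (proj₁ (G n)) (into G p e) (into G q e')
    into-mono G p q refl e' (outer h) = ⊥-elim (<-irrefl (sym e') h)
    into-mono G p q refl refl (inner h) = h

    into-lab : (G : ℕ → Seq Q) → ∀ {n} p (e : proj₁ p ≡ n) → proj₂ (G n) (into G p e) ≡ proj₂ (sumSeq G) p
    into-lab G p refl = refl

    cast : (F : ℕ → Seq Q) → ∀ {i j} → i ≡ j → CtblOrd.Carrier (proj₁ (F i)) → CtblOrd.Carrier (proj₁ (F j))
    cast F refl x = x

    cast-mono : (F : ℕ → Seq Q) → ∀ {i j} (e : i ≡ j) x y → CtblOrd._<_ (proj₁ (F i)) x y →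
      CtblOrd._<_ (proj₁ (F j)) (cast F e x) (cast F e y)
    cast-mono F refl x y h = h

    cast-lab : (F : ℕ → Seq Q) → ∀ {i j} (e : i ≡ j) x → proj₂ (F j) (cast F e x) ≡ proj₂ (F i) x
    cast-lab F refl x = refl

    -- Each child recurs beyond every block, so block n can be sent to a later block holding the
    -- same child.
    self-tail : (u : ℕ → Tree Q) (n₀ : ℕ) → Σ (SeqEmb _≡_ (seqOf (node u)) (seqOf (node u))) λ t → ∀ γ → n₀ < proj₁ (proj₁ t γ)
    self-tail u n₀ = (t , mono , lab) , λ γ → proj₂ (ok (proj₁ γ))
      where
      gr = greedy (λ n m → recur n ≡ recur m × n₀ < m)
        (λ n k → let m , le , e = recur-inf (recur n) (suc n₀ ⊔ℕ k) in
          m , ≤-trans (m≤n⊔m (suc n₀) k) le , sym e , ≤-trans (m≤m⊔n (suc n₀) k) le)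
      τ = proj₁ gr
      ok = proj₂ (proj₂ gr)
      t : Pos (node u) → Pos (node u)
      t (n , x) = τ n , cast (seqOf ∘ u) (proj₁ (ok n)) x
      mono : ∀ x y → CtblOrd._<_ (proj₁ (seqOf (node u))) x y → CtblOrd._<_ (proj₁ (seqOf (node u))) (t x) (t y)
      mono x y (outer h) = outer (proj₁ (proj₂ gr) h)
      mono (n , x) (n , y) (inner h) = inner (cast-mono (seqOf ∘ u) (proj₁ (ok n)) x y h)
      lab : ∀ γ → proj₂ (seqOf (node u)) γ ≡ proj₂ (seqOf (node u)) (t γ)
      lab (n , x) = sym (cast-lab (seqOf ∘ u) (proj₁ (ok n)) x)

    module _ {r : Q → Q → Set ℓ'} where

      -- A bounded embedding is eventually in one block, and every tail of the source contains a copy of it.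
      split : ∀ x (G : ℕ → Seq Q) ((h , _) : SeqEmb r (seqOf x) (sumSeq G)) k → (∀ γ → proj₁ (h γ) < k) →
        Σ ℕ λ n → SeqEmb r (seqOf x) (G n)
      split (leaf q) G (h , _ , lab) k b = proj₁ (h tt) , (λ _ → proj₂ (h tt)) , (λ _ _ ()) , λ _ → lab tt
      split (node u) G (h , mono , lab) k b = n ,
          (λ γ → into G (h (t γ)) (same γ)) ,
          (λ x y p → into-mono G (h (t x)) (h (t y)) (same x) (same y) (mono _ _ (proj₁ (proj₂ (proj₁ st)) x y p))) ,
          λ γ → subst₂ r (sym (proj₂ (proj₂ (proj₁ st)) γ)) (sym (into-lab G (h (t γ)) (same γ))) (lab (t γ))
        where
        -- Least distance to the bound k: γ₀ goes to the highest block ever used, and what follows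
        -- γ₀ cannot leave that block.
        top = least (λ d → Σ (Pos (node u)) λ γ → k ∸ proj₁ (h γ) ≡ d) (_ , first-pos (node u) , refl)
        γ₀ = proj₁ (proj₁ (proj₂ top))
        n = proj₁ (h γ₀)
        highest : ∀ γ → proj₁ (h γ) ≤ n
        highest γ = ≮⇒≥ λ p → proj₂ (proj₂ top) (k ∸ proj₁ (h γ))
          (subst (k ∸ proj₁ (h γ) <_) (proj₂ (proj₁ (proj₂ top))) (∸-monoʳ-< p (<⇒≤ (b γ)))) (γ , refl)
        st = self-tail u (proj₁ γ₀)
        t = proj₁ (proj₁ st)
        same : ∀ γ → proj₁ (h (t γ)) ≡ n
        same γ = ≤-antisym (highest (t γ)) (block-≤ G _ _ (mono γ₀ (t γ) (outer (proj₂ st γ))))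

      -- The block of a child of u is followed by further blocks, so its image is bounded and
      -- `split` finds a copy inside one block of v. The sequence of a node has two positions in
      -- order, so it does not fit into that of a leaf.
      seqOf-reflects : ∀ x y → SeqEmb r (seqOf x) (seqOf y) → TreeLe r x y
      seqOf-reflects (leaf p) (leaf q) (h , mono , lab) = lab tt
      seqOf-reflects (leaf p) (node v) (h , mono , lab) = recur (proj₁ (h tt)) ,
        seqOf-reflects (leaf p) (v (recur (proj₁ (h tt)))) ((λ _ → proj₂ (h tt)) , (λ _ _ ()) , λ _ → lab tt)
      seqOf-reflects (node u) (leaf q) (h , mono , lab) =
        lift (mono (0 , first-pos (u (recur 0))) (1 , first-pos (u (recur 1))) (outer (s≤s z≤n)))
      seqOf-reflects (node u) (node v) (h , mono , lab) i = let n , _ , e = recur-inf i 0 in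
        subst (λ i → Σ ℕ λ j → TreeLe r (u i) (v j)) e
          (let m , emb = split (u (recur n)) (λ m → seqOf (v (recur m)))
                 ((λ x → h (n , x)) , (λ x y p → mono _ _ (inner p)) , λ x → lab (n , x))
                 (suc (proj₁ (h (suc n , first-pos (u (recur (suc n)))))))
                 (λ x → s≤s (block-≤ (λ m → seqOf (v (recur m))) _ _ (mono (n , x) (suc n , _) (outer (n<1+n n)))))
           in recur m , seqOf-reflects (u (recur n)) (v (recur m)) emb)

  -- Good pairs, bad arrays and double covers

  GoodPairs : {Q : Set ℓ} → (Q → Q → Set ℓ') → Set (ℓ ⊔ ℓ')
  GoodPairs {Q = Q} r = (x : ℕ → Q) → Σ ℕ λ i → Σ ℕ λ j → i < j × r (x i) (x j)

  wqo⇒good : {Q : Set ℓ} {r : Q → Q → Set ℓ'} → IsWqo r → GoodPairs r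
  wqo⇒good w x = let φ , mφ , h = w x in φ 0 , φ 1 , mφ (s≤s z≤n) , h (s≤s z≤n)

  good⇒wqo : {Q : Set ℓ} {r : Q → Q → Set ℓ'} → GoodPairs r → IsWqo r
  good⇒wqo {r = r} g x with ramsey₂ (λ i j → r (x i) (x j))
  ... | N , mN , inj₁ h = N , mN , h
  ... | N , mN , inj₂ h = let i , j , p , q = g (x ∘ N) in ⊥-elim (h p q)

  bqo⇒trees-good : {Q : Set ℓ} {r : Q → Q → Set ℓ'} → IsBqo r → GoodPairs (TreeLe r)
  bqo⇒trees-good {r = r} b x = let i , j , p , h , _ , mono , lab = wqo⇒good {r = SeqLe r} b (seqOf ∘ x) in
    i , j , p , seqOf-reflects (x i) (x j) (h , mono , lab)

  Bqo : {Q : Set ℓ} → (Q → Q → Set ℓ') → Set (ℓ ⊔ ℓ')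
  Bqo {Q = Q} r = (f : Pt → Q) → LC f → ¬ (∀ X → Mono X → ¬ r (f X) (f (X ∘ suc)))

  -- With three relations it composes signs as well as a single order.
  tree-trans : {Q : Set ℓ} {r s t : Q → Q → Set ℓ'} → (∀ {x y z} → r x y → s y z → t x z) →
    ∀ x y z → TreeLe r x y → TreeLe s y z → TreeLe t x z
  tree-trans c (leaf x) (leaf y) (leaf z) p q = c p q
  tree-trans c (leaf x) (leaf y) (node w) p (k , q) = k , tree-trans c (leaf x) (leaf y) (w k) p q
  tree-trans c (leaf x) (node v) (node w) (j , p) q = let k , q' = q j in k , tree-trans c (leaf x) (v j) (w k) p q'
  tree-trans c (leaf x) (node v) (leaf z) p (lift ())
  tree-trans c (node u) (leaf y) z (lift ()) q
  tree-trans c (node u) (node v) (leaf z) p (lift ())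
  tree-trans c (node u) (node v) (node w) p q i =
    let j , p' = p i ; k , q' = q j in k , tree-trans c (u i) (v j) (w k) p' q'

  tree-refl : {Q : Set ℓ} {r : Q → Q → Set ℓ'} → (∀ x → r x x) → ∀ x → TreeLe r x x
  tree-refl h (leaf x) = h x
  tree-refl h (node u) i = i , tree-refl h (u i)

  -- The double cover argument for sequences. On a set without pairs of sign `false`, Ramsey's
  -- theorem makes all pairs or no pairs have sign `true`; the former is refuted by `square` on
  -- three indices, the latter by `found`.
  signed-pair : (R : Bool → ℕ → ℕ → Set ℓ) → (∀ {i j k} → R true i j → R true j k → R false i k) →
    (∀ φ → Mono φ → Σ ℕ λ i → Σ ℕ λ j → i < j × Σ Bool λ s → R s (φ i) (φ j)) → Σ Pt λ N → Mono N × (∀ {i j} → i < j → R false (N i) (N j))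
  signed-pair R square found with ramsey₂ (R false)
  ... | N , mN , inj₁ h = N , mN , h
  ... | N , mN , inj₂ h with ramsey₂ (λ i j → R true (N i) (N j))
  ...   | M , mM , inj₁ k = ⊥-elim (h (mM {0} {2} (s≤s z≤n)) (square (k {0} {1} (s≤s z≤n)) (k {1} {2} (s≤s (s≤s z≤n)))))
  ...   | M , mM , inj₂ k with found (N ∘ M) (mN ∘ mM)
  ...     | i , j , i<j , false , q = ⊥-elim (h (mM i<j) q)
  ...     | i , j , i<j , true , q = ⊥-elim (k i<j q)

  -- A quasi-order ≤ = rs false with a coarser quasi-order ≤' that is the union of ≤ and a second relation rs true, whose
  -- square lies in ≤ (a double cover).  On trees with hereditarily ≤-increasing children the union property persists, since
  -- one sign occurs for infinitely many children.  Every array becomes such a tree on a suitable infinite set.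
  module DoubleCover {Q : Set ℓ} (r : Q → Q → Set ℓ″) (rs : Bool → Q → Q → Set ℓ')
    (covers : ∀ {x y} → r x y → Σ Bool λ s → rs s x y)
    (rs-refl : ∀ x → rs false x x)
    (rs-trans : ∀ {s x y z} → rs false x y → rs s y z → rs s x z)
    (rs-square : ∀ {x y z} → rs true x y → rs true y z → rs false x z)
    (good : GoodPairs (TreeLe r)) where

    _≤ᵗ_ : Tree Q → Tree Q → Set ℓ'
    _≤ᵗ_ = TreeLe (rs false)

    ≤ᵗ-trans : ∀ x y z → x ≤ᵗ y → y ≤ᵗ z → x ≤ᵗ z
    ≤ᵗ-trans = tree-trans rs-trans

    Increasing : (ℕ → Tree Q) → Set ℓ'
    Increasing u = ∀ {i j} → i < j → u i ≤ᵗ u j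

    HInc : Tree Q → Set ℓ'
    HInc (leaf q) = Lift _ ⊤
    HInc (node u) = (∀ i → HInc (u i)) × Increasing u

    increasing-≤ : ∀ {u} → Increasing u → ∀ {i j} → i ≤ j → u i ≤ᵗ u j
    increasing-≤ {u} inc {i} i≤j with m≤n⇒m<n∨m≡n i≤j
    ... | inj₁ p = inc p
    ... | inj₂ refl = tree-refl {r = rs false} rs-refl (u i)

    tree-covers : ∀ x y → HInc x → HInc y → TreeLe r x y → Σ Bool λ s → TreeLe (rs s) x y
    tree-covers (leaf p) (leaf q) hx hy le = covers le
    tree-covers (leaf p) (node v) hx (hv , _) (j , le) = let s , h = tree-covers (leaf p) (v j) hx (hv j) le in s , j , h
    tree-covers (node u) (leaf q) hx hy (lift ())
    tree-covers (node u) (node v) (hu , inc) (hv , _) le = s , λ i →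
        let i' , i≤i' , e = proj₂ pg i
        in proj₁ (le i') , subst (λ s → TreeLe (rs s) (u i) (v (proj₁ (le i')))) e
             (tree-trans rs-trans (u i) (u i') _ (increasing-≤ {u} inc i≤i') (proj₂ (signed i')))
      where
      signed : ∀ i → Σ Bool λ s → TreeLe (rs s) (u i) (v (proj₁ (le i)))
      signed i = tree-covers (u i) (v (proj₁ (le i))) (hu i) (hv _) (proj₂ (le i))
      pg = pigeon (λ i → proj₁ (signed i))
      s = proj₁ pg

    increasing-subseq : (x : ℕ → Tree Q) → (∀ i → HInc (x i)) → Σ Pt λ φ → Mono φ × Increasing (x ∘ φ)
    increasing-subseq x hx = signed-pair (λ s i j → TreeLe (rs s) (x i) (x j))
      (λ {i} {j} {k} → tree-trans {r = rs true} {rs true} {rs false} rs-square (x i) (x j) (x k))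
      λ φ _ → let i , j , i<j , le = good (x ∘ φ) in i , j , i<j , tree-covers (x (φ i)) (x (φ j)) (hx (φ i)) (hx (φ j)) le

    -- The tree is a decision tree for f on the subsets of N: child i serves the points that begin
    -- with N i.
    Rep : (Pt → Q) → Pt → Tree Q → Set ℓ
    Rep f N (leaf q) = ∀ Y → Mono Y → Y ⊂ N → f Y ≡ q
    Rep f N (node t) = ∀ i → Rep (λ Y → f (N i ◂ Y)) (tail N i) (t i)

    Thinned : (Pt → Q) → Pt → Tree Q → Set _
    Thinned f N t = Σ (Tree Q) λ t' → Rep f N t' × HInc t' × t ≤ᵗ t' × t' ≤ᵗ t

    -- Shrinking N deletes children, yet the tree stays equivalent: children increase, so a deleted
    -- one lies below one that is kept.
    thin : ∀ {f N M} t → Mono M → Mono N → M ⊂ N → Rep f N t → HInc t → Thinned f M t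
    thin (leaf q) mM mN s rep hi = leaf q , (λ Y mY s' → rep Y mY (⊂-trans s' s)) , lift tt , rs-refl q , rs-refl q
    thin {f} {N} {M} (node t) mM mN s rep (ht , inc) =
        node t' , (λ i → proj₁ (proj₂ (kid i))) , ((λ i → proj₁ (proj₂ (proj₂ (kid i)))) , inc') ,
        (λ i → i , ≤ᵗ-trans (t i) (t (k i)) (t' i) (increasing-≤ {t} inc (mono-infl (⊂-index mM mN s) i)) (up i)) ,
        (λ i → k i , down i)
      where
      k = proj₁ ∘ s
      kid : ∀ i → Thinned (λ Y → f (M i ◂ Y)) (tail M i) (t (k i))
      kid i = thin (t (k i)) (mono-tail i mM) (mono-tail (k i) mN) (⊂-tails mM mN s i)
        (subst (λ n → Rep (λ Y → f (n ◂ Y)) (tail N (k i)) (t (k i))) (sym (proj₂ (s i))) (rep (k i))) (ht (k i))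
      t' : ℕ → Tree Q
      t' i = proj₁ (kid i)
      up : ∀ i → t (k i) ≤ᵗ t' i
      up i = proj₁ (proj₂ (proj₂ (proj₂ (kid i))))
      down : ∀ i → t' i ≤ᵗ t (k i)
      down i = proj₂ (proj₂ (proj₂ (proj₂ (kid i))))
      inc' : Increasing t'
      inc' {i} {j} p = ≤ᵗ-trans (t' i) (t (k i)) (t' j) (down i) (≤ᵗ-trans (t (k i)) (t (k j)) (t' j) (inc (⊂-index mM mN s p)) (up j))

    Represented : (Pt → Q) → Pt → Set _
    Represented f N = Σ (Tree Q) λ t → HInc t × Rep f N t

    -- The trees below the single first entries need not increase. A subsequence of the first
    -- entries makes them do so, and each child is then thinned to the entries that remain after it.
    assemble : ∀ {f N} → Mono N → (∀ i → Represented (λ Y → f (N i ◂ Y)) (tail N i)) →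
      Σ Pt λ φ → Mono φ × Represented f (N ∘ φ)
    assemble {f} {N} mN t with increasing-subseq (λ i → proj₁ (t i)) (λ i → proj₁ (proj₂ (t i)))
    ... | φ , mφ , inc = φ , mφ , node t' , ((λ i → proj₁ (proj₂ (proj₂ (kid i)))) , inc') , λ i → proj₁ (proj₂ (kid i))
      where
      u : ℕ → Tree Q
      u i = proj₁ (t (φ i))
      kid : ∀ i → Thinned (λ Y → f (N (φ i) ◂ Y)) (tail (N ∘ φ) i) (u i)
      kid i = thin (u i) (mono-tail i (mN ∘ mφ)) (mono-tail (φ i) mN)
        (⊂-tails (mN ∘ mφ) mN (⊂-∘ {N} φ) i) (proj₂ (proj₂ (t (φ i)))) (proj₁ (proj₂ (t (φ i))))
      t' : ℕ → Tree Q
      t' i = proj₁ (kid i)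
      inc' : Increasing t'
      inc' {i} {j} p = ≤ᵗ-trans (t' i) (u i) (t' j) (proj₂ (proj₂ (proj₂ (proj₂ (kid i)))))
        (≤ᵗ-trans (u i) (u j) (t' j) (inc p) (proj₁ (proj₂ (proj₂ (proj₂ (kid j))))))

    represent : ∀ {m f} → Bar m f → ∀ M → Above m M → Σ Pt λ N → Mono N × N ⊂ M × Represented f N
    represent {m} {f} (done h) M (mM , b) = M , mM , ⊂-refl , leaf (f M) , lift tt , λ Y mY s →
      h Y M (mY , ≤-trans b (subst (M 0 ≤_) (sym (proj₂ (s 0))) (mono-≤ mM z≤n))) (mM , b)
    represent {m} {f} (more h) M aM = finish (Fusion.fusion m G
        (λ _ mM' s (mM , t , hi , rep) → let t' , rep' , hi' , _ = thin t mM' mM s rep hi in mM' , t' , hi' , rep')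
        (λ k M m≤k aM → let N , mN , s , rp = represent (h k m≤k) M aM in N , mN , s , mN , rp) M aM)
      where
      G : ℕ → Pt → Set _
      G k M = Mono M × Represented (λ Y → f (k ◂ Y)) M
      finish : (Σ Pt λ N → Mono N × N ⊂ M × (∀ i → G (N i) (tail N i))) → Σ Pt λ N → Mono N × N ⊂ M × Represented f N
      finish (N , mN , N⊂M , t) = let φ , mφ , rp = assemble mN (λ i → proj₂ (t i)) in
        N ∘ φ , mN ∘ mφ , ⊂-trans (⊂-∘ φ) N⊂M , rp

    -- From T ≤ T', where T and T' represent the array below a stem s = (x₀,…,x_k) and below (x₁,…,x_{k+1}), build X
    -- extending s with f X ≤ f (X ∘ suc): the next point of T is forced, that of T' is read off T ≤ T'.
    play : ∀ t t' (g g' : Pt → Q) M i → Mono M → Rep g M t → Rep g' (tail M i) t' → t ≤ᵗ t' →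
      Σ Pt λ Y → Mono Y × Y ⊂ tail M i × rs false (g (M i ◂ Y)) (g' Y)
    play (leaf p) (leaf q) g g' M i mM rep rep' le = tail M i , mono-tail i mM , ⊂-refl ,
      subst₂ (rs false) (sym (rep (M i ◂ tail M i) (mono-◂ (mM (s≤s (m≤m+n i 0))) (mono-tail i mM))
          λ { zero → i , refl ; (suc n) → suc i + n , refl }))
        (sym (rep' (tail M i) (mono-tail i mM) ⊂-refl)) le
    play (leaf p) (node t') g g' M i mM rep rep' (j , le) =
      let Y , mY , s , h = play (leaf p) (t' j) (λ Y → g (M i ◂ Y)) (λ Y → g' (tail M i j ◂ Y)) (tail M i) j (mono-tail i mM)
            (λ Y mY s → rep (M i ◂ Y) (mono-◂ (subst (M i <_) (sym (proj₂ (s 0))) (mM (s≤s (m≤m+n i _)))) mY)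
              λ { zero → i , refl ; (suc n) → suc i + proj₁ (s n) , proj₂ (s n) })
            (rep' j) le
      in tail M i j ◂ Y , mono-◂ (subst (tail M i j <_) (sym (proj₂ (s 0))) (mono-tail i mM (s≤s (m≤m+n j _)))) mY ,
         (λ { zero → j , refl ; (suc n) → suc j + proj₁ (s n) , proj₂ (s n) }) , h
    play (node t) (leaf q) g g' M i mM rep rep' (lift ())
    play (node t) (node t') g g' M i mM rep rep' le = let j , le' = le i in
      let Y , mY , s , h = play (t i) (t' j) (λ Y → g (M i ◂ Y)) (λ Y → g' (tail M i j ◂ Y)) (tail M i) j (mono-tail i mM)
            (rep i) (rep' j) le'
      in tail M i j ◂ Y , mono-◂ (subst (tail M i j <_) (sym (proj₂ (s 0))) (mono-tail i mM (s≤s (m≤m+n j _)))) mY ,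
         (λ { zero → j , refl ; (suc n) → suc j + proj₁ (s n) , proj₂ (s n) }) , h

    -- The children of the root increase, so `play` on the first two yields a point beginning with N
    -- 0, N 1 at which the array is good. If the root is a leaf, f is constant on the subsets of N.
    cover-bqo : Bqo (rs false)
    cover-bqo f lc bad = refute (represent (bar lc) id (id , z≤n))
      where
      refute : ¬ Σ Pt λ N → Mono N × N ⊂ id × Represented f N
      refute (N , mN , _ , leaf q , _ , rep) = bad N mN
        (subst₂ (rs false) (sym (rep N mN ⊂-refl)) (sym (rep (N ∘ suc) (mono-shift mN) (⊂-∘ suc))) (rs-refl q))
      refute (N , mN , _ , node t , (_ , inc) , rep) =
        let Y , mY , s , h = play (t 0) (t 1) (λ Y → f (N 0 ◂ Y)) (λ Y → f (N 1 ◂ Y)) (tail N 0) 0 (mono-tail 0 mN)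
              (rep 0) (rep 1) (inc (s≤s z≤n))
            m1 = mono-◂ (subst (N 1 <_) (sym (proj₂ (s 0))) (mN (s≤s (s≤s z≤n)))) mY
        in bad (N 0 ◂ N 1 ◂ Y) (mono-◂ (mN (s≤s z≤n)) m1) h

  -- Labelled chains

  record Chain : Set₁ where
    field
      Car : Set
      ctb : Countable Car
      _≺_ : Car → Car → Set
      irr : ∀ x → ¬ (x ≺ x)
      tra : ∀ {x y z} → x ≺ y → y ≺ z → x ≺ z
      tri : ∀ x y → x ≺ y ⊎ (x ≡ y ⊎ y ≺ x)

  LCh : Set ℓ → Set (lsuc lzero ⊔ ℓ)
  LCh Q = Σ Chain λ J → Chain.Car J → Q

  ∣_∣ : {Q : Set ℓ} → LCh Q → Set
  ∣ L ∣ = Chain.Car (proj₁ L)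

  Lt : {Q : Set ℓ} (L : LCh Q) → ∣ L ∣ → ∣ L ∣ → Set
  Lt L = Chain._≺_ (proj₁ L)

  record Emb {Q : Set ℓ} (r : Q → Q → Set ℓ') (L M : LCh Q) : Set ℓ' where
    constructor emb
    field
      fun : ∣ L ∣ → ∣ M ∣
      mono : ∀ {x y} → Lt L x y → Lt M (fun x) (fun y)
      lab : ∀ x → r (proj₂ L x) (proj₂ M (fun x))
  open Emb

  sumCh : {Q : Set ℓ} (J : Chain) → (Chain.Car J → LCh Q) → LCh Q
  sumCh J F = record
    { Car = Σ Car λ j → ∣ F j ∣
    ; ctb = countable-Σ ctb (λ j → Chain.ctb (proj₁ (F j)))
    ; _≺_ = Lex _≺_ (λ j → Lt (F j))
    ; irr = Lex-irrefl irr (λ j → Chain.irr (proj₁ (F j)))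
    ; tra = Lex-trans tra (λ j → Chain.tra (proj₁ (F j)))
    ; tri = Lex-tri tri (λ j → Chain.tri (proj₁ (F j)))
    } , λ (j , x) → proj₂ (F j) x
    where open Chain J

  emptyL : {Q : Set ℓ} → LCh Q
  emptyL = record { Car = ⊥ ; ctb = record { enc = λ () ; enc-inj = λ { {()} } } ; _≺_ = λ _ _ → ⊥
    ; irr = λ () ; tra = λ () ; tri = λ () } , λ ()

  singleL : {Q : Set ℓ} → Q → LCh Q
  singleL q = record { Car = ⊤ ; ctb = record { enc = λ _ → 0 ; enc-inj = λ _ → refl } ; _≺_ = λ _ _ → ⊥
    ; irr = λ _ () ; tra = λ () ; tri = λ _ _ → inj₂ (inj₁ refl) } , λ _ → q

  two : Chain
  two = record { Car = Bool ; ctb = record { enc = if_then 1 else 0 ; enc-inj = inj } ; _≺_ = λ x y → x ≡ false × y ≡ true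
    ; irr = λ { false (_ , ()) ; true (() , _) } ; tra = λ p q → proj₁ p , proj₂ q
    ; tri = λ { false false → inj₂ (inj₁ refl) ; false true → inj₁ (refl , refl)
              ; true false → inj₂ (inj₂ (refl , refl)) ; true true → inj₂ (inj₁ refl) } }
    where
    inj : Injective (if_then 1 else 0)
    inj {false} {false} _ = refl
    inj {true} {true} _ = refl

  both : {A : Set ℓ} → A → A → Bool → A
  both a b false = a
  both a b true = b

  _⊕_ : {Q : Set ℓ} → LCh Q → LCh Q → LCh Q
  L ⊕ M = sumCh two (both L M)

  module _ {Q : Set ℓ} {r : Q → Q → Set ℓ'} where

    sum-emb : (J J' : Chain) (F : Chain.Car J → LCh Q) (G : Chain.Car J' → LCh Q) (h : Chain.Car J → Chain.Car J') →
      (∀ {i j} → Chain._≺_ J i j → Chain._≺_ J' (h i) (h j)) → (∀ j → Emb r (F j) (G (h j))) → Emb r (sumCh J F) (sumCh J' G)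
    sum-emb J J' F G h mh e = emb (λ (j , x) → h j , fun (e j) x) m (λ (j , x) → lab (e j) x)
      where
      m : ∀ {p q} → Lex _ (λ j → Lt (F j)) p q → Lex _ (λ j → Lt (G j)) (h (proj₁ p) , fun (e _) (proj₂ p)) (h (proj₁ q) , fun (e _) (proj₂ q))
      m (outer p) = outer (mh p)
      m (inner {a} p) = inner (mono (e a) p)

    empty-emb : {L : LCh Q} → Emb r emptyL L
    empty-emb = emb (λ ()) (λ { {()} }) (λ ())

    none-emb : {L M : LCh Q} → ¬ ∣ L ∣ → Emb r L M
    none-emb n = emb (λ x → ⊥-elim (n x)) (λ {x} _ → ⊥-elim (n x)) (λ x → ⊥-elim (n x))

    emb-∘ : {s t : Q → Q → Set ℓ'} → (∀ {x y z} → r x y → s y z → t x z) → ∀ {L M N} → Emb r L M → Emb s M N → Emb t L N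
    emb-∘ c e e' = emb (fun e' ∘ fun e) (mono e' ∘ mono e) (λ x → c (lab e x) (lab e' (fun e x)))

    emb-id : (∀ x → r x x) → ∀ {L} → Emb r L L
    emb-id rr = emb id id (λ x → rr _)

    emb-≡ : (∀ x → r x x) → ∀ {L M} → Emb _≡_ L M → Emb r L M
    emb-≡ rr e = emb (fun e) (mono e) (λ x → subst (r _) (lab e x) (rr _))

  summand : {Q : Set ℓ} (J : Chain) (F : Chain.Car J → LCh Q) (j : Chain.Car J) → Emb _≡_ (F j) (sumCh J F)
  summand J F j = emb (j ,_) inner (λ _ → refl)

  -- The forth construction and a universal coloured dense chain

  greatest : {A : Set} (c : Countable A) (R : A → A → Set) → (∀ {x y z} → R x y → R y z → R x z) → (∀ x y → R x y ⊎ (x ≡ y ⊎ R y x)) →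
    (P : A → Set) → ∀ n → (∀ a → Countable.enc c a < n → ¬ P a) ⊎
    Σ A λ m → Countable.enc c m < n × P m × (∀ a → Countable.enc c a < n → P a → a ≡ m ⊎ R a m)
  greatest c R Rt Rtri P zero = inj₁ λ _ ()
  greatest {A} c R Rt Rtri P (suc n) with em (Σ A λ a → Countable.enc c a ≡ n × P a) | greatest c R Rt Rtri P n
  ... | no none | inj₁ h = inj₁ λ { a (s≤s p) pa → case m≤n⇒m<n∨m≡n p of λ { (inj₁ q) → h a q pa ; (inj₂ e) → none (a , e , pa) } }
  ... | no none | inj₂ (m , lt , pm , h) = inj₂ (m , m<n⇒m<1+n lt , pm , λ { a (s≤s p) pa → case m≤n⇒m<n∨m≡n p of λ
          { (inj₁ q) → h a q pa ; (inj₂ e) → ⊥-elim (none (a , e , pa)) } })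
  ... | yes (b , refl , pb) | inj₁ h = inj₂ (b , n<1+n _ , pb , λ { a (s≤s p) pa → case m≤n⇒m<n∨m≡n p of λ
          { (inj₁ q) → ⊥-elim (h a q pa) ; (inj₂ e) → inj₁ (Countable.enc-inj c e) } })
  ... | yes (b , refl , pb) | inj₂ (m , lt , pm , h) with Rtri m b
  ...   | inj₁ mb = inj₂ (b , n<1+n _ , pb , λ { a (s≤s p) pa → case m≤n⇒m<n∨m≡n p of λ
          { (inj₁ q) → case h a q pa of λ { (inj₁ refl) → inj₂ mb ; (inj₂ am) → inj₂ (Rt am mb) }
          ; (inj₂ e) → inj₁ (Countable.enc-inj c e) } })
  ...   | inj₂ bm = inj₂ (m , m<n⇒m<1+n lt , pm , λ { a (s≤s p) pa → case m≤n⇒m<n∨m≡n p of λ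
          { (inj₁ q) → h a q pa ; (inj₂ e) → case Countable.enc-inj c e of λ { refl → case bm of λ
            { (inj₁ e') → inj₁ (sym e') ; (inj₂ q) → inj₂ q } } } })

  -- Cantor's forth argument. Its target is only assumed transitive, so it serves both for the
  -- coloured dense chain and for intervals of a chain ordered by strict separation.
  module Forth (A : Chain) {B : Set ℓ'} (_<B_ : B → B → Set ℓ″) (tr : ∀ {x y z} → x <B y → y <B z → x <B z)
    (Ok : Chain.Car A → B → Set ℓ) where

    open Chain A
    open Countable ctb

    Gap : Maybe B → Maybe B → Set ℓ″
    Gap (just l) (just u) = l <B u
    Gap _ _ = Lift _ ⊤

    _≪_ : Maybe B → B → Set (ℓ' ⊔ ℓ″)
    lo ≪ b = ∀ l → lo ≡ just l → l <B b

    _≫_ : Maybe B → B → Set (ℓ' ⊔ ℓ″)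
    hi ≫ b = ∀ u → hi ≡ just u → b <B u

    Good : ℕ → (Car → B) → Set (ℓ ⊔ ℓ″)
    Good n h = (∀ a → enc a < n → Ok a (h a)) × (∀ a a' → enc a < n → enc a' < n → a ≺ a' → h a <B h a')

    module _ (fill : ∀ a lo hi → Gap lo hi → Σ B λ b → Ok a b × lo ≪ b × hi ≫ b) where

      -- Among the elements already placed, only the nearest neighbours of a on either side
      -- constrain its image.
      bounds : ∀ n h → Good n h → ∀ a → Σ (Maybe B) λ lo → Σ (Maybe B) λ hi → Gap lo hi ×
        (∀ b → lo ≪ b → ∀ a' → enc a' < n → a' ≺ a → h a' <B b) × (∀ b → hi ≫ b → ∀ a' → enc a' < n → a ≺ a' → b <B h a')
      bounds n h (_ , hm) a with greatest ctb _≺_ tra tri (_≺ a) n | greatest ctb (λ x y → y ≺ x) (λ p q → tra q p) tri' (a ≺_) n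
        where
        tri' : ∀ x y → y ≺ x ⊎ (x ≡ y ⊎ x ≺ y)
        tri' x y with tri x y
        ... | inj₁ p = inj₂ (inj₂ p)
        ... | inj₂ (inj₁ p) = inj₂ (inj₁ p)
        ... | inj₂ (inj₂ p) = inj₁ p
      ... | inj₁ x | inj₁ y = nothing , nothing , lift tt , (λ b _ a' p q → ⊥-elim (x a' p q)) , (λ b _ a' p q → ⊥-elim (y a' p q))
      ... | inj₂ (l , el , pl , x) | inj₁ y = just (h l) , nothing , lift tt ,
            (λ b lb a' p q → case x a' p q of λ { (inj₁ refl) → lb _ refl ; (inj₂ s) → tr (hm a' l p el s) (lb _ refl) }) ,
            (λ b _ a' p q → ⊥-elim (y a' p q))
      ... | inj₁ x | inj₂ (u , eu , pu , y) = nothing , just (h u) , lift tt , (λ b _ a' p q → ⊥-elim (x a' p q)) ,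
            (λ b ub a' p q → case y a' p q of λ { (inj₁ refl) → ub _ refl ; (inj₂ s) → tr (ub _ refl) (hm u a' eu p s) })
      ... | inj₂ (l , el , pl , x) | inj₂ (u , eu , pu , y) = just (h l) , just (h u) , hm l u el eu (tra pl pu) ,
            (λ b lb a' p q → case x a' p q of λ { (inj₁ refl) → lb _ refl ; (inj₂ s) → tr (hm a' l p el s) (lb _ refl) }) ,
            (λ b ub a' p q → case y a' p q of λ { (inj₁ refl) → ub _ refl ; (inj₂ s) → tr (ub _ refl) (hm u a' eu p s) })

      Next : ℕ → (Car → B) → Set (ℓ ⊔ ℓ' ⊔ ℓ″)
      Next n h = Σ (Car → B) λ h' → Good (suc n) h' × (∀ a → enc a < n → h' a ≡ h a)

      extend : ∀ n h → Good n h → Next n h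
      extend n h g@(ok , hm) with em (Σ Car λ a → enc a ≡ n)
      ... | no none = h , ((λ a p → ok a (low a p)) , (λ a a' p p' → hm a a' (low a p) (low a' p'))) , λ _ _ → refl
        where
        low : ∀ a → enc a < suc n → enc a < n
        low a (s≤s p) with m≤n⇒m<n∨m≡n p
        ... | inj₁ q = q
        ... | inj₂ e = ⊥-elim (none (a , e))
      ... | yes (c , refl) with bounds n h g c
      ...   | lo , hi , gap , lo-ok , hi-ok with fill c lo hi gap
      ...     | b , okb , lb , ub = h' , ((λ a p → ok' a p (enc a ≟ n)) , (λ a a' p p' q → hm' a a' p p' (enc a ≟ n) (enc a' ≟ n) q)) ,
                  λ a p → h'-old a (enc a ≟ n) p
        where
        pick-b : ∀ a → Dec (enc a ≡ enc c) → B
        pick-b a (yes _) = b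
        pick-b a (no _) = h a
        h' : Car → B
        h' a = pick-b a (enc a ≟ n)
        low : ∀ a → enc a < suc n → ¬ enc a ≡ n → enc a < n
        low a (s≤s p) ne with m≤n⇒m<n∨m≡n p
        ... | inj₁ q = q
        ... | inj₂ e = ⊥-elim (ne e)
        ok' : ∀ a → enc a < suc n → (d : Dec (enc a ≡ n)) → Ok a (pick-b a d)
        ok' a p (yes e) = subst (λ x → Ok x b) (sym (enc-inj e)) okb
        ok' a p (no ne) = ok a (low a p ne)
        hm' : ∀ a a' → enc a < suc n → enc a' < suc n → (d : Dec (enc a ≡ n)) (d' : Dec (enc a' ≡ n)) → a ≺ a' →
          pick-b a d <B pick-b a' d'
        hm' a a' p p' (yes e) (yes e') q = ⊥-elim (irr a (subst (a ≺_) (trans (enc-inj e') (sym (enc-inj e))) q))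
        hm' a a' p p' (yes e) (no ne') q = hi-ok b ub a' (low a' p' ne') (subst (_≺ a') (enc-inj e) q)
        hm' a a' p p' (no ne) (yes e') q = lo-ok b lb a (low a p ne) (subst (a ≺_) (enc-inj e') q)
        hm' a a' p p' (no ne) (no ne') q = hm a a' (low a p ne) (low a' p' ne') q
        h'-old : ∀ a (d : Dec (enc a ≡ n)) → enc a < n → pick-b a d ≡ h a
        h'-old a (yes e) p = ⊥-elim (<-irrefl e p)
        h'-old a (no _) p = refl

      forth : Σ (Car → B) λ h → (∀ a → Ok a (h a)) × (∀ {a a'} → a ≺ a' → h a <B h a')
      forth = (λ a → proj₁ (st (suc (enc a))) a) , (λ a → proj₁ (proj₂ (st (suc (enc a)))) a (n<1+n _)) ,
          λ {a} {a'} q → let k = suc (enc a) ⊔ℕ suc (enc a') ; p = m≤m⊔n (suc (enc a)) (suc (enc a')) ; p' = m≤n⊔m (suc (enc a)) (suc (enc a'))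
                         in subst₂ _<B_ (settled a p) (settled a' p') (proj₂ (proj₂ (st k)) a a' p p' q)
        where
        st : ∀ n → Σ (Car → B) (Good n)
        st zero = (λ a → proj₁ (fill a nothing nothing (lift tt))) , (λ _ ()) , λ _ _ ()
        st (suc n) = let h , g = st n ; h' , g' , _ = extend n h g in h' , g'
        settled : ∀ a {n} → suc (enc a) ≤ n → proj₁ (st n) a ≡ proj₁ (st (suc (enc a))) a
        settled a {n} p with m≤n⇒m<n∨m≡n p
        ... | inj₂ refl = refl
        settled a {suc n} _ | inj₁ (s≤s p) = trans (proj₂ (proj₂ (extend n (proj₁ (st n)) (proj₂ (st n)))) a p) (settled a p)

  -- Prefixes come first, and at the first difference the larger entry comes first. Hence l ∷ʳ m
  -- descends towards l as m grows, which leaves room for every colour immediately above l.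
  data _<ᴸ_ : List ℕ → List ℕ → Set where
    nil : ∀ {y ys} → [] <ᴸ (y ∷ ys)
    here : ∀ {x xs y ys} → y < x → (x ∷ xs) <ᴸ (y ∷ ys)
    there : ∀ {x xs ys} → xs <ᴸ ys → (x ∷ xs) <ᴸ (x ∷ ys)

  <ᴸ-irrefl : ∀ l → ¬ l <ᴸ l
  <ᴸ-irrefl (x ∷ l) (here p) = <-irrefl refl p
  <ᴸ-irrefl (x ∷ l) (there p) = <ᴸ-irrefl l p

  <ᴸ-trans : ∀ {l m n} → l <ᴸ m → m <ᴸ n → l <ᴸ n
  <ᴸ-trans nil (here _) = nil
  <ᴸ-trans nil (there _) = nil
  <ᴸ-trans (here p) (here q) = here (<-trans q p)
  <ᴸ-trans (here p) (there q) = here p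
  <ᴸ-trans (there p) (here q) = here q
  <ᴸ-trans (there p) (there q) = there (<ᴸ-trans p q)

  <ᴸ-tri : ∀ l m → l <ᴸ m ⊎ (l ≡ m ⊎ m <ᴸ l)
  <ᴸ-tri [] [] = inj₂ (inj₁ refl)
  <ᴸ-tri [] (y ∷ m) = inj₁ nil
  <ᴸ-tri (x ∷ l) [] = inj₂ (inj₂ nil)
  <ᴸ-tri (x ∷ l) (y ∷ m) with <-cmp x y
  ... | tri< p _ _ = inj₂ (inj₂ (here p))
  ... | tri> _ _ p = inj₁ (here p)
  ... | tri≈ _ refl _ with <ᴸ-tri l m
  ...   | inj₁ p = inj₁ (there p)
  ...   | inj₂ (inj₁ refl) = inj₂ (inj₁ refl)
  ...   | inj₂ (inj₂ p) = inj₂ (inj₂ (there p))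

  <ᴸ-snoc : ∀ l m → l <ᴸ (l ∷ʳ m)
  <ᴸ-snoc [] m = nil
  <ᴸ-snoc (x ∷ l) m = there (<ᴸ-snoc l m)

  snoc-<ᴸ : ∀ {l u} → l <ᴸ u → Σ ℕ λ N → ∀ m → N ≤ m → (l ∷ʳ m) <ᴸ u
  snoc-<ᴸ {u = y ∷ _} nil = suc y , λ m p → here p
  snoc-<ᴸ (here p) = 0 , λ _ _ → here p
  snoc-<ᴸ (there p) = let N , h = snoc-<ᴸ p in N , λ m q → there (h m q)

  list-code : List ℕ → ℕ
  list-code [] = 0
  list-code (x ∷ l) = suc (pair x (list-code l))

  list-code-inj : Injective list-code
  list-code-inj {[]} {[]} e = refl
  list-code-inj {x ∷ l} {y ∷ m} e =
    let e' = pair-inj x (list-code l) y (list-code m) (suc-injective e) in cong₂ _∷_ (cong proj₁ e') (list-code-inj (cong proj₂ e'))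

  -- A countable dense chain without endpoints (nonempty lists, in the form of an initial part and a last entry); the last
  -- entry colours it so that each colour is dense.
  dense : Chain
  dense = record
    { Car = List ℕ × ℕ
    ; ctb = countable-Σ (record { enc = list-code ; enc-inj = list-code-inj }) (λ _ → record { enc = id ; enc-inj = id })
    ; _≺_ = λ p q → whole p <ᴸ whole q
    ; irr = λ p → <ᴸ-irrefl (whole p)
    ; tra = <ᴸ-trans
    ; tri = tri-whole }
    where
    whole : List ℕ × ℕ → List ℕ
    whole (l , m) = l ∷ʳ m
    tri-whole : ∀ p q → whole p <ᴸ whole q ⊎ (p ≡ q ⊎ whole q <ᴸ whole p)
    tri-whole (l , m) (l' , m') with <ᴸ-tri (l ∷ʳ m) (l' ∷ʳ m')
    ... | inj₁ p = inj₁ p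
    ... | inj₂ (inj₁ e) = inj₂ (inj₁ (cong₂ _,_ (proj₁ (∷ʳ-injective l l' e)) (proj₂ (∷ʳ-injective l l' e))))
    ... | inj₂ (inj₂ p) = inj₂ (inj₂ p)

  <-trichotomy : ∀ m n → m < n ⊎ (m ≡ n ⊎ n < m)
  <-trichotomy m n with <-cmp m n
  ... | tri< p _ _ = inj₁ p
  ... | tri≈ _ p _ = inj₂ (inj₁ p)
  ... | tri> _ _ p = inj₂ (inj₂ p)

  ℕ-countable : Countable ℕ
  ℕ-countable = record { enc = id ; enc-inj = id }

  upward downward : Chain
  upward = record { Car = ℕ ; ctb = ℕ-countable ; _≺_ = _<_ ; irr = λ _ → <-irrefl refl ; tra = <-trans ; tri = <-trichotomy }
  downward = record { Car = ℕ ; ctb = ℕ-countable ; _≺_ = λ x y → y < x ; irr = λ _ → <-irrefl refl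
    ; tra = λ p q → <-trans q p ; tri = λ x y → case <-trichotomy x y of λ
      { (inj₁ p) → inj₂ (inj₂ p) ; (inj₂ (inj₁ p)) → inj₂ (inj₁ p) ; (inj₂ (inj₂ p)) → inj₁ p } }

  data Kind : Set where
    ω⁺ ω⁻ η : Kind

  idxCh : Kind → Chain
  idxCh ω⁺ = upward
  idxCh ω⁻ = downward
  idxCh η = dense

  colour : ∀ k → Chain.Car (idxCh k) → ℕ
  colour ω⁺ n = recur n
  colour ω⁻ n = recur n
  colour η (l , m) = recur m

  dense-universal : (A : Chain) (d : Chain.Car A → ℕ) → Σ (Chain.Car A → Chain.Car dense) λ h →
    (∀ a → colour η (h a) ≡ d a) × (∀ {a a'} → Chain._≺_ A a a' → Chain._≺_ dense (h a) (h a'))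
  dense-universal A d = forth fill
    where
    open Forth A (Chain._≺_ dense) (λ {x} {y} {z} → Chain.tra dense {x} {y} {z}) (λ a b → colour η b ≡ d a)
    -- With no lower bound the empty list stands in: it precedes every element of the dense chain
    -- without being one.
    after : Maybe (List ℕ × ℕ) → List ℕ
    after nothing = []
    after (just (l , m)) = l ∷ʳ m
    after-≪ : ∀ lo m → lo ≪ (after lo , m)
    after-≪ (just (l , n)) m (l , n) refl = <ᴸ-snoc (l ∷ʳ n) m
    fill : ∀ a lo hi → Gap lo hi → Σ (List ℕ × ℕ) λ b → colour η b ≡ d a × lo ≪ b × hi ≫ b
    fill a lo nothing _ = let m , _ , e = recur-inf (d a) 0 in (after lo , m) , e , after-≪ lo m , λ _ ()
    fill a lo (just (l , n)) gap = let N , h = below lo gap ; m , N≤m , e = recur-inf (d a) N in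
        (after lo , m) , e , after-≪ lo m , λ { _ refl → h m N≤m }
      where
      below : ∀ lo → Gap lo (just (l , n)) → Σ ℕ λ N → ∀ m → N ≤ m → (after lo ∷ʳ m) <ᴸ (l ∷ʳ n)
      below nothing _ = snoc-<ᴸ (positive l)
        where
        positive : ∀ l → [] <ᴸ (l ∷ʳ n)
        positive [] = nil
        positive (_ ∷ _) = nil
      below (just _) g = snoc-<ᴸ g

  kind-universal : ∀ k (d : Chain.Car (idxCh k) → ℕ) → Σ (Chain.Car (idxCh k) → Chain.Car (idxCh k)) λ h →
    (∀ a → colour k (h a) ≡ d a) × (∀ {a a'} → Chain._≺_ (idxCh k) a a' → Chain._≺_ (idxCh k) (h a) (h a'))
  kind-universal ω⁺ d = let h , m , e = greedy (λ n m → recur m ≡ d n) (λ n → recur-inf (d n)) in h , e , m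
  kind-universal ω⁻ d = let h , m , e = greedy (λ n m → recur m ≡ d n) (λ n → recur-inf (d n)) in h , e , m
  kind-universal η d = dense-universal dense d

  -- Recurrent sums and the bqo theorem for their terms

  decode : {I : Set} → Countable I → ℕ → Maybe I
  decode {I} c n with em (Σ I λ i → Countable.enc c i ≡ n)
  ... | yes (i , _) = just i
  ... | no _ = nothing

  decode-enc : {I : Set} (c : Countable I) (i : I) → decode c (Countable.enc c i) ≡ just i
  decode-enc {I} c i with em (Σ I λ j → Countable.enc c j ≡ Countable.enc c i)
  ... | yes (j , e) = cong just (Countable.enc-inj c e)
  ... | no n = ⊥-elim (n (i , refl))

  module _ {Q : Set ℓ} where

    pick : {I : Set} → (I → LCh Q) → Maybe I → LCh Q
    pick F nothing = emptyL
    pick F (just i) = F i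

    -- The sum over the index chain of kind k in which every member of the family recurs as often as possible.
    kindSum : Kind → {I : Set} → Countable I → (I → LCh Q) → LCh Q
    kindSum k c F = sumCh (idxCh k) λ j → pick F (decode c (colour k j))

    module _ {r : Q → Q → Set ℓ'} where

      pick-emb : {I I' : Set} {F : I → LCh Q} {G : I' → LCh Q} (c' : Countable I') →
        (m : ∀ i → Σ I' λ i' → Emb r (F i) (G i')) → ∀ mi n → (∀ i → mi ≡ just i → n ≡ Countable.enc c' (proj₁ (m i))) →
        Emb r (pick F mi) (pick G (decode c' n))
      pick-emb c' m nothing n _ = empty-emb
      pick-emb {G = G} c' m (just i) n e rewrite e i refl | decode-enc c' (proj₁ (m i)) = proj₂ (m i)

      -- Domination of the families suffices: universality of the coloured index chain sends each
      -- place holding F i to a place holding a member of G above it.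
      kind-emb : ∀ k {I I' : Set} (c : Countable I) (c' : Countable I') (F : I → LCh Q) (G : I' → LCh Q) →
        (∀ i → Σ I' λ i' → Emb r (F i) (G i')) → Emb r (kindSum k c F) (kindSum k c' G)
      kind-emb k {I} {I'} c c' F G m = sum-emb (idxCh k) (idxCh k) (λ j → pick F (decode c (colour k j)))
          (λ j → pick G (decode c' (colour k j))) h mh λ j →
          pick-emb {F = F} {G} c' m (decode c (colour k j)) (colour k (h j)) λ i e → trans (col j) (cong target e)
        where
        target : Maybe I → ℕ
        target nothing = 0
        target (just i) = Countable.enc c' (proj₁ (m i))
        u = kind-universal k (λ j → target (decode c (colour k j)))
        h = proj₁ u
        col = proj₁ (proj₂ u)
        mh : ∀ {i j} → Chain._≺_ (idxCh k) i j → Chain._≺_ (idxCh k) (h i) (h j)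
        mh = proj₂ (proj₂ u)

    kind-member : ∀ k {I : Set} (c : Countable I) (F : I → LCh Q) i → Emb _≡_ (F i) (kindSum k c F)
    kind-member k c F i = let j , e = point k in
        subst (λ mi → Emb _≡_ (pick F mi) (kindSum k c F)) (trans (cong (decode c) e) (decode-enc c i)) (summand (idxCh k) (λ j → pick F (decode c (colour k j))) j)
      where
      point : ∀ k → Σ (Chain.Car (idxCh k)) λ j → colour k j ≡ Countable.enc c i
      point ω⁺ = let n , _ , e = recur-inf (Countable.enc c i) 0 in n , e
      point ω⁻ = let n , _ , e = recur-inf (Countable.enc c i) 0 in n , e
      point η = let n , _ , e = recur-inf (Countable.enc c i) 0 in ([] , n) , e

  -- Terms for the equimorphism types of countable labelled chains.
  data Term (Q : Set ℓ) : Set (lsuc lzero ⊔ ℓ) where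
    lf : Q → Term Q
    cat : Term Q → Term Q → Term Q
    nd : Kind → (I : Set) → Countable I → (I → Term Q) → Term Q

  ⟦_⟧ : {Q : Set ℓ} → Term Q → LCh Q
  ⟦ lf q ⟧ = singleL q
  ⟦ cat s t ⟧ = ⟦ s ⟧ ⊕ ⟦ t ⟧
  ⟦ nd k I c x ⟧ = kindSum k c λ i → ⟦ x i ⟧

  data Child {Q : Set ℓ} : Term Q → Term Q → Set (lsuc lzero ⊔ ℓ) where
    cat₁ : ∀ {s t} → Child s (cat s t)
    cat₂ : ∀ {s t} → Child t (cat s t)
    kid : ∀ {k I c x} i → Child (x i) (nd k I c x)

  child-wf : {Q : Set ℓ} → WellFounded (Child {Q = Q})
  child-wf (lf q) = acc λ ()
  child-wf (cat s t) = acc λ { cat₁ → child-wf s ; cat₂ → child-wf t }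
  child-wf (nd k I c x) = acc λ { (kid i) → child-wf (x i) }

  module _ {Q : Set ℓ} {r : Q → Q → Set ℓ'} where

    cat-emb : ∀ s t s' t' → Emb r ⟦ s ⟧ ⟦ s' ⟧ → Emb r ⟦ t ⟧ ⟦ t' ⟧ → Emb r ⟦ cat s t ⟧ ⟦ cat s' t' ⟧
    cat-emb s t s' t' e f = sum-emb two two (both ⟦ s ⟧ ⟦ t ⟧) (both ⟦ s' ⟧ ⟦ t' ⟧) id id λ { false → e ; true → f }

    child-emb : ∀ {s t : Term Q} → Child s t → Emb _≡_ ⟦ s ⟧ ⟦ t ⟧
    child-emb (cat₁ {s} {t}) = summand two (both ⟦ s ⟧ ⟦ t ⟧) false
    child-emb (cat₂ {s} {t}) = summand two (both ⟦ s ⟧ ⟦ t ⟧) true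
    child-emb (kid {k} {I} {c} {x} i) = kind-member k c (λ i → ⟦ x i ⟧) i

  kind-code : Kind → ℕ
  kind-code ω⁺ = 0
  kind-code ω⁻ = 1
  kind-code η = 2

  kind-code-inj : ∀ k k' → kind-code k ≡ kind-code k' → k ≡ k'
  kind-code-inj ω⁺ ω⁺ _ = refl
  kind-code-inj ω⁻ ω⁻ _ = refl
  kind-code-inj η η _ = refl

  shape : {Q : Set ℓ} → Term Q → ℕ
  shape (lf _) = 0
  shape (cat _ _) = 1
  shape (nd k _ _ _) = 2 + kind-code k

  ramsey-finite : (c : Pt → ℕ) → LC c → ∀ b → (∀ X → Mono X → c X < b) →
    Σ Pt λ N → Mono N × Σ ℕ λ v → ∀ X → Mono X → c (N ∘ X) ≡ v
  ramsey-finite c lc zero h with h id id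
  ... | ()
  ramsey-finite c lc (suc b) h = split-off (ramsey (lc-map (_≡ b) lc))
    where
    split-off : (Σ Pt λ N → Mono N × ((∀ X → Mono X → c (N ∘ X) ≡ b) ⊎ (∀ X → Mono X → ¬ c (N ∘ X) ≡ b))) →
      Σ Pt λ N → Mono N × Σ ℕ λ v → ∀ X → Mono X → c (N ∘ X) ≡ v
    split-off (N , mN , inj₁ e) = N , mN , b , e
    split-off (N , mN , inj₂ ne) =
      let M , mM , v , e = ramsey-finite (λ X → c (N ∘ X)) (lc-∘ lc mN) b
            (λ X mX → ≤∧≢⇒< (≤-pred (h (N ∘ X) (mN ∘ mX))) (ne X mX))
      in N ∘ M , mN ∘ mM , v , e

  module TermBqo {Q : Set ℓ} {r : Q → Q → Set ℓ'} (rr : ∀ x → r x x) (rt : ∀ {x y z} → r x y → r y z → r x z)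
    (bqo : Bqo r) where

    _≼ᵗ_ : Term Q → Term Q → Set ℓ'
    s ≼ᵗ t = Emb r ⟦ s ⟧ ⟦ t ⟧

    _⊏_ : Term Q → Term Q → Set (lsuc lzero ⊔ ℓ)
    _⊏_ = TransClosure Child

    ⊏⇒≼ : ∀ {s t} → s ⊏ t → s ≼ᵗ t
    ⊏⇒≼ Trans.[ c ] = emb-≡ rr (child-emb {r = r} c)
    ⊏⇒≼ (c Trans.∷ cs) = emb-∘ rt (emb-≡ rr (child-emb {r = r} c)) (⊏⇒≼ cs)

    open MinimalBadArray _≼ᵗ_ _⊏_ (emb-∘ rt) Trans._++_ (Trans.wellFounded Child child-wf) ⊏⇒≼ using (Bad; minimal-bad)

    Minimal : (Pt → Term Q) → Set _
    Minimal f = ∀ c h → Mono c → LC h → Bad h → ¬ (∀ X → Mono X → h X ⊏ f (c ∘ X))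

    kid-of : Term Q → Term Q → Term Q
    kid-of s@(nd k I c x) (nd k' I' c' x') with em (Σ I λ i → ∀ i' → ¬ (x i ≼ᵗ x' i'))
    ... | yes (i , _) = x i
    ... | no _ = s
    kid-of s _ = s

    -- If every child of s embedded in a child of t, `kind-emb` would embed s in t, as equal shapes
    -- have equal kinds.
    kid-of-child : ∀ s t {n} → shape s ≡ 2 + n → shape t ≡ 2 + n → ¬ s ≼ᵗ t →
      Child (kid-of s t) s × (∀ u → Child u t → ¬ (kid-of s t ≼ᵗ u))
    kid-of-child (nd k I c x) (nd k' I' c' x') e e' n with em (Σ I λ i → ∀ i' → ¬ (x i ≼ᵗ x' i'))
    ... | yes (i , q) = kid i , λ { _ (kid i') → q i' }
    ... | no q = ⊥-elim (n (case kind-code-inj k k' (suc-injective (suc-injective (trans e (sym e')))) of λ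
            { refl → kind-emb k c c' (λ i → ⟦ x i ⟧) (λ i → ⟦ x' i ⟧) λ i → byContra λ m → q (i , λ i' p → m (i' , p)) }))

    left right : Term Q → Term Q
    left (cat s t) = s
    left s = s
    right (cat s t) = t
    right s = s

    label : Q → Term Q → Q
    label d (lf q) = q
    label d _ = d

    shape-bound : ∀ (s : Term Q) → shape s < 5
    shape-bound (lf _) = s≤s z≤n
    shape-bound (cat _ _) = s≤s (s≤s z≤n)
    shape-bound (nd k _ _ _) = s≤s (s≤s (kind-bound k))
      where
      kind-bound : ∀ k → kind-code k < 3
      kind-bound ω⁺ = s≤s z≤n
      kind-bound ω⁻ = s≤s (s≤s z≤n)
      kind-bound η = s≤s (s≤s (s≤s z≤n))

    no-leaves : ∀ f → LC f → Bad f → ¬ (∀ X → Mono X → shape (f X) ≡ 0)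
    no-leaves f lc bad sh with f id | sh id id
    ... | lf d | _ = bqo (label d ∘ f) (lc-map (label d) lc) λ X mX p →
            bad X mX (leaves (f X) (f (X ∘ suc)) (sh X mX) (sh (X ∘ suc) (mono-shift mX)) p)
      where
      leaves : ∀ s t → shape s ≡ 0 → shape t ≡ 0 → r (label d s) (label d t) → s ≼ᵗ t
      leaves (lf p) (lf q) _ _ h = emb id id λ _ → h

    -- By Ramsey's theorem the left parts form a bad array on some set, or they compare well
    -- everywhere on one; in the second case the right parts form a bad array. Either array is
    -- strictly below f, against minimality.
    no-cats : ∀ f → LC f → Bad f → Minimal f → ¬ (∀ X → Mono X → shape (f X) ≡ 1)
    no-cats f lc bad min sh = decide (ramsey (lc-zip (λ s t → left s ≼ᵗ left t) lc (lc-shift lc)))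
      where
      cats : ∀ s → shape s ≡ 1 → Child (left s) s × Child (right s) s
      cats (cat s t) _ = cat₁ , cat₂
      join : ∀ s t → shape s ≡ 1 → shape t ≡ 1 → left s ≼ᵗ left t → right s ≼ᵗ right t → s ≼ᵗ t
      join (cat s s') (cat t t') _ _ p q = cat-emb s s' t t' p q
      decide : ¬ Σ Pt λ N → Mono N × ((∀ X → Mono X → left (f (N ∘ X)) ≼ᵗ left (f (N ∘ X ∘ suc))) ⊎
                                      (∀ X → Mono X → ¬ left (f (N ∘ X)) ≼ᵗ left (f (N ∘ X ∘ suc))))
      decide (N , mN , inj₁ h) = min N (λ X → right (f (N ∘ X))) mN (lc-map right (lc-∘ lc mN))
        (λ X mX p → bad (N ∘ X) (mN ∘ mX) (join _ _ (sh (N ∘ X) (mN ∘ mX)) (sh (N ∘ X ∘ suc) (mN ∘ mono-shift mX)) (h X mX) p))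
        (λ X mX → Trans.[ proj₂ (cats (f (N ∘ X)) (sh (N ∘ X) (mN ∘ mX))) ])
      decide (N , mN , inj₂ h) = min N (λ X → left (f (N ∘ X))) mN (lc-map left (lc-∘ lc mN)) h
        (λ X mX → Trans.[ proj₁ (cats (f (N ∘ X)) (sh (N ∘ X) (mN ∘ mX))) ])

    -- The child chosen in f X lies below no child of f (X ∘ suc), in particular not below the one
    -- chosen there. So the choices form a bad array strictly below the minimal one.
    no-nodes : ∀ f n → LC f → Bad f → Minimal f → ¬ (∀ X → Mono X → shape (f X) ≡ 2 + n)
    no-nodes f n lc bad min sh = min id (λ X → kid-of (f X) (f (X ∘ suc))) id (lc-zip kid-of lc (lc-shift lc))
        (λ X mX → proj₂ (kc X mX) _ (proj₁ (kc (X ∘ suc) (mono-shift mX))))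
        (λ X mX → Trans.[ proj₁ (kc X mX) ])
      where
      kc : ∀ X → Mono X → Child (kid-of (f X) (f (X ∘ suc))) (f X) × (∀ u → Child u (f (X ∘ suc)) → ¬ (kid-of (f X) (f (X ∘ suc)) ≼ᵗ u))
      kc X mX = kid-of-child (f X) (f (X ∘ suc)) (sh X mX) (sh (X ∘ suc) (mono-shift mX)) (bad X mX)

    term-bqo : Bqo _≼ᵗ_
    term-bqo f₀ lc₀ bad₀ = refute (minimal-bad f₀ lc₀ bad₀)
      where
      refute : ¬ Σ (Pt → Term Q) λ f → LC f × Bad f × Minimal f
      refute (f , lc , bad , min) = by-shape (ramsey-finite (shape ∘ f) (lc-map shape lc) 5 λ X _ → shape-bound (f X))
        where
        by-shape : ¬ Σ Pt λ N → Mono N × Σ ℕ λ v → ∀ X → Mono X → shape (f (N ∘ X)) ≡ v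
        by-shape (N , mN , v , sh) = go v sh
          where
          lc' = lc-∘ lc mN
          bad' : Bad (λ X → f (N ∘ X))
          bad' X mX = bad (N ∘ X) (mN ∘ mX)
          min' : Minimal (λ X → f (N ∘ X))
          min' c h mc lh bh b = min (N ∘ c) h (mN ∘ mc) lh bh b
          go : ∀ v → ¬ (∀ X → Mono X → shape (f (N ∘ X)) ≡ v)
          go 0 = no-leaves _ lc' bad'
          go 1 = no-cats _ lc' bad' min'
          go (suc (suc n)) = no-nodes _ n lc' bad' min'

  -- Subchains, condensation and Laver's theorem

  holds : {P : Set ℓ} → P → T (does (em P))
  holds {P = P} p with em P
  ... | yes _ = tt
  ... | no n = n p

  sound : {P : Set ℓ} → T (does (em P)) → P
  sound {P = P} t with em P
  ... | yes p = p

  T-prop : ∀ {b} (p q : T b) → p ≡ q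
  T-prop {true} p q = refl

  pairs-eq : ∀ {A : Set} {P : A → Set ℓ} {a b} {p : T (does (em (P a)))} {q : T (does (em (P b)))} → a ≡ b → _≡_ {A = Σ A λ x → T (does (em (P x)))} (a , p) (b , q)
  pairs-eq refl = cong (_ ,_) (T-prop _ _)

  -- The subset is squashed to a Boolean predicate, so that its members are determined by their first components.
  Sub : {Q : Set ℓ} (L : LCh Q) → (∣ L ∣ → Set ℓ') → LCh Q
  Sub L P = record
    { Car = Σ ∣ L ∣ λ x → T (does (em (P x)))
    ; ctb = record { enc = λ (x , _) → Countable.enc ctb x ; enc-inj = λ e → pairs-eq (Countable.enc-inj ctb e) }
    ; _≺_ = λ (x , _) (y , _) → x ≺ y
    ; irr = λ (x , _) → irr x
    ; tra = tra
    ; tri = λ (x , p) (y , q) → case tri x y of λ { (inj₁ h) → inj₁ h ; (inj₂ (inj₁ e)) → inj₂ (inj₁ (pairs-eq e)) ; (inj₂ (inj₂ h)) → inj₂ (inj₂ h) }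
    } , λ (x , _) → proj₂ L x
    where
    open Chain (proj₁ L)

  module _ {Q : Set ℓ} where

    sub-out : (L : LCh Q) (P : ∣ L ∣ → Set ℓ') → Emb _≡_ (Sub L P) L
    sub-out L P = emb proj₁ id (λ _ → refl)

    sub-in : {M : LCh Q} (L : LCh Q) (P : ∣ L ∣ → Set ℓ') (e : Emb _≡_ M L) → (∀ x → P (fun e x)) → Emb _≡_ M (Sub L P)
    sub-in L P e h = emb (λ x → fun e x , holds (h x)) (mono e) (lab e)

    sub-sub : {M : LCh Q} (P : ∣ M ∣ → Set ℓ') (L : LCh Q) (P' : ∣ L ∣ → Set ℓ″) (e : Emb _≡_ M L) →
      (∀ x → P x → P' (fun e x)) → Emb _≡_ (Sub M P) (Sub L P')
    sub-sub {M = M} P L P' e h = sub-in L P' (emb-∘ trans (sub-out M P) e) λ (x , p) → h x (sound p)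

    part : (L : LCh Q) (P : ∣ L ∣ → Set ℓ') (P' : ∣ L ∣ → Set ℓ″) → (∀ x → P x → P' x) → Emb _≡_ (Sub L P) (Sub L P')
    part L P P' h = sub-sub P L P' (emb-id λ _ → refl) h

    lt-total : (L : LCh Q) → ∀ {x y} → ¬ x ≡ y → ¬ Lt L y x → Lt L x y
    lt-total L {x} {y} ne n with Chain.tri (proj₁ L) x y
    ... | inj₁ p = p
    ... | inj₂ (inj₁ e) = ⊥-elim (ne e)
    ... | inj₂ (inj₂ p) = ⊥-elim (n p)

  module Cut {Q : Set ℓ} (M : LCh Q) (P : ∣ M ∣ → Set ℓ') (down : ∀ {x y} → Lt M x y → P y → P x) where

    parts : LCh Q
    parts = Sub M P ⊕ Sub M (¬_ ∘ P)

    side : ∀ x → Dec (P x) → ∣ parts ∣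
    side x (yes p) = false , x , holds p
    side x (no n) = true , x , holds n

    side-mono : ∀ x y (a : Dec (P x)) (b : Dec (P y)) → Lt M x y → Lt parts (side x a) (side y b)
    side-mono x y (yes _) (yes _) q = inner q
    side-mono x y (yes _) (no _) q = outer (refl , refl)
    side-mono x y (no n) (yes p) q = ⊥-elim (n (down q p))
    side-mono x y (no _) (no _) q = inner q

    side-lab : ∀ x (a : Dec (P x)) → proj₂ M x ≡ proj₂ parts (side x a)
    side-lab x (yes _) = refl
    side-lab x (no _) = refl

    to : Emb _≡_ M parts
    to = emb (λ x → side x (em (P x))) (λ {x} {y} → side-mono x y (em (P x)) (em (P y))) (λ x → side-lab x (em (P x)))

    from : Emb _≡_ parts M
    from = emb back back-mono back-lab
      where
      back : ∣ parts ∣ → ∣ M ∣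
      back (false , x , _) = x
      back (true , x , _) = x
      back-mono : ∀ {u v} → Lt parts u v → Lt M (back u) (back v)
      back-mono {false , x , p} {true , y , n} (outer (refl , refl)) =
        lt-total M (λ { refl → sound n (sound p) }) (λ q → sound n (down q (sound p)))
      back-mono (inner {false} q) = q
      back-mono (inner {true} q) = q
      back-lab : ∀ u → proj₂ parts u ≡ proj₂ M (back u)
      back-lab (false , _) = refl
      back-lab (true , _) = refl

  direction : Bool → Kind
  direction true = ω⁺
  direction false = ω⁻

  stream : {Q : Set ℓ} → Bool → (ℕ → LCh Q) → LCh Q
  stream true L = sumCh upward L
  stream false L = sumCh downward L

  module Laver {Q : Set ℓ} {r : Q → Q → Set ℓ'} (rr : ∀ x → r x x) (rt : ∀ {x y z} → r x y → r y z → r x z)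
    (good : GoodPairs λ s t → Emb r ⟦ s ⟧ ⟦ t ⟧) where

    infixr 9 _⨾_
    _⨾_ : ∀ {L M N} → Emb r L M → Emb r M N → Emb r L N
    _⨾_ = emb-∘ rt

    infixr 9 _⨾≡_
    _⨾≡_ : ∀ {L M N : LCh Q} → Emb _≡_ L M → Emb _≡_ M N → Emb _≡_ L N
    _⨾≡_ = emb-∘ trans

    weaken : ∀ {L M} → Emb _≡_ L M → Emb r L M
    weaken = emb-≡ rr

    Denoted : LCh Q → Set (lsuc lzero ⊔ ℓ ⊔ ℓ')
    Denoted L = Σ (Term Q) λ t → Emb r L ⟦ t ⟧ × Emb r ⟦ t ⟧ L

    transport : ∀ {L M} → Emb r L M → Emb r M L → Denoted L → Denoted M
    transport e e' (t , f , f') = t , e' ⨾ f , f' ⨾ e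

    denoted-empty : ∀ {L} → ¬ ∣ L ∣ → Denoted L
    denoted-empty n = nd ω⁺ ⊥ c ⊥-elim , none-emb n , none-emb λ (j , x) → absurd (λ i → ⟦ ⊥-elim i ⟧) (decode c (recur j)) x
      where
      c : Countable ⊥
      c = Chain.ctb (proj₁ (emptyL {Q = Q}))
      absurd : ∀ (F : ⊥ → LCh Q) mi → ¬ ∣ pick F mi ∣
      absurd F nothing ()

    denoted-⊕ : ∀ {L M} → Denoted L → Denoted M → Denoted (L ⊕ M)
    denoted-⊕ {L} {M} (s , e , e') (t , f , f') = cat s t ,
      sum-emb two two (both L M) (both ⟦ s ⟧ ⟦ t ⟧) id id (λ { false → e ; true → f }) ,
      sum-emb two two (both ⟦ s ⟧ ⟦ t ⟧) (both L M) id id (λ { false → e' ; true → f' })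

    stream-emb : ∀ b {F G : ℕ → LCh Q} (h : Pt) → Mono h → (∀ n → Emb r (F n) (G (h n))) → Emb r (stream b F) (stream b G)
    stream-emb true {F} {G} h mh e = sum-emb upward upward F G h mh e
    stream-emb false {F} {G} h mh e = sum-emb downward downward F G h mh e

    Recurrent : (ℕ → Term Q) → Set ℓ'
    Recurrent z = ∀ n k → Σ ℕ λ m → k ≤ m × Emb r ⟦ z n ⟧ ⟦ z m ⟧

    -- In the node every z n occurs infinitely often, so the stream embeds in it. Conversely each
    -- summand of the node, being some z i or empty, fits into arbitrarily late places of the
    -- stream.
    denoted-recurrent : ∀ b (z : ℕ → Term Q) → Recurrent z → Denoted (stream b (⟦_⟧ ∘ z))
    denoted-recurrent b z rec = nd (direction b) ℕ ℕ-countable z , to b , from b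
      where
      F : ℕ → LCh Q
      F n = pick (⟦_⟧ ∘ z) (decode ℕ-countable (recur n))
      there-emb : ∀ n m → recur m ≡ n → Emb r ⟦ z n ⟧ (F m)
      there-emb n m refl rewrite decode-enc ℕ-countable (recur m) = emb-id rr
      g = greedy (λ n m → recur m ≡ n) recur-inf
      to : ∀ b → Emb r (stream b (⟦_⟧ ∘ z)) ⟦ nd (direction b) ℕ ℕ-countable z ⟧
      to true = stream-emb true {⟦_⟧ ∘ z} {F} (proj₁ g) (proj₁ (proj₂ g)) λ n → there-emb n (proj₁ g n) (proj₂ (proj₂ g) n)
      to false = stream-emb false {⟦_⟧ ∘ z} {F} (proj₁ g) (proj₁ (proj₂ g)) λ n → there-emb n (proj₁ g n) (proj₂ (proj₂ g) n)
      back-emb : ∀ mi k → Σ ℕ λ m → k ≤ m × Emb r (pick (⟦_⟧ ∘ z) mi) ⟦ z m ⟧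
      back-emb nothing k = k , ≤-refl , empty-emb
      back-emb (just i) k = rec i k
      g' = greedy (λ n m → Emb r (F n) ⟦ z m ⟧) (λ n → back-emb (decode ℕ-countable (recur n)))
      from : ∀ b → Emb r ⟦ nd (direction b) ℕ ℕ-countable z ⟧ (stream b (⟦_⟧ ∘ z))
      from true = stream-emb true {F} {⟦_⟧ ∘ z} (proj₁ g') (proj₁ (proj₂ g')) (proj₂ (proj₂ g'))
      from false = stream-emb false {F} {⟦_⟧ ∘ z} (proj₁ g') (proj₁ (proj₂ g')) (proj₂ (proj₂ g'))

    -- Call a term lone if it embeds in no sufficiently late term. Infinitely many lone terms, each
    -- taken beyond the bound of the one before, would have no good pair.
    eventually-recurrent : (z : ℕ → Term Q) → Σ ℕ λ N → Recurrent (λ n → z (N + n))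
    eventually-recurrent z = finish (often Lone)
      where
      Lone : ℕ → Set ℓ'
      Lone n = Σ ℕ λ k → ∀ m → k ≤ m → ¬ Emb r ⟦ z n ⟧ ⟦ z m ⟧
      finish : (∀ k → Σ ℕ λ m → k ≤ m × Lone m) ⊎ Σ ℕ (λ k → ∀ m → k ≤ m → ¬ Lone m) → Σ ℕ λ N → Recurrent (λ n → z (N + n))
      finish (inj₂ (N , none)) = N , λ n k → byContra λ no → none (N + n) (m≤m+n N n) (N + k , λ m p e →
        no (m ∸ N , m+n≤o⇒n≤o∸m N p , subst (λ x → Emb r ⟦ z (N + n) ⟧ ⟦ z x ⟧) (sym (m+[n∸m]≡n (≤-trans (m≤m+n N k) p))) e))
        where
        m+n≤o⇒n≤o∸m : ∀ m {n o} → m + n ≤ o → n ≤ o ∸ m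
        m+n≤o⇒n≤o∸m m {n} p = subst (_≤ _) (m+n∸m≡n m n) (∸-monoˡ-≤ m p)
      finish (inj₁ inf) = ⊥-elim (let i , j , i<j , e = good (λ i → z (a i)) in
          proj₂ (lone i) (a j) (≤-trans (late i) (mono-≤ ma i<j)) e)
        where
        st : ℕ → Σ ℕ Lone
        st zero = let m , _ , l = inf 0 in m , l
        st (suc i) = let n , k , _ = st i ; m , _ , l = inf (suc n ⊔ℕ k) in m , l
        a : ℕ → ℕ
        a i = proj₁ (st i)
        lone : ∀ i → Lone (a i)
        lone i = proj₂ (st i)
        above : ∀ i → suc (a i) ⊔ℕ proj₁ (lone i) ≤ a (suc i)
        above i = proj₁ (proj₂ (inf (suc (a i) ⊔ℕ proj₁ (lone i))))
        ma : Mono a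
        ma = mono-step a λ i → ≤-trans (m≤m⊔n (suc (a i)) (proj₁ (lone i))) (above i)
        late : ∀ i → proj₁ (lone i) ≤ a (suc i)
        late i = ≤-trans (m≤n⊔m (suc (a i)) (proj₁ (lone i))) (above i)

    Before : Bool → (M : LCh Q) → ∣ M ∣ → ∣ M ∣ → Set
    Before true M x y = Lt M x y
    Before false M x y = Lt M y x

    Fibre : (M : LCh Q) → (∣ M ∣ → ℕ) → ℕ → LCh Q
    Fibre M p n = Sub M λ x → p x ≡ n

    Fibrewise : (M : LCh Q) → (∣ M ∣ → ℕ) → (ℕ → Term Q) → Set ℓ'
    Fibrewise M p z = ∀ n → Emb r (Fibre M p n) ⟦ z n ⟧ × Emb r ⟦ z n ⟧ (Fibre M p n)

    recurrent-fibres : ∀ b M (p : ∣ M ∣ → ℕ) z → (∀ {x y} → Before b M x y → p x ≤ p y) → Fibrewise M p z → Recurrent z → Denoted M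
    recurrent-fibres b M p z mp d rec = transport (stream-emb b id id (proj₂ ∘ d) ⨾ weaken (from b mp))
        (weaken (to b mp) ⨾ stream-emb b id id (proj₁ ∘ d)) (denoted-recurrent b z rec)
      where
      open Chain (proj₁ M)
      point : ∀ x n → p x ≡ n → ∣ Fibre M p n ∣
      point x n e = x , holds e
      to : ∀ b → (∀ {x y} → Before b M x y → p x ≤ p y) → Emb _≡_ M (stream b (Fibre M p))
      to true mp = emb (λ x → p x , point x (p x) refl) m λ _ → refl
        where
        level : ∀ x y k (h : T (does (em (p y ≡ k)))) → x ≺ y → p x ≡ k →
          Lt (stream true (Fibre M p)) (p x , point x (p x) refl) (k , y , h)
        level x y k h q refl = inner q
        m : ∀ {x y} → x ≺ y → Lt (stream true (Fibre M p)) (p x , point x (p x) refl) (p y , point y (p y) refl)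
        m {x} {y} q with m≤n⇒m<n∨m≡n (mp q)
        ... | inj₁ l = outer l
        ... | inj₂ e = level x y (p y) (holds refl) q e
      to false mp = emb (λ x → p x , point x (p x) refl) m λ _ → refl
        where
        level : ∀ x y k (h : T (does (em (p y ≡ k)))) → x ≺ y → p x ≡ k →
          Lt (stream false (Fibre M p)) (p x , point x (p x) refl) (k , y , h)
        level x y k h q refl = inner q
        m : ∀ {x y} → x ≺ y → Lt (stream false (Fibre M p)) (p x , point x (p x) refl) (p y , point y (p y) refl)
        m {x} {y} q with m≤n⇒m<n∨m≡n (mp q)
        ... | inj₁ l = outer l
        ... | inj₂ e = level x y (p y) (holds refl) q (sym e)
      from : ∀ b → (∀ {x y} → Before b M x y → p x ≤ p y) → Emb _≡_ (stream b (Fibre M p)) M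
      from true mp = emb (λ (n , x , _) → x) m λ _ → refl
        where
        m : ∀ {u v} → Lt (stream true (Fibre M p)) u v → proj₁ (proj₂ u) ≺ proj₁ (proj₂ v)
        m {n , x , h} {k , y , h'} (outer l) = lt-total M
          (λ { refl → <-irrefl (trans (sym (sound h)) (sound h')) l })
          (λ q → <-irrefl refl (<-≤-trans l (subst₂ _≤_ (sound h') (sound h) (mp q))))
        m (inner q) = q
      from false mp = emb (λ (n , x , _) → x) m λ _ → refl
        where
        m : ∀ {u v} → Lt (stream false (Fibre M p)) u v → proj₁ (proj₂ u) ≺ proj₁ (proj₂ v)
        m {n , x , h} {k , y , h'} (outer l) = lt-total M
          (λ { refl → <-irrefl (trans (sym (sound h')) (sound h)) l })
          (λ q → <-irrefl refl (<-≤-trans l (subst₂ _≤_ (sound h) (sound h') (mp q))))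
        m (inner q) = q

    -- Being denoted need not obviously pass to subchains, whereas the condensation below needs a
    -- property closed under them.
    Her : LCh Q → Set (lsuc lzero ⊔ ℓ ⊔ ℓ')
    Her L = ∀ M → Emb _≡_ M L → Denoted M

    her-sub : ∀ {L M} → Emb _≡_ M L → Her L → Her M
    her-sub e h N f = h N (f ⨾≡ e)

    her-single : ∀ {L} → (∀ x y → x ≡ y) → Her L
    her-single {L} one M e with em ∣ M ∣
    ... | no n = denoted-empty n
    ... | yes m = lf (proj₂ M m) ,
      emb (λ _ → tt) (λ q → ⊥-elim (Chain.irr (proj₁ L) _ (subst (Lt L _) (one _ _) (mono e q))))
        (λ x → subst (λ l → r l (proj₂ M m)) (trans (lab e m) (trans (cong (proj₂ L) (one _ _)) (sym (lab e x)))) (rr _)) ,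
      emb (λ _ → m) (λ ()) (λ _ → rr _)

    denoted-cut : ∀ M (P : ∣ M ∣ → Set ℓ″) → (∀ {x y} → Lt M x y → P y → P x) →
      Denoted (Sub M P) → Denoted (Sub M (¬_ ∘ P)) → Denoted M
    denoted-cut M P down d d' = transport (weaken (Cut.from M P down)) (weaken (Cut.to M P down)) (denoted-⊕ d d')

    -- From some fibre on the terms are recurrent; the finitely many fibres before it are cut off
    -- one at a time and rejoined by `cat`.
    denoted-fibres : ∀ b M (p : ∣ M ∣ → ℕ) → (∀ {x y} → Before b M x y → p x ≤ p y) →
      (∀ n → Denoted (Fibre M p n)) → Denoted M
    denoted-fibres b M p mp d = let N , rec = eventually-recurrent z in cut-off N M p z mp (λ n → proj₂ (d n)) rec
      where
      z : ℕ → Term Q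
      z n = proj₁ (d n)
      cut-off : ∀ N M (p : ∣ M ∣ → ℕ) z → (∀ {x y} → Before b M x y → p x ≤ p y) → Fibrewise M p z →
        Recurrent (λ n → z (N + n)) → Denoted M
      cut-off zero M p z mp d rec = recurrent-fibres b M p z mp d rec
      cut-off (suc N) M p z mp d rec = join b mp
        where
        Positive : ∣ M ∣ → Set
        Positive x = 0 < p x
        shifted : ∀ n → Emb r (Fibre (Sub M Positive) (pred ∘ p ∘ proj₁) n) ⟦ z (suc n) ⟧ × Emb r ⟦ z (suc n) ⟧ (Fibre (Sub M Positive) (pred ∘ p ∘ proj₁) n)
        shifted n = weaken (sub-sub _ M (λ x → p x ≡ suc n) (sub-out M Positive) λ (x , q) e → up (p x) (sound q) e) ⨾ proj₁ (d (suc n)) ,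
            proj₂ (d (suc n)) ⨾ weaken (sub-in (Sub M Positive) (λ x → pred (p (proj₁ x)) ≡ n)
              (part M (λ x → p x ≡ suc n) Positive λ x e → subst (0 <_) (sym e) (s≤s z≤n)) λ (x , e) → cong pred (sound e))
          where
          up : ∀ m → 0 < m → pred m ≡ n → m ≡ suc n
          up (suc m) _ e = cong suc e
        positive : Denoted (Sub M Positive)
        positive = cut-off N (Sub M Positive) (pred ∘ p ∘ proj₁) (z ∘ suc) (λ {x} {y} → shift-mono b mp x y) shifted rec
          where
          shift-mono : ∀ b → (∀ {x y} → Before b M x y → p x ≤ p y) → ∀ x y → Before b (Sub M Positive) x y → pred (p (proj₁ x)) ≤ pred (p (proj₁ y))
          shift-mono true mp x y l = pred-mono-≤ (mp l)
          shift-mono false mp x y l = pred-mono-≤ (mp l)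
        null : Denoted (Fibre M p 0)
        null = z 0 , d 0
        join : ∀ b → (∀ {x y} → Before b M x y → p x ≤ p y) → Denoted M
        join true mp = denoted-cut M (λ x → p x ≡ 0) (λ l e → n≤0⇒n≡0 (subst (p _ ≤_) e (mp l))) null
          (transport (weaken (part M Positive (λ x → ¬ p x ≡ 0) λ x q e → <-irrefl (sym e) q))
            (weaken (part M (λ x → ¬ p x ≡ 0) Positive λ x n → n≢0⇒n>0 n)) positive)
        join false mp = denoted-cut M Positive (λ l q → <-≤-trans q (mp l)) positive
          (transport (weaken (part M (λ x → p x ≡ 0) (λ x → ¬ 0 < p x) λ x e q → <-irrefl (sym e) q))
            (weaken (part M (λ x → ¬ 0 < p x) (λ x → p x ≡ 0) λ x n → n≤0⇒n≡0 (≮⇒≥ n))) null)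

    her-cut : ∀ L (P : ∣ L ∣ → Set ℓ″) → (∀ {x y} → Lt L x y → P y → P x) →
      Her (Sub L P) → Her (Sub L (¬_ ∘ P)) → Her L
    her-cut L P down h h' M e = denoted-cut M (P ∘ fun e) (down ∘ mono e)
      (h _ (sub-sub (P ∘ fun e) L P e λ _ → id)) (h' _ (sub-sub (¬_ ∘ P ∘ fun e) L (¬_ ∘ P) e λ _ → id))

    UpTo : Bool → (M : LCh Q) → ∣ M ∣ → ∣ M ∣ → Set
    UpTo b M e y = y ≡ e ⊎ Before b M y e

    -- Fibres of y ↦ the least code of an element beyond y.
    denoted-direction : ∀ b M → (∀ e → Her (Sub M (UpTo b M e))) → Denoted M
    denoted-direction b M h = denoted-fibres b M (λ y → proj₁ (code y)) mp fib
      where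
      open Chain (proj₁ M)
      Beyond : ∣ M ∣ → ℕ → Set
      Beyond y n = Σ ∣ M ∣ λ e → Countable.enc ctb e ≡ n × UpTo b M e y
      code : ∀ y → Σ ℕ λ n → Beyond y n × (∀ m → m < n → ¬ Beyond y m)
      code y = least (Beyond y) (_ , y , refl , inj₁ refl)
      before-trans : ∀ b {x y z} → Before b M x y → Before b M y z → Before b M x z
      before-trans true p q = tra p q
      before-trans false p q = tra q p
      mp : ∀ {x y} → Before b M x y → proj₁ (code x) ≤ proj₁ (code y)
      mp {x} {y} q with code x | code y
      ... | n , _ , min | m , (e , ee , u) , _ = ≮⇒≥ λ l → min m l (e , ee , inj₂ (case u of λ
          { (inj₁ refl) → q ; (inj₂ q') → before-trans b q q' }))
      fib : ∀ n → Denoted (Fibre M (λ y → proj₁ (code y)) n)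
      fib n with em (Σ ∣ M ∣ λ e → Countable.enc ctb e ≡ n)
      ... | no none = denoted-empty λ (y , t) → let e , ee , _ = proj₁ (proj₂ (code y)) in none (e , trans ee (sound t))
      ... | yes (e , refl) = h e _ (sub-sub _ M (UpTo b M e) (emb-id λ _ → refl) λ y c →
              let e' , ee , u = proj₁ (proj₂ (code y)) in subst (λ e → UpTo b M e y) (Countable.enc-inj ctb (trans ee c)) u)

    her-direction : ∀ b L → (∀ e → Her (Sub L (UpTo b L e))) → Her L
    her-direction b L h M f = denoted-direction b M λ e → her-sub (sub-sub (UpTo b M e) L (UpTo b L (fun f e)) f (carry b e)) (h (fun f e))
      where
      carry : ∀ b e x → UpTo b M e x → UpTo b L (fun f e) (fun f x)
      carry b e x (inj₁ refl) = inj₁ refl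
      carry true e x (inj₂ q) = inj₂ (mono f q)
      carry false e x (inj₂ q) = inj₂ (mono f q)

  -- Hausdorff's argument for an undenoted chain N. The condensation identifies points with a
  -- hereditarily denoted interval between them; its quotient is dense, and by absorption every
  -- class fits between any two classes, so N would be equimorphic to a dense shuffle of its
  -- classes.
  module Condense {Q : Set ℓ} {r : Q → Q → Set ℓ'} (rr : ∀ x → r x x) (rt : ∀ {x y z} → r x y → r y z → r x z)
    (good : GoodPairs λ s t → Emb r ⟦ s ⟧ ⟦ t ⟧)
    (N : LCh Q) (¬dN : ¬ Laver.Denoted rr rt good N)
    (absorbs : ∀ N' → Emb _≡_ N' N → ¬ Laver.Her rr rt good N' → ∀ t → Emb r ⟦ t ⟧ N → Emb r ⟦ t ⟧ N') where

    open Laver rr rt good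
    open Chain (proj₁ N)
    open Countable ctb

    _⊴_ : Car → Car → Set
    x ⊴ y = x ≡ y ⊎ x ≺ y

    ⊴-trans : ∀ {x y z} → x ⊴ y → y ⊴ z → x ⊴ z
    ⊴-trans (inj₁ refl) q = q
    ⊴-trans (inj₂ p) (inj₁ refl) = inj₂ p
    ⊴-trans (inj₂ p) (inj₂ q) = inj₂ (tra p q)

    ⊴-≺ : ∀ {x y z} → x ⊴ y → y ≺ z → x ≺ z
    ⊴-≺ (inj₁ refl) q = q
    ⊴-≺ (inj₂ p) q = tra p q

    ≺-⊴ : ∀ {x y z} → x ≺ y → y ⊴ z → x ≺ z
    ≺-⊴ p (inj₁ refl) = p
    ≺-⊴ p (inj₂ q) = tra p q

    not-≺ : ∀ {x y} → ¬ (x ≺ y) → y ⊴ x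
    not-≺ {x} {y} n with tri x y
    ... | inj₁ p = ⊥-elim (n p)
    ... | inj₂ (inj₁ e) = inj₁ (sym e)
    ... | inj₂ (inj₂ p) = inj₂ p

    Btw : Car → Car → Car → Set
    Btw x y z = (x ⊴ z × z ⊴ y) ⊎ (y ⊴ z × z ⊴ x)

    Btw-sym : ∀ {x y z} → Btw x y z → Btw y x z
    Btw-sym (inj₁ p) = inj₂ p
    Btw-sym (inj₂ p) = inj₁ p

    Btw-≺ : ∀ {x y z} → x ≺ y → Btw x y z → x ⊴ z × z ⊴ y
    Btw-≺ q (inj₁ p) = p
    Btw-≺ q (inj₂ (p , p')) = ⊥-elim (irr _ (≺-⊴ q (⊴-trans p p')))

    Btw-mono : ∀ {x y z w} → Btw x y z → Btw x z w → Btw x y w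
    Btw-mono (inj₁ (p , q)) (inj₁ (s , t)) = inj₁ (s , ⊴-trans t q)
    Btw-mono (inj₁ (p , q)) (inj₂ (s , t)) = inj₁ (⊴-trans p s , ⊴-trans t (⊴-trans p q))
    Btw-mono (inj₂ (p , q)) (inj₁ (s , t)) = inj₂ (⊴-trans p (⊴-trans q s) , ⊴-trans t q)
    Btw-mono (inj₂ (p , q)) (inj₂ (s , t)) = inj₂ (⊴-trans p s , t)

    _~_ : Car → Car → Set _
    x ~ y = Her (Sub N (Btw x y))

    part-of-part : ∀ {a b c} (P : Car → Set a) (A : ∣ Sub N P ∣ → Set b) (P' : Car → Set c) →
      (∀ x (p : T (does (em (P x)))) → A (x , p) → P' x) → Emb _≡_ (Sub (Sub N P) A) (Sub N P')
    part-of-part P A P' h = sub-sub A N P' (sub-out N P) λ (x , p) → h x p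

    ~-refl : ∀ x → x ~ x
    ~-refl x = her-single λ (y , p) (z , q) → pairs-eq (trans (same (sound p)) (sym (same (sound q))))
      where
      same : ∀ {y} → Btw x x y → y ≡ x
      same (inj₁ (inj₁ refl , _)) = refl
      same (inj₁ (inj₂ p , q)) = ⊥-elim (irr _ (≺-⊴ p q))
      same (inj₂ (inj₁ refl , _)) = refl
      same (inj₂ (inj₂ p , q)) = ⊥-elim (irr _ (≺-⊴ p q))

    ~-sym : ∀ {x y} → x ~ y → y ~ x
    ~-sym {x} {y} = her-sub (part N (Btw y x) (Btw x y) λ _ → Btw-sym)

    ~-convex : ∀ {x y z} → Btw x y z → x ~ y → x ~ z
    ~-convex {x} {y} {z} b = her-sub (part N (Btw x z) (Btw x y) λ _ → Btw-mono b)

    ~-trans : ∀ {x y z} → x ~ y → y ~ z → x ~ z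
    ~-trans {x} {y} {z} p q = her-cut (Sub N (Btw x z)) (λ (m , _) → m ⊴ y) (λ l → ⊴-trans (inj₂ l)) (low (em (z ≺ x))) (high (em (z ≺ x)))
      where
      low : Dec (z ≺ x) → Her (Sub (Sub N (Btw x z)) (λ (m , _) → m ⊴ y))
      low (yes zx) = her-sub (part-of-part (Btw x z) (λ (m , _) → m ⊴ y) (Btw y z) λ m b m≤y → inj₂ (proj₁ (Btw-≺ zx (Btw-sym (sound b))) , m≤y)) q
      low (no n) = her-sub (part-of-part (Btw x z) (λ (m , _) → m ⊴ y) (Btw x y) λ m b m≤y → inj₁ ((case sound b of λ { (inj₁ (s , _)) → s ; (inj₂ (s , _)) → ⊴-trans (not-≺ n) s }) , m≤y)) p
      high : Dec (z ≺ x) → Her (Sub (Sub N (Btw x z)) (λ (m , _) → ¬ m ⊴ y))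
      high (yes zx) = her-sub (part-of-part (Btw x z) (λ (m , _) → ¬ m ⊴ y) (Btw x y) λ m b n → inj₂ (not-≺ (n ∘ inj₂) , proj₂ (Btw-≺ zx (Btw-sym (sound b))))) p
      high (no n) = her-sub (part-of-part (Btw x z) (λ (m , _) → ¬ m ⊴ y) (Btw y z) λ m b n' → inj₁ (not-≺ (n' ∘ inj₂) , (case sound b of λ
        { (inj₁ (_ , s)) → s ; (inj₂ (_ , s)) → ⊴-trans s (not-≺ n) }))) q

    Class : Car → LCh Q
    Class x = Sub N (x ~_)

    -- On either side of x the class is exhausted by intervals from x to a member e, which are
    -- hereditarily denoted because x ~ e.
    her-class : ∀ x → Her (Class x)
    her-class x = her-cut (Class x) (λ (y , _) → y ≺ x) tra
        (her-direction false Down λ ((e , p) , _) → her-sub (sub-sub (UpTo false Down _) N (Btw x e) (out Down-pred) λ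
          { ((y , _) , y≺x) u → inj₂ (upto u , inj₂ (sound y≺x)) }) (sound p))
        (her-direction true Up λ ((e , p) , _) → her-sub (sub-sub (UpTo true Up _) N (Btw x e) (out Up-pred) λ
          { ((y , _) , n) u → inj₁ (not-≺ (sound n) , upto' u) }) (sound p))
      where
      Down-pred Up-pred : ∣ Class x ∣ → Set
      Down-pred (y , _) = y ≺ x
      Up-pred (y , _) = ¬ y ≺ x
      Down Up : LCh Q
      Down = Sub (Class x) Down-pred
      Up = Sub (Class x) Up-pred
      out : (P : ∣ Class x ∣ → Set) → Emb _≡_ (Sub (Class x) P) N
      out P = sub-out (Class x) P ⨾≡ sub-out N (x ~_)
      upto : ∀ {e y} → UpTo false Down e y → proj₁ (proj₁ e) ⊴ proj₁ (proj₁ y)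
      upto (inj₁ refl) = inj₁ refl
      upto (inj₂ q) = inj₂ q
      upto' : ∀ {e y} → UpTo true Up e y → proj₁ (proj₁ y) ⊴ proj₁ (proj₁ e)
      upto' (inj₁ refl) = inj₁ refl
      upto' (inj₂ q) = inj₂ q

    word : ∀ x → Denoted (Class x)
    word x = her-class x (Class x) (emb-id λ _ → refl)

    _≪≪_ : Car → Car → Set _
    x ≪≪ y = x ≺ y × ¬ x ~ y

    ≪≪-⊴ : ∀ {x y z} → x ≪≪ y → y ⊴ z → x ≪≪ z
    ≪≪-⊴ (p , n) q = ≺-⊴ p q , λ h → n (~-convex (inj₁ (inj₂ p , q)) h)

    ⊴-≪≪ : ∀ {x y z} → x ⊴ y → y ≪≪ z → x ≪≪ z
    ⊴-≪≪ q (p , n) = ⊴-≺ q p , λ h → n (~-sym (~-convex (inj₂ (q , inj₂ p)) (~-sym h)))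

    separated : Σ Car λ x → Σ Car λ y → x ≪≪ y
    separated with em Car
    ... | no n = ⊥-elim (¬dN (denoted-empty n))
    ... | yes x with em (∀ y → x ~ y)
    ...   | yes all = ⊥-elim (¬dN (her-class x N (sub-in N (x ~_) (emb-id λ _ → refl) all)))
    ...   | no n with ¬∀⇒∃¬ n
    ...     | y , q with tri x y
    ...       | inj₁ p = x , y , p , q
    ...       | inj₂ (inj₁ refl) = ⊥-elim (q (~-refl x))
    ...       | inj₂ (inj₂ p) = y , x , p , λ h → q (~-sym h)

    -- If no class lay strictly between, the interval from x to y would be a piece of one class
    -- followed by a piece of another, hence hereditarily denoted, and x ~ y.
    between : ∀ {x y} → x ≪≪ y → Σ Car λ z → x ≪≪ z × z ≪≪ y
    between {x} {y} (x≺y , n) = byContra λ none → n (collapse none)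
      where
      collapse : ¬ (Σ Car λ z → x ≪≪ z × z ≪≪ y) → x ~ y
      collapse none = her-cut (Sub N (Btw x y)) (λ (m , _) → x ~ m)
          (λ {(m , b)} l h → ~-convex (inj₁ (proj₁ (Btw-≺ x≺y (sound b)) , inj₂ l)) h)
          (her-sub (part-of-part (Btw x y) (λ (m , _) → x ~ m) (x ~_) λ m b h → h) (her-class x))
          (her-sub (part-of-part (Btw x y) (λ (m , _) → ¬ x ~ m) (y ~_) close) (her-class y))
        where
        close : ∀ m (b : T (does (em (Btw x y m)))) → ¬ x ~ m → y ~ m
        close m b h with Btw-≺ x≺y (sound b)
        ... | inj₁ refl , _ = ⊥-elim (h (~-refl x))
        ... | inj₂ _ , inj₁ refl = ~-refl y
        ... | inj₂ p , inj₂ q = byContra λ h' → none (m , (p , h) , (q , λ s → h' (~-sym s)))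

    base = separated
    x₀ = proj₁ base
    y₀ = proj₁ (proj₂ base)

    -- The ends keep strictly inside x₀ and y₀ even as classes, so there is always room for another
    -- interval on either side.
    record Interval : Set (lsuc lzero ⊔ ℓ ⊔ ℓ') where
      constructor interval
      field
        lo hi : Car
        x₀≪ : x₀ ≪≪ lo
        wide : lo ≪≪ hi
        ≪y₀ : hi ≪≪ y₀
    open Interval

    -- The index chain of an η-sum embeds into the intervals, and N absorbs each summand into each interval.
    shuffle-into : (F : Maybe Car → LCh Q) → (∀ m I → Emb r (F m) (Sub N (Btw (lo I) (hi I)))) → (c : Chain.Car dense → Maybe Car) →
      Emb r (sumCh dense (F ∘ c)) N
    shuffle-into F fit c = emb (λ (j , x) → place j x) place-mono λ (j , x) → lab (fit (c j) (h j)) x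
      where
      left-end : Maybe Interval → Car
      left-end nothing = x₀
      left-end (just I) = hi I
      right-end : Maybe Interval → Car
      right-end nothing = y₀
      right-end (just I) = lo I
      open Forth dense {B = Interval} (λ I J → hi I ≪≪ lo J) (λ {I} {J} {K} p q → ≪≪-⊴ p (inj₂ (tra (proj₁ (wide J)) (proj₁ q)))) (λ _ _ → ⊤)
      room : ∀ l u → Gap l u → left-end l ≪≪ right-end u
      room nothing nothing _ = proj₂ (proj₂ base)
      room nothing (just J) _ = x₀≪ J
      room (just I) nothing _ = ≪y₀ I
      room (just I) (just J) p = p
      x₀⊴ : ∀ l → x₀ ⊴ left-end l
      x₀⊴ nothing = inj₁ refl
      x₀⊴ (just I) = inj₂ (tra (proj₁ (x₀≪ I)) (proj₁ (wide I)))
      ⊴y₀ : ∀ u → right-end u ⊴ y₀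
      ⊴y₀ nothing = inj₁ refl
      ⊴y₀ (just J) = inj₂ (tra (proj₁ (wide J)) (proj₁ (≪y₀ J)))
      fill : ∀ a l u → Gap l u → Σ Interval λ I → ⊤ × l ≪ I × u ≫ I
      fill a l u gap = let p , lp , pu = between (room l u gap) ; q , pq , qu = between pu in
        interval p q (⊴-≪≪ (x₀⊴ l) lp) pq (≪≪-⊴ qu (⊴y₀ u)) , tt ,
        (λ { I refl → lp }) , (λ { J refl → qu })
      f = forth fill
      h = proj₁ f
      place : ∀ j → ∣ F (c j) ∣ → Car
      place j x = proj₁ (fun (fit (c j) (h j)) x)
      place-in : ∀ j x → lo (h j) ⊴ place j x × place j x ⊴ hi (h j)
      place-in j x = Btw-≺ (proj₁ (wide (h j))) (sound (proj₂ (fun (fit (c j) (h j)) x)))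
      place-mono : ∀ {p q} → Lt (sumCh dense (F ∘ c)) p q → place (proj₁ p) (proj₂ p) ≺ place (proj₁ q) (proj₂ q)
      place-mono {j , x} {k , y} (outer l) = ⊴-≺ (proj₂ (place-in j x)) (≺-⊴ (proj₁ (proj₂ (proj₂ f) l)) (proj₁ (place-in k y)))
      place-mono (inner {j} l) = mono (fit (c j) (h j)) l

    -- It embeds in N by absorption. N embeds in it because the representatives form a countable
    -- chain, which goes into the dense chain with each representative at a place of its own colour.
    shuffle : Term Q
    shuffle = nd η Car ctb λ x → proj₁ (word x)

    shuffle≤N : Emb r ⟦ shuffle ⟧ N
    shuffle≤N = shuffle-into (pick λ x → ⟦ proj₁ (word x) ⟧) fit (λ j → decode ctb (colour η j))
      where
      fit : ∀ m I → Emb r (pick (λ x → ⟦ proj₁ (word x) ⟧) m) (Sub N (Btw (lo I) (hi I)))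
      fit nothing I = empty-emb
      fit (just x) I = absorbs _ (sub-out N _) (proj₂ (wide I)) (proj₁ (word x))
        (proj₂ (proj₂ (word x)) ⨾ weaken (sub-out N (x ~_)))

    open Representatives ctb _~_ ~-refl ~-sym ~-trans using (rep; rep-eq) renaming (∼rep to x~rep)

    rep-≺ : ∀ {x y} → x ≺ y → ¬ x ~ y → rep x ≺ rep y
    rep-≺ {x} {y} p n = lt-total N
      (λ e → n (~-trans (x~rep x) (subst (_~ y) (sym e) (~-sym (x~rep y)))))
      (λ q → case em (x ≺ rep y) of λ
        { (yes s) → n (~-trans (~-convex (inj₁ (inj₂ s , inj₂ q)) (x~rep x)) (~-sym (x~rep y)))
        ; (no s) → n (~-sym (~-convex (inj₂ (not-≺ s , inj₂ p)) (x~rep y))) })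

    Reps : LCh Q
    Reps = Sub N λ a → rep a ≡ a

    module Gather (rep' : Car → Car) (x~rep' : ∀ x → x ~ rep' x) (rep'-eq : ∀ {x y} → x ~ y → rep' x ≡ rep' y)
      (rep'-≺ : ∀ {x y} → x ≺ y → ¬ x ~ y → rep' x ≺ rep' y) (is-rep : ∀ x → T (does (em (rep (rep' x) ≡ rep' x))))
      (w : Car → Term Q) (class-emb : ∀ x → Emb r (Class x) ⟦ w x ⟧)
      (h : ∣ Reps ∣ → Chain.Car dense) (h-colour : ∀ s → colour η (h s) ≡ enc (proj₁ s))
      (h-mono : ∀ {s t} → Lt Reps s t → Chain._≺_ dense (h s) (h t)) where

      rep-point : Car → ∣ Reps ∣
      rep-point x = rep' x , is-rep x
      F : Maybe Car → LCh Q
      F = pick λ x → ⟦ w x ⟧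
      target : LCh Q
      target = kindSum η ctb λ x → ⟦ w x ⟧
      fit : ∀ s → Emb r (Class (proj₁ s)) (F (decode ctb (colour η (h s))))
      fit s = subst (λ mi → Emb r (Class (proj₁ s)) (F mi))
        (sym (trans (cong (decode ctb) (h-colour s)) (decode-enc ctb (proj₁ s)))) (class-emb (proj₁ s))
      place : ∀ s x → T (does (em (proj₁ s ~ x))) → ∣ target ∣
      place s x p = h s , fun (fit s) (x , p)
      same-block : ∀ s s' x y p q → s ≡ s' → x ≺ y → Lt target (place s x p) (place s' y q)
      same-block s s' x y p q refl l = inner (mono (fit s) l)
      member : ∀ x → T (does (em (rep' x ~ x)))
      member x = holds (~-sym (x~rep' x))
      place-mono : ∀ x y → x ≺ y → Dec (x ~ y) → Lt target (place (rep-point x) x (member x)) (place (rep-point y) y (member y))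
      place-mono x y l (yes e) = same-block (rep-point x) (rep-point y) x y (member x) (member y)
        (pairs-eq (rep'-eq e)) l
      place-mono x y l (no n) = outer (h-mono {rep-point x} {rep-point y} (rep'-≺ l n))
      gather : Emb r N target
      gather = emb (λ x → place (rep-point x) x (member x)) (λ {x} {y} l → place-mono x y l (em (x ~ y)))
        (λ x → lab (fit (rep-point x)) (x , member x))

    N≤shuffle : Emb r N ⟦ shuffle ⟧
    N≤shuffle = let h , col , h-mono = dense-universal (proj₁ Reps) (λ (a , _) → enc a) in
      Gather.gather rep x~rep rep-eq rep-≺ (λ x → holds (rep-eq (~-sym (x~rep x))))
        (λ x → proj₁ (word x)) (λ x → proj₁ (proj₂ (word x))) h col h-mono

    contradiction-N : ⊥
    contradiction-N = ¬dN (shuffle , N≤shuffle , shuffle≤N)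

  module Representation {Q : Set ℓ} {r : Q → Q → Set ℓ'} (rr : ∀ x → r x x) (rt : ∀ {x y z} → r x y → r y z → r x z)
    (good : GoodPairs λ s t → Emb r ⟦ s ⟧ ⟦ t ⟧) where

    open Laver rr rt good

    Absorbing : LCh Q → Set _
    Absorbing N = ∀ N' → Emb _≡_ N' N → ¬ Her N' → ∀ t → Emb r ⟦ t ⟧ N → Emb r ⟦ t ⟧ N'

    Shrink : LCh Q → Set _
    Shrink N = Σ (LCh Q) λ N' → Emb _≡_ N' N × ¬ Her N' × Σ (Term Q) λ t → Emb r ⟦ t ⟧ N × ¬ Emb r ⟦ t ⟧ N'

    -- Otherwise ever smaller subchains lose terms t₀, t₁, … in turn, against good.
    absorbing : ∀ L → ¬ Her L → Σ (LCh Q) λ N → ¬ Her N × Absorbing N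
    absorbing L ¬hL = byContra λ none → descend λ N ¬h → byContra λ ns → none (N , ¬h ,
        λ N' e ¬h' t f → byContra λ nf → ns (N' , e , ¬h' , t , f , nf))
      where
      descend : ¬ (∀ N → ¬ Her N → Shrink N)
      descend sh = let i , j , i<j , e = good (λ i → proj₁ (lost i)) in
          proj₂ (proj₂ (lost i)) (e ⨾ proj₁ (proj₂ (lost j)) ⨾ weaken (below i<j))
        where
        st : ℕ → Σ (LCh Q) λ N → ¬ Her N
        st zero = L , ¬hL
        st (suc i) = let N' , _ , ¬h' , _ = sh (proj₁ (st i)) (proj₂ (st i)) in N' , ¬h'
        lost : ∀ i → Σ (Term Q) λ t → Emb r ⟦ t ⟧ (proj₁ (st i)) × ¬ Emb r ⟦ t ⟧ (proj₁ (st (suc i)))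
        lost i = proj₂ (proj₂ (proj₂ (sh (proj₁ (st i)) (proj₂ (st i)))))
        step : ∀ i → Emb _≡_ (proj₁ (st (suc i))) (proj₁ (st i))
        step i = proj₁ (proj₂ (sh (proj₁ (st i)) (proj₂ (st i))))
        below : ∀ {i j} → i < j → Emb _≡_ (proj₁ (st j)) (proj₁ (st (suc i)))
        below {i} {suc j} (s≤s i≤j) with m≤n⇒m<n∨m≡n i≤j
        ... | inj₁ i<j = step j ⨾≡ below i<j
        ... | inj₂ refl = emb-id λ _ → refl

    -- An undenoted subchain M of an absorbing N is again absorbing in the sense required by
    -- `Condense`, and M itself is undenoted.
    denoted : ∀ L → Denoted L
    denoted L = byContra λ nd → refute (absorbing L λ h → nd (h L (emb-id λ _ → refl)))
      where
      refute : ¬ Σ (LCh Q) λ N → ¬ Her N × Absorbing N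
      refute (N , ¬h , abs) = let M , q = ¬∀⇒∃¬ ¬h ; e , ¬d = ¬∀⇒∃¬ q in
        Condense.contradiction-N rr rt good M ¬d λ N' e' ¬h' t f → abs N' (e' ⨾≡ e) ¬h' t (f ⨾ weaken e)

  bqo⇒good : {Q : Set ℓ} {r : Q → Q → Set ℓ'} → Bqo r → GoodPairs r
  bqo⇒good {r = r} b x = byContra λ none → b (λ X → x (X 0)) (λ X _ → 1 , λ Y _ a → cong x (a 0 (s≤s z≤n)))
    λ X mX p → none (X 0 , X 1 , mX (s≤s z≤n) , p)

  -- The denoting term depends only on the chain, so replacing values by terms keeps an array
  -- locally constant.
  chains-bqo : {Q : Set ℓ} {r : Q → Q → Set ℓ'} → (∀ x → r x x) → (∀ {x y z} → r x y → r y z → r x z) →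
    Bqo r → Bqo (Emb r)
  chains-bqo {Q = Q} {r} rr rt b f lc bad = terms (λ X → proj₁ (term (f X))) (lc-map (λ L → proj₁ (term L)) lc) λ X mX e →
      bad X mX (emb-∘ rt (proj₁ (proj₂ (term (f X)))) (emb-∘ rt e (proj₂ (proj₂ (term (f (X ∘ suc)))))))
    where
    terms : Bqo (λ s t → Emb r ⟦ s ⟧ ⟦ t ⟧)
    terms = TermBqo.term-bqo rr rt b
    terms-good : GoodPairs (λ s t → Emb r ⟦ s ⟧ ⟦ t ⟧)
    terms-good = bqo⇒good {r = λ s t → Emb r ⟦ s ⟧ ⟦ t ⟧} terms
    term : ∀ L → Laver.Denoted rr rt terms-good L
    term = Representation.denoted rr rt terms-good

  -- Transitive orientations of graphs

  module Forcing {V : Set} (E : V → V → Set) (E-sym : ∀ {x y} → E x y → E y x) (E-irr : ∀ {x} → ¬ E x x) where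

    -- Gallai's forcing, up to reversal: edges with a common end whose other ends are not adjacent
    -- must point the same way at the common end in a transitive orientation.
    data Link (p q : V) : V → V → Set where
      start : Link p q p q
      flip : ∀ {x y} → Link p q x y → Link p q y x
      turn : ∀ {x y y'} → Link p q x y → E x y' → ¬ E y y' → Link p q x y'

    link-edge : ∀ {p q x y} → E p q → Link p q x y → E x y
    link-edge e start = e
    link-edge e (flip l) = E-sym (link-edge e l)
    link-edge e (turn l e' _) = e'

    link-trans : ∀ {p q x y u v} → Link p q x y → Link x y u v → Link p q u v
    link-trans l start = l
    link-trans l (flip m) = flip (link-trans l m)
    link-trans l (turn m e n) = turn (link-trans l m) e n

    link-sym : ∀ {p q x y} → E p q → Link p q x y → Link x y p q
    link-sym e start = start
    link-sym e (flip l) = link-trans (flip start) (link-sym e l)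
    link-sym e (turn l e' n) = link-trans (turn start (link-edge e l) (n ∘ E-sym)) (link-sym e l)

    Met : V → V → V → Set
    Met p q v = Σ V λ w → Link p q v w

    -- If v were adjacent to x but not to y, the edge xy would force xv, and v would be met by the
    -- class.
    spread : ∀ {p q v x y} → ¬ Met p q v → Link p q x y → E v x → E v y
    spread {x = x} {y} nm l e = byContra λ n → nm (x , flip (turn l (E-sym e) (n ∘ E-sym)))

    spread-all : ∀ {p q v x y u w} → ¬ Met p q v → Link p q x y → E v x → Link x y u w → E v u × E v w
    spread-all nm l e start = e , spread nm l e
    spread-all nm l e (flip m) = let a , b = spread-all nm l e m in b , a
    spread-all nm l e (turn m e' n) = let a , b = spread-all nm l e m in a , spread nm (link-trans l (turn m e' n)) a

    -- Gallai's triangle lemma: if the side bc of a triangle lies in the class and the sides at a do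
    -- not, then a is joined to the ends of all edges of the class, by edges outside it. So the
    -- class does not meet a.
    apart : ∀ {p q a b c x y} → E p q → E a b → E a c → ¬ Link p q a b → ¬ Link p q a c → Link p q b c → Link b c x y →
      (E a x × ¬ Link p q a x) × (E a y × ¬ Link p q a y)
    apart e ab ac nb nc l start = (ab , nb) , (ac , nc)
    apart e ab ac nb nc l (flip m) = let s , t = apart e ab ac nb nc l m in t , s
    apart {a = a} e ab ac nb nc l (turn {x} {y} {y'} m e' n) with apart e ab ac nb nc l m
    ... | (ax , nx) , (ay , ny) = (ax , nx) , ay' , λ k → ny (turn k ay (n ∘ E-sym))
      where
      ay' : E a y'
      ay' = byContra λ k → nx (flip (turn (link-trans l (turn m e' n)) (E-sym ax) (k ∘ E-sym)))

    module _ (span : ∀ p q → E p q → ∀ v → Met p q v) where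

      no-apex : ∀ {p q a b c} → E p q → E a b → E a c → ¬ Link p q a b → ¬ Link p q a c → ¬ Link p q b c
      no-apex {p} {q} {a} e ab ac nb nc l with span p q e a
      ... | w , m = E-irr (proj₁ (proj₁ (apart e ab ac nb nc l (link-trans (link-sym e l) m))))

      -- An edge xz outside the class meets an edge xy of the class. A nonedge yz would force xz. If
      -- yz is an edge outside the class, then z is an apex over xy; if it is in the class, y is an
      -- apex over xz for the class of xz.
      one-class : ∀ {p q x z} → E p q → E x z → Link p q x z
      one-class {p} {q} {x} {z} e xz = byContra λ nxz → case span p q e x of λ (y , xy) → apex nxz y xy
        where
        apex : ¬ Link p q x z → ∀ y → Link p q x y → ⊥
        apex nxz y xy with em (Link p q y z)
        ... | no nyz = no-apex e (E-sym xz) (E-sym yz) (nxz ∘ flip) (nyz ∘ flip) xy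
          where
          yz : E y z
          yz = byContra λ n → nxz (turn xy xz n)
        ... | yes yz = no-apex xz (E-sym (link-edge e xy)) (link-edge e yz)
                (λ l → nxz (link-trans (flip xy) (link-sym xz l))) (λ l → nxz (link-trans yz (link-sym xz l))) start

      -- Forcing respects both orientations, so whether they agree or disagree is constant along the
      -- single class.
      module Orientation (a b : V → V → Set)
        (a-total : ∀ {x y} → E x y → a x y ⊎ a y x) (b-total : ∀ {x y} → E x y → b x y ⊎ b y x)
        (a-anti : ∀ {x y} → E x y → a x y → ¬ a y x)
        (a-turn : ∀ {x y y'} → E x y → E x y' → ¬ E y y' → (a x y → a x y') × (a y x → a y' x))
        (b-turn : ∀ {x y y'} → E x y → E x y' → ¬ E y y' → (b x y → b x y') × (b y x → b y' x)) where

        Same Opposite : V → V → Set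
        Same x y = (a x y × b x y) ⊎ (a y x × b y x)
        Opposite x y = (a x y × b y x) ⊎ (a y x × b x y)

        same : ∀ {p q x y} → E p q → Same p q → Link p q x y → Same x y
        same e s start = s
        same e s (flip l) = case same e s l of λ { (inj₁ h) → inj₂ h ; (inj₂ h) → inj₁ h }
        same e s (turn l e' n) = let a₁ , a₂ = a-turn (link-edge e l) e' n ; b₁ , b₂ = b-turn (link-edge e l) e' n in
          case same e s l of λ { (inj₁ (h , k)) → inj₁ (a₁ h , b₁ k) ; (inj₂ (h , k)) → inj₂ (a₂ h , b₂ k) }

        opposite : ∀ {p q x y} → E p q → Opposite p q → Link p q x y → Opposite x y
        opposite e s start = s
        opposite e s (flip l) = case opposite e s l of λ { (inj₁ h) → inj₂ h ; (inj₂ h) → inj₁ h }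
        opposite e s (turn l e' n) = let a₁ , a₂ = a-turn (link-edge e l) e' n ; b₁ , b₂ = b-turn (link-edge e l) e' n in
          case opposite e s l of λ { (inj₁ (h , k)) → inj₁ (a₁ h , b₂ k) ; (inj₂ (h , k)) → inj₂ (a₂ h , b₁ k) }

        all-same : ∀ {p q} → E p q → Same p q → ∀ {x y} → E x y → a x y → b x y
        all-same e s e' h with same e s (one-class e e')
        ... | inj₁ (_ , k) = k
        ... | inj₂ (h' , _) = ⊥-elim (a-anti e' h h')

        all-opposite : ∀ {p q} → E p q → Opposite p q → ∀ {x y} → E x y → a x y → b y x
        all-opposite e s e' h with opposite e s (one-class e e')
        ... | inj₁ (_ , k) = k
        ... | inj₂ (h' , _) = ⊥-elim (a-anti e' h h')

        orient : (∀ {x y} → E x y → a x y → b x y) ⊎ (∀ {x y} → E x y → a x y → b y x)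
        orient with em (Σ V λ p → Σ V λ q → E p q)
        ... | no none = inj₁ λ e _ → ⊥-elim (none (_ , _ , e))
        ... | yes (p , q , e) with a-total e | b-total e
        ...   | inj₁ h | inj₁ k = inj₁ (all-same e (inj₁ (h , k)))
        ...   | inj₂ h | inj₂ k = inj₁ (all-same e (inj₂ (h , k)))
        ...   | inj₁ h | inj₂ k = inj₂ (all-opposite e (inj₁ (h , k)))
        ...   | inj₂ h | inj₁ k = inj₂ (all-opposite e (inj₂ (h , k)))

  -- Incomparability graphs whose proper poset modules are chains

  module PosetGraph (P : Poset) (mods : ProperModulesAreChains P) (conn : IncConnected P) where

    private
      V = Poset.Carrier P
      I = Incomparable P
    open Poset P using () renaming (_≤_ to _⊑ᴾ_; refl to ⊑-refl; trans to ⊑ᴾ-trans; antisym to ⊑-antisym)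

    I-sym : ∀ {x y} → I x y → I y x
    I-sym (p , q) = q , p

    I-irr : ∀ {x} → ¬ I x x
    I-irr (p , _) = p (⊑-refl _)

    comparable : ∀ {x y} → ¬ I x y → x ⊑ᴾ y ⊎ y ⊑ᴾ x
    comparable {x} {y} n with em (x ⊑ᴾ y)
    ... | yes p = inj₁ p
    ... | no p = inj₂ (byContra λ q → n (p , q))

    module IncForcing = Forcing I I-sym I-irr
    open IncForcing

    -- The vertices of a forcing class of Inc(P) form a module.
    inc-span : ∀ p q → I p q → ∀ v → Met p q v
    inc-span p q e v = byContra λ nm → case mods (Met p q) module-class (λ all → nm (all v)) p q (q , start) (p , flip start) of λ
        { (inj₁ h) → proj₁ e h ; (inj₂ h) → proj₂ e h }
      where
      module-class : IsModule P (Met p q)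
      module-class u nu with em (I u p)
      ... | yes up = inj₂ (inj₂ λ a (w , l) → proj₁ (spread-all nu start up l))
      ... | no n with comparable n
      ...   | inj₁ up = inj₂ (inj₁ λ a (w , l) → proj₁ (above l))
        where
        apart-from : ∀ {x y} → Link p q x y → ¬ I u x
        apart-from l ux = n (proj₁ (spread-all nu l ux (link-sym e l)))
        other : ∀ {x y} → Link p q x y → u ⊑ᴾ x → u ⊑ᴾ y
        other l h with comparable (apart-from (flip l))
        ... | inj₁ k = k
        ... | inj₂ k = ⊥-elim (proj₂ (link-edge e l) (⊑ᴾ-trans k h))
        above : ∀ {x y} → Link p q x y → u ⊑ᴾ x × u ⊑ᴾ y
        above start = up , other start up
        above (flip l) = let s , t = above l in t , s
        above (turn l e' k) = let s , _ = above l in s , other (turn l e' k) s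
      ...   | inj₂ pu = inj₁ λ a (w , l) → proj₁ (below l)
        where
        apart-from : ∀ {x y} → Link p q x y → ¬ I u x
        apart-from l ux = n (proj₁ (spread-all nu l ux (link-sym e l)))
        other : ∀ {x y} → Link p q x y → x ⊑ᴾ u → y ⊑ᴾ u
        other l h with comparable (apart-from (flip l))
        ... | inj₂ k = k
        ... | inj₁ k = ⊥-elim (proj₁ (link-edge e l) (⊑ᴾ-trans h k))
        below : ∀ {x y} → Link p q x y → x ⊑ᴾ u × y ⊑ᴾ u
        below start = pu , other start pu
        below (flip l) = let s , t = below l in t , s
        below (turn l e' k) = let s , _ = below l in s , other (turn l e' k) s

    GraphModule : (V → Set) → Set
    GraphModule K = ∀ v → ¬ K v → (∀ a → K a → I v a) ⊎ (∀ a → K a → ¬ I v a)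

    data Reach (K : V → Set) (a : V) : V → Set where
      base : Reach K a a
      step : ∀ {c d} → Reach K a c → K d → I c d → Reach K a d

    -- A module of the graph need not be a module of P, but its connected components are: a vertex
    -- comparable to a whole component lies on one side of it. A component containing an edge is not
    -- a chain, so it cannot be proper.
    graph-modules-independent : ∀ K → GraphModule K → ∀ v₀ → ¬ K v₀ → ∀ {a b} → K a → K b → ¬ I a b
    graph-modules-independent K gm v₀ nv₀ {a} {b} ka kb e =
        case mods (Reach K a) is-module (λ all → nv₀ (reach-K (all v₀))) a b base (step base kb e) of λ
          { (inj₁ h) → proj₁ e h ; (inj₂ h) → proj₂ e h }
      where
      reach-K : ∀ {c} → Reach K a c → K c
      reach-K base = ka
      reach-K (step _ kd _) = kd
      one-side : ∀ v → (∀ c → Reach K a c → ¬ I v c) → (∀ c → Reach K a c → c ⊑ᴾ v) ⊎ (∀ c → Reach K a c → v ⊑ᴾ c)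
      one-side v n with comparable (n a base)
      ... | inj₁ va = inj₂ λ c → up
        where
        up : ∀ {c} → Reach K a c → v ⊑ᴾ c
        up base = va
        up (step {c} {d} r kd i) with comparable (n d (step r kd i))
        ... | inj₁ h = h
        ... | inj₂ h = ⊥-elim (proj₂ i (⊑ᴾ-trans h (up r)))
      ... | inj₂ av = inj₁ λ c → down
        where
        down : ∀ {c} → Reach K a c → c ⊑ᴾ v
        down base = av
        down (step {c} {d} r kd i) with comparable (n d (step r kd i))
        ... | inj₂ h = h
        ... | inj₁ h = ⊥-elim (proj₁ i (⊑ᴾ-trans (down r) h))
      is-module : IsModule P (Reach K a)
      is-module v nr with em (K v)
      ... | yes kv = case one-side v (λ c r i → nr (step r kv (I-sym i))) of λ { (inj₁ h) → inj₁ h ; (inj₂ h) → inj₂ (inj₁ h) }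
      ... | no nk with gm v nk
      ...   | inj₁ h = inj₂ (inj₂ λ c r → h c (reach-K r))
      ...   | inj₂ h = case one-side v (λ c r → h c (reach-K r)) of λ { (inj₁ h) → inj₁ h ; (inj₂ h) → inj₂ (inj₁ h) }

    Twin : V → V → Set
    Twin x y = ∀ z → (I x z → I y z) × (I y z → I x z)

    twin-refl : ∀ x → Twin x x
    twin-refl x z = id , id

    twin-sym : ∀ {x y} → Twin x y → Twin y x
    twin-sym t z = proj₂ (t z) , proj₁ (t z)

    twin-trans : ∀ {x y z} → Twin x y → Twin y z → Twin x z
    twin-trans s t w = proj₁ (t w) ∘ proj₁ (s w) , proj₂ (s w) ∘ proj₂ (t w)

    twin-¬I : ∀ {x y} → Twin x y → ¬ I x y
    twin-¬I {y = y} t e = I-irr (proj₁ (t y) e)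

    -- The comparable pairs whose order the graph constrains; the order inside a twin class is
    -- invisible to it.
    Cross : V → V → Set
    Cross x y = ¬ I x y × ¬ Twin x y

    cross-sym : ∀ {x y} → Cross x y → Cross y x
    cross-sym (n , t) = n ∘ I-sym , t ∘ twin-sym

    cross-irr : ∀ {x} → ¬ Cross x x
    cross-irr (_ , t) = t (twin-refl _)

    cross-twin : ∀ {x y y'} → Cross x y → Twin y y' → Cross x y'
    cross-twin {x} (n , t) s = (λ i → n (I-sym (proj₂ (s x) (I-sym i)))) , λ t' → t (twin-trans t' (twin-sym s))

    non-twin : ∀ {x y} → ¬ Twin x y → Σ V λ z → (I x z × ¬ I y z) ⊎ (I y z × ¬ I x z)
    non-twin {x} {y} n with ¬∀⇒∃¬ n
    ... | z , q with em (I x z) | em (I y z)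
    ...   | yes xz | yes yz = ⊥-elim (q ((λ _ → yz) , λ _ → xz))
    ...   | yes xz | no yz = z , inj₁ (xz , yz)
    ...   | no xz | yes yz = z , inj₂ (yz , xz)
    ...   | no xz | no yz = ⊥-elim (q ((λ h → ⊥-elim (xz h)) , λ h → ⊥-elim (yz h)))

    module CrossForcing = Forcing Cross cross-sym cross-irr

    -- The vertices met by a forcing class of `Cross` form a module of the graph. It has an edge: a
    -- vertex z telling p from q, say adjacent to p only, makes qp force qz, so both p and z are
    -- met. Hence it is not proper.
    cross-span : ∀ p q → Cross p q → ∀ v → CrossForcing.Met p q v
    cross-span p q e v = byContra λ nm → impossible nm (non-twin (proj₂ e))
      where
      open CrossForcing using () renaming (Link to Linkᶜ; Met to Metᶜ; start to startᶜ; flip to flipᶜ; turn to turnᶜ;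
        spread-all to spread-allᶜ; link-sym to link-symᶜ; link-edge to link-edgeᶜ)
      gm : GraphModule (Metᶜ p q)
      gm u nu with em (Cross u p)
      ... | yes c = inj₂ λ a (w , l) → proj₁ (proj₁ (spread-allᶜ nu startᶜ c l))
      ... | no nc = inj₁ λ a (w , l) → byContra λ ni → none l (ni , λ t → none (flipᶜ l)
              (cross-sym (cross-twin (cross-sym (link-edgeᶜ e l)) (twin-sym t))))
        where
        none : ∀ {x y} → Linkᶜ p q x y → ¬ Cross u x
        none l ux = nc (proj₁ (spread-allᶜ nu l ux (link-symᶜ e l)))
      impossible : ¬ Metᶜ p q v → ¬ (Σ V λ z → (I p z × ¬ I q z) ⊎ (I q z × ¬ I p z))
      impossible nm (z , inj₁ (pz , qz)) = graph-modules-independent (Metᶜ p q) gm v nm (q , startᶜ)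
        (q , flipᶜ (turnᶜ (flipᶜ startᶜ) (qz , λ t → proj₁ e (I-sym (proj₂ (t p) (I-sym pz)))) λ c → proj₁ c pz)) pz
      impossible nm (z , inj₂ (qz , pz)) = graph-modules-independent (Metᶜ p q) gm v nm (p , flipᶜ startᶜ)
        (p , flipᶜ (turnᶜ startᶜ (pz , λ t → proj₁ e (proj₂ (t q) (I-sym qz))) λ c → proj₁ c qz)) qz

    not-isolated : ∀ {x z} → ¬ x ≡ z → Σ V λ w → I x w
    not-isolated {x} {z} n with conn x z
    ... | ε = ⊥-elim (n refl)
    ... | _◅_ {j = w} (_ , i) _ = w , i

    module SameInc (_≤'_ : V → V → Set) (trans' : ∀ {x y z} → x ≤' y → y ≤' z → x ≤' z)
      (refl' : ∀ x → x ≤' x) (antisym' : ∀ {x y} → x ≤' y → y ≤' x → x ≡ y)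
      (I⇒ : ∀ {x y} → I x y → ¬ x ≤' y) (comparable' : ∀ {x y} → ¬ I x y → x ≤' y ⊎ y ≤' x) where

      -- Otherwise the interval [y, y'] is a module of the graph containing x and a vertex incomparable to x.
      convex : ∀ {x y y'} → Twin y y' → Cross x y → y ≤' x → y' ≤' x
      convex {x} {y} {y'} t c yx with comparable' (proj₁ (cross-twin c t))
      ... | inj₂ h = h
      ... | inj₁ xy' with non-twin (proj₂ c)
      ...   | z , inj₂ (yz , xz) = ⊥-elim (case comparable' xz of λ
                { (inj₁ h) → I⇒ yz (trans' yx h) ; (inj₂ h) → I⇒ (I-sym (proj₁ (t z) yz)) (trans' h xy') })
      ...   | z , inj₁ (xz , yz) = ⊥-elim (in-chain (em (Σ V λ v → ¬ W v)))
        where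
        W : V → Set
        W u = y ≤' u × u ≤' y'
        gm : GraphModule W
        gm v nw with em (I v y)
        ... | yes vy = inj₁ λ u (p , q) → byContra λ n → case comparable' n of λ
                { (inj₁ h) → I⇒ (I-sym (proj₁ (t v) (I-sym vy))) (trans' h q) ; (inj₂ h) → I⇒ (I-sym vy) (trans' p h) }
        ... | no n with comparable' n
        ...   | inj₁ vy = inj₂ λ u (p , _) i → I⇒ i (trans' vy p)
        ...   | inj₂ yv with comparable' {v} {y'} (λ i → n (I-sym (proj₂ (t v) (I-sym i))))
        ...     | inj₁ vy' = ⊥-elim (nw (yv , vy'))
        ...     | inj₂ y'v = inj₂ λ u (_ , q) i → I⇒ (I-sym i) (trans' q y'v)
        z∈W : W z
        z∈W = (case comparable' yz of λ { (inj₁ h) → h ; (inj₂ h) → ⊥-elim (I⇒ (I-sym xz) (trans' h yx)) }) ,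
              (case comparable' {y'} {z} (yz ∘ proj₂ (t z)) of λ { (inj₂ h) → h ; (inj₁ h) → ⊥-elim (I⇒ xz (trans' xy' h)) })
        in-chain : Dec (Σ V λ v → ¬ W v) → ⊥
        in-chain (yes (v , nv)) = graph-modules-independent W gm v nv (yx , xy') z∈W xz
        in-chain (no all) = let w , i = not-isolated {y} {z} (λ { refl → proj₁ c xz }) in
          I⇒ i (proj₁ (byContra λ n → all (w , n)))

      convex-up : ∀ {x y y'} → Twin y y' → Cross x y → x ≤' y → x ≤' y'
      convex-up t c xy with comparable' (proj₁ (cross-twin c t))
      ... | inj₁ h = h
      ... | inj₂ h = ⊥-elim (cross-irr (subst (Cross _) (antisym' (convex (twin-sym t) (cross-twin c t) h) xy) c))

      -- Two vertices outside `Cross` are incomparable, where transitivity settles the claim, or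
      -- twins, where convexity of twin classes does.
      turn-order : ∀ {x y y'} → Cross x y → Cross x y' → ¬ Cross y y' → (x ≤' y → x ≤' y') × (y ≤' x → y' ≤' x)
      turn-order {x} {y} {y'} c c' n with em (I y y')
      ... | yes i = (λ h → case comparable' (proj₁ c') of λ { (inj₁ k) → k ; (inj₂ k) → ⊥-elim (I⇒ (I-sym i) (trans' k h)) }) ,
                    (λ h → case comparable' (proj₁ c') of λ { (inj₂ k) → k ; (inj₁ k) → ⊥-elim (I⇒ i (trans' h k)) })
      ... | no ni = let t = byContra λ nt → n (ni , nt) in convex-up t c , convex t c

  plain : Chain → LCh ⊤
  plain A = A , λ _ → tt

  -- Induction on the size of A: match the last element of A with the last element of the image of i.
  finite-embedding : ∀ n (A B : Chain) → (∀ x → Countable.enc (Chain.ctb A) x < n) → (i : Chain.Car A → Chain.Car B) → Injective i →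
    Σ (Chain.Car A → Chain.Car B) λ θ → ∀ {x y} → Chain._≺_ A x y → Chain._≺_ B (θ x) (θ y)
  finite-embedding n A B bound i i-inj with em (Chain.Car A)
  finite-embedding n A B bound i i-inj | no none = (λ x → ⊥-elim (none x)) , λ {x} _ → ⊥-elim (none x)
  finite-embedding zero A B bound i i-inj | yes a₁ = case bound a₁ of λ ()
  finite-embedding (suc n) A B bound i i-inj | yes a₁ =
      build (greatest ctb _≺_ tra tri (λ _ → ⊤) (suc n)) (greatest ctb (λ x y → i x ≺ᴮ i y) (Chain.tra B) tri-i (λ _ → ⊤) (suc n))
    where
    open Chain A
    open Countable ctb
    _≺ᴮ_ = Chain._≺_ B
    Greatest : (Car → Car → Set) → Set
    Greatest R = (∀ a → enc a < suc n → ¬ ⊤) ⊎ Σ Car λ m → enc m < suc n × ⊤ × (∀ a → enc a < suc n → ⊤ → a ≡ m ⊎ R a m)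
    tri-i : ∀ x y → i x ≺ᴮ i y ⊎ (x ≡ y ⊎ i y ≺ᴮ i x)
    tri-i x y with Chain.tri B (i x) (i y)
    ... | inj₁ p = inj₁ p
    ... | inj₂ (inj₁ e) = inj₂ (inj₁ (i-inj e))
    ... | inj₂ (inj₂ p) = inj₂ (inj₂ p)
    Result = Σ (Car → Chain.Car B) λ θ → ∀ {x y} → x ≺ y → θ x ≺ᴮ θ y
    build : Greatest _≺_ → Greatest (λ x y → i x ≺ᴮ i y) → Result
    build (inj₁ no-max) _ = ⊥-elim (no-max a₁ (bound a₁) tt)
    build (inj₂ _) (inj₁ no-max) = ⊥-elim (no-max a₁ (bound a₁) tt)
    build (inj₂ (a , _ , _ , a-max)) (inj₂ (m , _ , _ , m-max)) = (λ x → θ x (em (x ≺ a))) , λ {x} {y} → θ-mono x y (em (x ≺ a)) (em (y ≺ a))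
      where
      -- Below a the code of a is free; giving it to the element of code n brings all codes below n.
      code : ∀ x → Dec (enc x ≡ n) → ℕ
      code x (yes _) = enc a
      code x (no _) = enc x
      code-bound : ∀ x → x ≺ a → (d : Dec (enc x ≡ n)) → code x d < n
      code-bound x l (yes e) = ≤∧≢⇒< (≤-pred (bound a)) λ e' → irr a (subst (_≺ a) (enc-inj (trans e (sym e'))) l)
      code-bound x l (no ne) = ≤∧≢⇒< (≤-pred (bound x)) ne
      code-inj : ∀ x y → x ≺ a → y ≺ a → (d : Dec (enc x ≡ n)) (d' : Dec (enc y ≡ n)) → code x d ≡ code y d' → x ≡ y
      code-inj x y l l' (yes e) (yes e') _ = enc-inj (trans e (sym e'))
      code-inj x y l l' (yes _) (no _) q = ⊥-elim (irr a (subst (_≺ a) (sym (enc-inj q)) l'))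
      code-inj x y l l' (no _) (yes _) q = ⊥-elim (irr a (subst (_≺ a) (enc-inj q) l))
      code-inj x y l l' (no _) (no _) q = enc-inj q
      A' B' : Chain
      A' = record { Car = S.Car ; ctb = recoded ; _≺_ = S._≺_ ; irr = S.irr ; tra = λ {x} {y} {z} → S.tra {x} {y} {z} ; tri = S.tri }
        where
        module S = Chain (proj₁ (Sub (plain A) (_≺ a)))
        recoded : Countable (Σ Car λ x → T (does (em (x ≺ a))))
        recoded = record { enc = λ (x , _) → code x (enc x ≟ n)
          ; enc-inj = λ {(x , p)} {(y , q)} e → pairs-eq (code-inj x y (sound p) (sound q) (enc x ≟ n) (enc y ≟ n) e) }
      B' = proj₁ (Sub (plain B) (_≺ᴮ i m))
      -- The value i m is reserved for a. If m itself lies below a, it takes over the value i a.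
      moved : ∀ x → Dec (x ≡ m) → Chain.Car B
      moved x (yes _) = i a
      moved x (no _) = i x
      moved-below : ∀ x → x ≺ a → (d : Dec (x ≡ m)) → moved x d ≺ᴮ i m
      moved-below x l (yes refl) with m-max a (bound a) tt
      ... | inj₁ refl = ⊥-elim (irr _ l)
      ... | inj₂ p = p
      moved-below x l (no ne) with m-max x (bound x) tt
      ... | inj₁ e = ⊥-elim (ne e)
      ... | inj₂ p = p
      moved-inj : ∀ x y → x ≺ a → y ≺ a → (d : Dec (x ≡ m)) (d' : Dec (y ≡ m)) → moved x d ≡ moved y d' → x ≡ y
      moved-inj x y l l' (yes e) (yes e') _ = trans e (sym e')
      moved-inj x y l l' (yes _) (no _) q = ⊥-elim (irr a (subst (_≺ a) (sym (i-inj q)) l'))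
      moved-inj x y l l' (no _) (yes _) q = ⊥-elim (irr a (subst (_≺ a) (i-inj q) l))
      moved-inj x y l l' (no _) (no _) q = i-inj q
      rec = finite-embedding n A' B' (λ (x , p) → code-bound x (sound p) (enc x ≟ n))
        (λ (x , p) → moved x (em (x ≡ m)) , holds (moved-below x (sound p) (em (x ≡ m))))
        (λ {(x , p)} {(y , q)} e → pairs-eq (moved-inj x y (sound p) (sound q) (em (x ≡ m)) (em (y ≡ m)) (cong proj₁ e)))
      θ : ∀ x → Dec (x ≺ a) → Chain.Car B
      θ x (yes p) = proj₁ (proj₁ rec (x , holds p))
      θ x (no _) = i m
      θ-mono : ∀ x y (d : Dec (x ≺ a)) (d' : Dec (y ≺ a)) → x ≺ y → θ x d ≺ᴮ θ y d'
      θ-mono x y (yes _) (yes _) l = proj₂ rec l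
      θ-mono x y (yes p) (no _) l = sound (proj₂ (proj₁ rec (x , holds p)))
      θ-mono x y (no n) (yes q) l = ⊥-elim (n (tra l q))
      θ-mono x y (no n) (no n') l with a-max y (bound y) tt
      ... | inj₁ refl = ⊥-elim (n l)
      ... | inj₂ q = ⊥-elim (n' q)

  -- P is determined by Inc(P) up to duality and permutation of the twin classes, which are finite chains.
  module FromInc (P : Poset) (mods : ProperModulesAreChains P) (conn : IncConnected P) (fin : Finite (Poset.Carrier P)) where

    open PosetGraph P mods conn
    open Poset P using () renaming (_≤_ to _⊑ᴾ_; refl to ⊑-refl; trans to ⊑ᴾ-trans; antisym to ⊑-antisym)
    private
      V = Poset.Carrier P
      I = Incomparable P

    size : ℕ
    size = proj₁ fin

    code : Countable V
    code = record { enc = λ x → toℕ (proj₁ (proj₂ fin) x) ; enc-inj = λ e → proj₂ (proj₂ fin) (toℕ-injective e) }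

    open Representatives code Twin twin-refl twin-sym twin-trans

    twin-class : (_≤'_ : V → V → Set) → (∀ {x y z} → x ≤' y → y ≤' z → x ≤' z) → (∀ {x y} → x ≤' y → y ≤' x → x ≡ y) →
      (∀ {x y} → ¬ I x y → x ≤' y ⊎ y ≤' x) → V → Chain
    twin-class _≤'_ tr as cmp r = record
      { Car = Σ V λ x → T (does (em (Twin r x)))
      ; ctb = record { enc = λ (x , _) → Countable.enc code x ; enc-inj = λ e → pairs-eq (Countable.enc-inj code e) }
      ; _≺_ = λ (x , _) (y , _) → x ≤' y × ¬ x ≡ y
      ; irr = λ _ (_ , n) → n refl
      ; tra = λ (p , n) (q , k) → tr p q , λ { refl → n (as p q) }
      ; tri = tri' }
      where
      tri' : ∀ ((x , _) (y , _) : Σ V λ x → T (does (em (Twin r x)))) → _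
      tri' (x , p) (y , q) with em (x ≡ y)
      ... | yes e = inj₂ (inj₁ (pairs-eq e))
      ... | no n with cmp (twin-¬I (twin-trans (twin-sym (sound p)) (sound q)))
      ...   | inj₁ l = inj₁ (l , n)
      ...   | inj₂ l = inj₂ (inj₂ (l , n ∘ sym))

    module P-order = SameInc _⊑ᴾ_ ⊑ᴾ-trans ⊑-refl ⊑-antisym proj₁ comparable

    module _ (_≤'_ : V → V → Set) (trans' : ∀ {x y z} → x ≤' y → y ≤' z → x ≤' z)
      (refl' : ∀ x → x ≤' x) (antisym' : ∀ {x y} → x ≤' y → y ≤' x → x ≡ y)
      (I⇒ : ∀ {x y} → I x y → ¬ x ≤' y) (comparable' : ∀ {x y} → ¬ I x y → x ≤' y ⊎ y ≤' x) where

      EmbedsIn : Set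
      EmbedsIn = Σ (V → V) λ θ → ∀ x y → (x ⊑ᴾ y → θ x ≤' θ y) × (θ x ≤' θ y → x ⊑ᴾ y)

      -- The map θ rearranges each twin class into the order ≤'. Pairs inside a class are then
      -- sorted, and for a crossing pair convexity carries the order of x, y over to θ x, θ y, where
      -- `agree` applies.
      embeds : (∀ {x y} → Cross x y → x ⊑ᴾ y → x ≤' y) → EmbedsIn
      embeds agree = θ , λ x y → forward x y , backward x y
        where
        sorted : ∀ r → _
        sorted r = finite-embedding size (twin-class _⊑ᴾ_ ⊑ᴾ-trans ⊑-antisym comparable r) (twin-class _≤'_ trans' antisym' comparable' r)
          (λ (x , _) → toℕ<n (proj₁ (proj₂ fin) x)) id id
        place : ∀ r x → Twin r x → V
        place r x t = proj₁ (proj₁ (sorted r) (x , holds t))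
        place-twin : ∀ r x t → Twin r (place r x t)
        place-twin r x t = sound (proj₂ (proj₁ (sorted r) (x , holds t)))
        place-mono : ∀ r r' x y t t' → r ≡ r' → x ⊑ᴾ y → ¬ x ≡ y → place r x t ≤' place r' y t' × ¬ place r x t ≡ place r' y t'
        place-mono r r x y t t' refl l n = proj₂ (sorted r) (l , n)
        θ : V → V
        θ x = place (rep x) x (twin-sym (∼rep x))
        θ-twin : ∀ x → Twin x (θ x)
        θ-twin x = twin-trans (∼rep x) (place-twin (rep x) x _)
        θ-mono : ∀ {x y} → Twin x y → x ⊑ᴾ y → ¬ x ≡ y → θ x ≤' θ y × ¬ θ x ≡ θ y
        θ-mono {x} {y} t l n = place-mono (rep x) (rep y) x y _ _ (rep-eq t) l n
        forward : ∀ x y → x ⊑ᴾ y → θ x ≤' θ y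
        forward x y l with em (Twin x y) | em (x ≡ y)
        ... | _ | yes refl = refl' _
        ... | yes t | no n = proj₁ (θ-mono t l n)
        ... | no nt | no n = agree (cross-sym (cross-twin (cross-sym c') (θ-twin x)))
                (P-order.convex-up (θ-twin y) (cross-sym (cross-twin (cross-sym c) (θ-twin x)))
                  (P-order.convex (θ-twin x) (cross-sym c) l))
          where
          c : Cross x y
          c = (λ i → proj₁ i l) , nt
          c' : Cross x (θ y)
          c' = cross-twin c (θ-twin y)
        backward : ∀ x y → θ x ≤' θ y → x ⊑ᴾ y
        backward x y l with em (I x y)
        ... | yes i = ⊥-elim (I⇒ (I-sym (proj₁ (θ-twin y (θ x)) (I-sym (proj₁ (θ-twin x y) i)))) l)
        ... | no ni with comparable ni
        ...   | inj₁ h = h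
        ...   | inj₂ h with em (x ≡ y)
        ...     | yes refl = ⊑-refl x
        ...     | no n = ⊥-elim (proj₂ (θ-mono t h (n ∘ sym)) e)
          where
          e : θ y ≡ θ x
          e = antisym' (forward y x h) l
          t : Twin y x
          t = twin-trans (θ-twin y) (subst (λ z → Twin z x) (sym e) (twin-sym (θ-twin x)))

    same-inc : (_≤'_ : V → V → Set) (trans' : ∀ {x y z} → x ≤' y → y ≤' z → x ≤' z)
      (refl' : ∀ x → x ≤' x) (antisym' : ∀ {x y} → x ≤' y → y ≤' x → x ≡ y)
      (I⇒ : ∀ {x y} → I x y → ¬ x ≤' y) (comparable' : ∀ {x y} → ¬ I x y → x ≤' y ⊎ y ≤' x) →
      (Σ (V → V) λ θ → ∀ x y → (x ⊑ᴾ y → θ x ≤' θ y) × (θ x ≤' θ y → x ⊑ᴾ y)) ⊎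
      (Σ (V → V) λ θ → ∀ x y → (x ⊑ᴾ y → θ y ≤' θ x) × (θ y ≤' θ x → x ⊑ᴾ y))
    same-inc _≤'_ trans' refl' antisym' I⇒ comparable' with orient
      where
      open SameInc _≤'_ trans' refl' antisym' I⇒ comparable'
      open CrossForcing.Orientation cross-span _⊑ᴾ_ _≤'_ (λ c → comparable (proj₁ c)) (λ c → comparable' (proj₁ c))
        (λ c p q → cross-irr (subst (Cross _) (⊑-antisym q p) c)) P-order.turn-order turn-order
    ... | inj₁ agree = inj₁ (embeds _≤'_ trans' refl' antisym' I⇒ comparable' agree)
    ... | inj₂ agree = inj₂ (embeds (λ x y → y ≤' x) (λ p q → trans' q p) refl' (λ p q → antisym' q p) (λ i → I⇒ (I-sym i))
            (λ n → case comparable' n of λ { (inj₁ h) → inj₂ h ; (inj₂ h) → inj₁ h }) agree)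

  -- Uniqueness of realizers

  module Realizers (P : Poset) (mods : ProperModulesAreChains P) (conn : IncConnected P) where

    open PosetGraph P mods conn
    open Poset P using () renaming (_≤_ to _⊑ᴾ_; refl to ⊑-refl; trans to ⊑ᴾ-trans; antisym to ⊑-antisym)
    private
      V = Poset.Carrier P
      I = Incomparable P

    record Realizer : Set₁ where
      field
        _≤₁_ _≤₂_ : V → V → Set
        lin₁ : IsLinear _≤₁_
        lin₂ : IsLinear _≤₂_
        realizes : ∀ x y → (x ⊑ᴾ y → x ≤₁ y × x ≤₂ y) × (x ≤₁ y × x ≤₂ y → x ⊑ᴾ y)

    exchange : Realizer → Realizer
    exchange R = record { _≤₁_ = _≤₂_ ; _≤₂_ = _≤₁_ ; lin₁ = lin₂ ; lin₂ = lin₁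
      ; realizes = λ x y → swap ∘ proj₁ (realizes x y) , proj₂ (realizes x y) ∘ swap }
      where open Realizer R

    module _ (R : Realizer) where
      open Realizer R

      reversed : ∀ {x y} → I x y → x ≤₁ y → y ≤₂ x
      reversed {x} {y} i h with IsLinear.total lin₂ x y
      ... | inj₁ k = ⊥-elim (proj₁ i (proj₂ (realizes x y) (h , k)))
      ... | inj₂ k = k

      anti : ∀ {x y} → I x y → x ≤₁ y → ¬ y ≤₁ x
      anti i p q = I-irr (subst (I _) (IsLinear.antisym lin₁ q p) i)

    module _ (R : Realizer) where
      open Realizer R

      -- Suppose y' ≤₁ x ≤₁ y. If y is below y' in P, the first order has a cycle. If y' is below y,
      -- then x ≤₂ y' ≤₂ y, which puts x below y. Either contradicts incomparability.
      turn-fwd : ∀ {x y y'} → I x y → I x y' → ¬ I y y' → x ≤₁ y → x ≤₁ y'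
      turn-fwd {x} {y} {y'} i i' n h with IsLinear.total lin₁ x y'
      ... | inj₁ k = k
      ... | inj₂ k with comparable n
      ...   | inj₁ l = ⊥-elim (anti R (I-sym i') (IsLinear.trans lin₁ k (IsLinear.refl lin₁ x)) (IsLinear.trans lin₁ h (proj₁ (proj₁ (realizes y y') l))))
      ...   | inj₂ l = ⊥-elim (proj₁ i (proj₂ (realizes x y) (h , IsLinear.trans lin₂ (reversed R (I-sym i') k) (proj₂ (proj₁ (realizes y' y) l)))))

      turn-lin : ∀ {x y y'} → I x y → I x y' → ¬ I y y' → (x ≤₁ y → x ≤₁ y') × (y ≤₁ x → y' ≤₁ x)
      turn-lin {x} {y} {y'} i i' n = turn-fwd i i' n , λ h → case IsLinear.total lin₁ x y' of λ
        { (inj₂ k) → k ; (inj₁ k) → ⊥-elim (anti R i (turn-fwd i' i (n ∘ I-sym) k) h) }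

    Equiv : (V → V → Set) → (V → V → Set) → Set
    Equiv a b = ∀ x y → (a x y → b x y) × (b x y → a x y)

    linear-equiv : ∀ {a b} → IsLinear a → IsLinear b → (∀ {x y} → x ⊑ᴾ y → a x y) → (∀ {x y} → x ⊑ᴾ y → b x y) →
      (∀ {x y} → I x y → a x y → b x y) → Equiv a b
    linear-equiv {a} {b} la lb pa pb h x y = sub , λ k → case IsLinear.total la x y of λ
        { (inj₁ l) → l ; (inj₂ l) → subst (λ z → a z y) (IsLinear.antisym lb (sub l) k) (IsLinear.refl la y) }
      where
      sub : ∀ {x y} → a x y → b x y
      sub {x} {y} l with em (I x y)
      ... | yes i = h i l
      ... | no n with comparable n
      ...   | inj₁ k = pb k
      ...   | inj₂ k = subst (b x) (IsLinear.antisym la l (pa k)) (IsLinear.refl lb x)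

    open Realizer using () renaming (_≤₁_ to ord₁; _≤₂_ to ord₂)

    -- The first orders of both realizers orient Inc(P), which has a single forcing class, so they
    -- agree or are opposite on it. The second order reverses the first on incomparable pairs and so
    -- follows.
    unique : (R S : Realizer) → (Equiv (ord₁ R) (ord₁ S) × Equiv (ord₂ R) (ord₂ S)) ⊎ (Equiv (ord₁ R) (ord₂ S) × Equiv (ord₂ R) (ord₁ S))
    unique R S with orient
      where
      open IncForcing.Orientation inc-span (Realizer._≤₁_ R) (Realizer._≤₁_ S) (λ _ → IsLinear.total (Realizer.lin₁ R) _ _)
        (λ _ → IsLinear.total (Realizer.lin₁ S) _ _) (anti R) (turn-lin R) (turn-lin S)
    ... | inj₁ h = inj₁ (linear-equiv R.lin₁ S.lin₁ (proj₁ ∘ proj₁ (R.realizes _ _)) (proj₁ ∘ proj₁ (S.realizes _ _)) h ,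
                         linear-equiv R.lin₂ S.lin₂ (proj₂ ∘ proj₁ (R.realizes _ _)) (proj₂ ∘ proj₁ (S.realizes _ _))
                           (λ i l → reversed S (I-sym i) (h (I-sym i) (reversed (exchange R) i l))))
      where
      module R = Realizer R
      module S = Realizer S
    ... | inj₂ h = inj₂ (linear-equiv R.lin₁ S.lin₂ (proj₁ ∘ proj₁ (R.realizes _ _)) (proj₂ ∘ proj₁ (S.realizes _ _))
                           (λ i l → reversed S (I-sym i) (h i l)) ,
                         linear-equiv R.lin₂ S.lin₁ (proj₂ ∘ proj₁ (R.realizes _ _)) (proj₁ ∘ proj₁ (S.realizes _ _))
                           (λ i l → h (I-sym i) (reversed (exchange R) i l)))
      where
      module R = Realizer R
      module S = Realizer S

  -- Lexicographical sums

  wqo-transfer : ∀ {a b} {A : Set a} {B : Set b} {r : A → A → Set ℓ} {s : B → B → Set ℓ'} (g : A → B) →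
    (∀ x y → s (g x) (g y) → r x y) → IsWqo s → IsWqo r
  wqo-transfer g refl' w f = let φ , m , h = w (g ∘ f) in φ , m , λ p → refl' _ _ (h p)

  bqo-transfer : ∀ {a b} {A : Set a} {B : Set b} {r : A → A → Set ℓ} {s : B → B → Set ℓ'} (g : A → B) →
    (∀ x y → s (g x) (g y) → r x y) → IsBqo s → IsBqo r
  bqo-transfer {r = r} {s} g refl' = wqo-transfer {r = SeqLe r} {s = SeqLe s} (λ (α , f) → α , g ∘ f)
    λ _ _ (h , inj , m , l) → h , inj , m , λ γ → refl' _ _ (l γ)

  -- Sequences over a class that maps to labelled chains are labelled chains of labelled chains.
  coded-bqo : ∀ {a} {A : Set a} {Q : Set ℓ} {r : Q → Q → Set ℓ'} {s : A → A → Set ℓ'} → (∀ x → r x x) →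
    (∀ {x y z} → r x y → r y z → r x z) → Bqo r → (g : A → LCh Q) → (∀ x y → Emb r (g x) (g y) → s x y) → IsBqo s
  coded-bqo {A = A} {Q} {r} {s} rr rt b g reflect = good⇒wqo {r = SeqLe s} λ x →
      let i , j , i<j , e = good (λ n → chain (x n)) in i , j , i<j , seq-le (x i) (x j) e
    where
    chain : Seq A → LCh (LCh Q)
    chain (α , f) = record { Car = Carrier ; ctb = countable ; _≺_ = CtblOrd._<_ α ; irr = irrefl ; tra = CtblOrd.trans α ; tri = trichot } , g ∘ f
      where open CtblOrd α using (Carrier; countable; irrefl; trichot)
    good : GoodPairs (Emb (Emb r))
    good = bqo⇒good {r = Emb (Emb r)} (chains-bqo (λ L → emb-id rr) (emb-∘ rt) (chains-bqo rr rt b))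
    seq-le : ∀ x y → Emb (Emb r) (chain x) (chain y) → SeqLe s x y
    seq-le (α , f) (β , f') e = fun e , inj , (λ _ _ → mono e) , λ γ → reflect _ _ (lab e γ)
      where
      inj : Injective (fun e)
      inj {x} {y} q with CtblOrd.trichot α x y
      ... | inj₁ p = ⊥-elim (CtblOrd.irrefl β _ (subst (CtblOrd._<_ β (fun e x)) (sym q) (mono e p)))
      ... | inj₂ (inj₁ p) = p
      ... | inj₂ (inj₂ p) = ⊥-elim (CtblOrd.irrefl β _ (subst (CtblOrd._<_ β (fun e y)) q (mono e p)))

  indexChain : (I : Poset) → IsChain I → Chain
  indexChain I ch = record
    { Car = Carrier ; ctb = countable ; _≺_ = λ i j → i ⊑ j × ¬ i ≡ j ; irr = λ _ (_ , n) → n refl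
    ; tra = λ (p , n) (q , _) → ⊑-trans p q , λ { refl → n (antisym p q) } ; tri = tri }
    where
    open Poset I using (Carrier; countable; antisym) renaming (_≤_ to _⊑_; trans to ⊑-trans)
    tri : ∀ i j → (i ⊑ j × ¬ i ≡ j) ⊎ (i ≡ j ⊎ (j ⊑ i × ¬ j ≡ i))
    tri i j with em (i ≡ j) | ch i j
    ... | yes e | _ = inj₂ (inj₁ e)
    ... | no n | inj₁ p = inj₁ (p , n)
    ... | no n | inj₂ p = inj₂ (inj₂ (p , n ∘ sym))

  module Blocks {𝒟 : Poset → Set} {P : Poset} (S : Hat 𝒟 P) where

    open Poset P using (Carrier) renaming (_≤_ to _⊑_)

    I : Poset
    I = let I , _ = S in I

    I-chain : Chain
    I-chain = let I , ch , _ = S in indexChain I ch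

    block : Poset.Carrier I → Poset
    block = let _ , _ , _ , Q , _ = S in Q

    block∈𝒟 : ∀ i → 𝒟 (block i)
    block∈𝒟 = let _ , _ , _ , _ , d , _ = S in d

    Point : Set
    Point = LexCarrier I block

    φ : Carrier → Point
    φ = let _ , _ , _ , _ , _ , φ , _ = S in φ

    φ-inj : Injective φ
    φ-inj = let _ , _ , _ , _ , _ , _ , inj , _ = S in inj

    preimage : ∀ p → Σ Carrier λ x → φ x ≡ p
    preimage = let _ , _ , _ , _ , _ , _ , _ , surj , _ = S in surj

    φ-≤ : ∀ x y → (x ⊑ y → LexLe I block (φ x) (φ y)) × (LexLe I block (φ x) (φ y) → x ⊑ y)
    φ-≤ = let _ , _ , _ , _ , _ , _ , _ , _ , iff = S in iff

    ψ : Point → Carrier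
    ψ p = proj₁ (preimage p)

    φψ : ∀ p → φ (ψ p) ≡ p
    φψ p = proj₂ (preimage p)

    ψφ : ∀ x → ψ (φ x) ≡ x
    ψφ x = φ-inj (φψ (φ x))

    ψ-inj : ∀ {p q} → ψ p ≡ ψ q → p ≡ q
    ψ-inj {p} {q} e = trans (sym (φψ p)) (trans (cong φ e) (φψ q))

    ψ-≤ : ∀ p q → (ψ p ⊑ ψ q → LexLe I block p q) × (LexLe I block p q → ψ p ⊑ ψ q)
    ψ-≤ p q = (λ h → subst₂ (LexLe I block) (φψ p) (φψ q) (proj₁ (φ-≤ _ _) h)) ,
              (λ h → proj₂ (φ-≤ _ _) (subst₂ (LexLe I block) (sym (φψ p)) (sym (φψ q)) h))

    ψ-across : ∀ {i j a b} → Chain._≺_ I-chain i j → ψ (i , a) ⊑ ψ (j , b)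
    ψ-across (p , n) = proj₂ (ψ-≤ _ _) (across p n)

    ψ-within : ∀ {i a b} → (Poset._≤_ (block i) a b → ψ (i , a) ⊑ ψ (i , b)) × (ψ (i , a) ⊑ ψ (i , b) → Poset._≤_ (block i) a b)
    ψ-within = (λ h → proj₂ (ψ-≤ _ _) (inside h)) , λ h → strip (proj₁ (ψ-≤ _ _) h)
      where
      strip : ∀ {i a b} → LexLe I block (i , a) (i , b) → Poset._≤_ (block i) a b
      strip (inside h) = h
      strip (across _ n) = ⊥-elim (n refl)

    Inhabited : Poset.Carrier I → Set
    Inhabited i = Poset.Carrier (block i)

    -- Members of 𝒟 may be empty; indices of empty blocks are dropped.
    coded : {Q : Set ℓ} → (Poset.Carrier I → Q) → LCh Q
    coded label = Sub (I-chain , label) Inhabited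

  module BlockwiseEmbedding {𝒟 : Poset → Set} {P P' : Poset} (S : Hat 𝒟 P) (S' : Hat 𝒟 P') where

    private
      module B = Blocks {𝒟} {P} S
      module B' = Blocks {𝒟} {P'} S'
      V = Poset.Carrier P
      V' = Poset.Carrier P'
      Index = Σ (Poset.Carrier B.I) λ i → T (does (em (B.Inhabited i)))
      _≺_ = Chain._≺_ B.I-chain
      _≺'_ = Chain._≺_ B'.I-chain

    module Along (h : Index → Poset.Carrier B'.I) (h-mono : ∀ s t → proj₁ s ≺ proj₁ t → h s ≺' h t)
      (e : ∀ s → Poset.Carrier (B.block (proj₁ s)) → Poset.Carrier (B'.block (h s)))
      (e-inj : ∀ s → Injective (e s)) where

      image : ∀ s → Poset.Carrier (B.block (proj₁ s)) → V'
      image s a = B'.ψ (h s , e s a)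

      embedding : V → V'
      embedding x = image (proj₁ (B.φ x) , holds (proj₂ (B.φ x))) (proj₂ (B.φ x))

      same-block : ∀ (R : V → V → Set) (R' : V' → V' → Set) →
        (∀ s a b → R (B.ψ (proj₁ s , a)) (B.ψ (proj₁ s , b)) → R' (image s a) (image s b)) →
        ∀ {i a b} p q → R (B.ψ (i , a)) (B.ψ (i , b)) → R' (image (i , p) a) (image (i , q) b)
      same-block R R' hyp {i} {a} {b} p q rel with T-prop p q
      ... | refl = hyp (i , p) a b rel

      -- Stated for any antisymmetric R containing the order of P, so that it serves this order as
      -- well as both orders of a bichain: points in different blocks are already comparable in P,
      -- and R cannot reverse them.
      preserves : (R : V → V → Set) (R' : V' → V' → Set) → (∀ {x y} → Poset._≤_ P x y → R x y) → (∀ {x y} → R x y → R y x → x ≡ y) →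
        (∀ {x y} → Poset._≤_ P' x y → R' x y) →
        (∀ s a b → R (B.ψ (proj₁ s , a)) (B.ψ (proj₁ s , b)) → R' (image s a) (image s b)) →
        ∀ x y → R x y → R' (embedding x) (embedding y)
      preserves R R' ≤⇒R R-anti ≤⇒R' hyp x y rel = go (B.φ x) (B.φ y) (subst₂ R (sym (B.ψφ x)) (sym (B.ψφ y)) rel)
        where
        go : ∀ p q → R (B.ψ p) (B.ψ q) → R' (image (proj₁ p , holds (proj₂ p)) (proj₂ p)) (image (proj₁ q , holds (proj₂ q)) (proj₂ q))
        go (i , a) (j , b) rel with Chain.tri B.I-chain i j
        ... | inj₁ l = ≤⇒R' (B'.ψ-across (h-mono _ _ l))
        ... | inj₂ (inj₁ refl) = same-block R R' hyp (holds a) (holds b) rel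
        ... | inj₂ (inj₂ l) = ⊥-elim (proj₂ l (cong proj₁ (B.ψ-inj (R-anti (≤⇒R (B.ψ-across l)) rel))))

      reflects : Injective embedding → (∀ s a b → Poset._≤_ P' (image s a) (image s b) → Poset._≤_ P (B.ψ (proj₁ s , a)) (B.ψ (proj₁ s , b))) →
        (∀ x y → Poset._≤_ P x y → Poset._≤_ P' (embedding x) (embedding y)) →
        ∀ x y → Poset._≤_ P' (embedding x) (embedding y) → Poset._≤_ P x y
      reflects inj hyp pres x y le = subst₂ (Poset._≤_ P) (B.ψφ x) (B.ψφ y) (go (B.φ x) (B.φ y) refl refl)
        where
        go : ∀ p q → B.φ x ≡ p → B.φ y ≡ q → Poset._≤_ P (B.ψ p) (B.ψ q)
        go (i , a) (j , b) ep eq with Chain.tri B.I-chain i j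
        ... | inj₁ l = B.ψ-across l
        ... | inj₂ (inj₂ l) = subst (λ z → Poset._≤_ P z (B.ψ (j , b))) (trans y≡x (trans (sym (B.ψφ x)) (cong B.ψ ep))) y≤y
          where
          y≡ : B.ψ (j , b) ≡ y
          y≡ = trans (cong B.ψ (sym eq)) (B.ψφ y)
          y≤y : Poset._≤_ P (B.ψ (j , b)) (B.ψ (j , b))
          y≤y = Poset.refl P _
          y≤x : Poset._≤_ P y x
          y≤x = subst₂ (Poset._≤_ P) y≡ (trans (cong B.ψ (sym ep)) (B.ψφ x)) (B.ψ-across l)
          y≡x : B.ψ (j , b) ≡ x
          y≡x = trans y≡ (inj (Poset.antisym P' (pres y x y≤x) le))
        ... | inj₂ (inj₁ refl) = within-block (holds a) (holds b)
                (subst₂ (λ p q → Poset._≤_ P' (image (proj₁ p , holds (proj₂ p)) (proj₂ p)) (image (proj₁ q , holds (proj₂ q)) (proj₂ q))) ep eq le)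
          where
          within-block : ∀ s t → Poset._≤_ P' (image (i , s) a) (image (i , t) b) → Poset._≤_ P (B.ψ (i , a)) (B.ψ (i , b))
          within-block s t le with T-prop s t
          ... | refl = hyp (i , s) a b le

      embedding-inj : Injective embedding
      embedding-inj {x} {y} q = B.φ-inj (go (B.φ x) (B.φ y) (B'.ψ-inj q))
        where
        eq-in : ∀ s {a b} → (h s , e s a) ≡ (h s , e s b) → a ≡ b
        eq-in s {a} {b} q = e-inj s (second q)
          where
          second : ∀ {j} {u v : Poset.Carrier (B'.block j)} → _≡_ {A = B'.Point} (j , u) (j , v) → u ≡ v
          second refl = refl
        go : ∀ p q → _≡_ {A = B'.Point} (h (proj₁ p , holds (proj₂ p)) , e (proj₁ p , holds (proj₂ p)) (proj₂ p))
                         (h (proj₁ q , holds (proj₂ q)) , e (proj₁ q , holds (proj₂ q)) (proj₂ q)) → p ≡ q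
        go (i , a) (j , b) eq with Chain.tri B.I-chain i j
        ... | inj₁ l = ⊥-elim (proj₂ (h-mono (i , holds a) (j , holds b) l) (cong proj₁ eq))
        ... | inj₂ (inj₂ l) = ⊥-elim (proj₂ (h-mono (j , holds b) (i , holds a) l) (sym (cong proj₁ eq)))
        ... | inj₂ (inj₁ refl) = cong (i ,_) (align (holds a) (holds b) eq)
          where
          align : ∀ p q → _≡_ {A = B'.Point} (h (i , p) , e (i , p) a) (h (i , q) , e (i , q) b) → a ≡ b
          align p q eq with T-prop p q
          ... | refl = eq-in (i , p) eq

  ≼P-intro : ∀ P P' (h : Poset.Carrier P → Poset.Carrier P') →
    (∀ x y → (Poset._≤_ P x y → Poset._≤_ P' (h x) (h y)) × (Poset._≤_ P' (h x) (h y) → Poset._≤_ P x y)) → P ≼P P'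
  ≼P-intro P P' h iff = h , (λ {x} {y} e → Poset.antisym P
      (proj₂ (iff x y) (subst (Poset._≤_ P' (h x)) e (Poset.refl P' _)))
      (proj₂ (iff y x) (subst (λ z → Poset._≤_ P' z (h x)) e (Poset.refl P' _)))) , iff

  ≼P-refl : ∀ P → P ≼P P
  ≼P-refl P = id , id , λ _ _ → id , id

  ≼P-trans : ∀ {P P' P''} → P ≼P P' → P' ≼P P'' → P ≼P P''
  ≼P-trans (h , i , f) (h' , i' , f') = h' ∘ h , i ∘ i' , λ x y → proj₁ (f' _ _) ∘ proj₁ (f x y) , proj₂ (f x y) ∘ proj₂ (f' _ _)

  ≼B-refl : ∀ B → B ≼B B
  ≼B-refl B = id , id , (λ _ _ → id , id) , λ _ _ → id , id

  ≼B-trans : ∀ {B B' B''} → B ≼B B' → B' ≼B B'' → B ≼B B''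
  ≼B-trans (h , i , f , g) (h' , i' , f' , g') = h' ∘ h , i ∘ i' ,
    (λ x y → proj₁ (f' _ _) ∘ proj₁ (f x y) , proj₂ (f x y) ∘ proj₂ (f' _ _)) ,
    λ x y → proj₁ (g' _ _) ∘ proj₁ (g x y) , proj₂ (g x y) ∘ proj₂ (g' _ _)

  swapB : Bichain → Bichain
  swapB B = record { Carrier = Carrier ; countable = countable ; _≤₁_ = _≤₂_ ; _≤₂_ = _≤₁_ ; lin₁ = lin₂ ; lin₂ = lin₁ }
    where open Bichain B

  dual : Poset → Poset
  dual P = record { Carrier = Carrier ; countable = countable ; _≤_ = λ x y → y ⊑ x ; refl = ⊑-refl
    ; trans = λ p q → ⊑-trans q p ; antisym = λ p q → antisym q p }
    where open Poset P using (Carrier; countable; antisym) renaming (_≤_ to _⊑_; refl to ⊑-refl; trans to ⊑-trans)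

  module _ {A B : Set} {_≤_ : B → B → Set} (lin : IsLinear _≤_) (h : A → B) (h-inj : Injective h) where

    pullback-linear : IsLinear λ x y → h x ≤ h y
    pullback-linear = record { refl = λ x → IsLinear.refl lin (h x) ; trans = IsLinear.trans lin
      ; antisym = λ p q → h-inj (IsLinear.antisym lin p q) ; total = λ x y → IsLinear.total lin (h x) (h y) }

    linear-reflects : {_⊑_ : A → A → Set} → IsLinear _⊑_ → (∀ x y → x ⊑ y → h x ≤ h y) → ∀ x y → h x ≤ h y → x ⊑ y
    linear-reflects {_⊑_} lin' m x y p with IsLinear.total lin' x y
    ... | inj₁ q = q
    ... | inj₂ q = subst (λ z → z ⊑ y) (h-inj (IsLinear.antisym lin (m y x q) p)) (IsLinear.refl lin' y)

  -- One-block sums put 𝒟 inside the class of sums, so a hypothesis on sums restricts to the labels.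
  singleton-sum : (𝒟 : Poset → Set) (P : Poset) → 𝒟 P → Hat 𝒟 P
  singleton-sum 𝒟 P d = point , (λ _ _ → inj₁ tt) , tt , (λ _ → P) , (λ _ → d) , (tt ,_) , (λ { refl → refl }) ,
      (λ (tt , x) → x , refl) , λ x y → inside , strip
    where
    point : Poset
    point = record { Carrier = ⊤ ; countable = record { enc = λ _ → 0 ; enc-inj = λ _ → refl } ; _≤_ = λ _ _ → ⊤
      ; refl = λ _ → tt ; trans = λ _ _ → tt ; antisym = λ _ _ → refl }
    strip : ∀ {x y} → LexLe point (λ _ → P) (tt , x) (tt , y) → Poset._≤_ P x y
    strip (inside h) = h
    strip (across _ n) = ⊥-elim (n refl)

  -- Posets and their bichains

  module Main (𝒟 : Poset → Set)
    (hyp : ∀ P → 𝒟 P → IsIntersectionOfTwoLinear P × ProperModulesAreChains P × IncConnected P) where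

    RealizedPoset : Set₁
    RealizedPoset = Σ Poset λ P → 𝒟 P × IsIntersectionOfTwoLinear P

    bichain-of : RealizedPoset → Bichain
    bichain-of (P , _ , _≤₁_ , _≤₂_ , lin₁ , lin₂ , _) = record
      { Carrier = Poset.Carrier P ; countable = Poset.countable P ; _≤₁_ = _≤₁_ ; _≤₂_ = _≤₂_ ; lin₁ = lin₁ ; lin₂ = lin₂ }

    signed : Bool → RealizedPoset → RealizedPoset → Set
    signed false X Y = bichain-of X ≼B bichain-of Y
    signed true X Y = bichain-of X ≼B swapB (bichain-of Y)

    -- Pulling the realizer of Y back along h gives a second realizer of the poset of X, and there
    -- are only two up to equivalence.
    signed-covers : ∀ {X Y} → proj₁ X ≼P proj₁ Y → Σ Bool λ s → signed s X Y
    signed-covers {P , d , a , b , la , lb , r} {P' , d' , a' , b' , la' , lb' , r'} (h , h-inj , iff) =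
        sign (unique R S)
      where
      X Y : RealizedPoset
      X = P , d , a , b , la , lb , r
      Y = P' , d' , a' , b' , la' , lb' , r'
      open Realizers P (proj₁ (proj₂ (hyp P d))) (proj₂ (proj₂ (hyp P d)))
      R S : Realizer
      R = record { _≤₁_ = a ; _≤₂_ = b ; lin₁ = la ; lin₂ = lb ; realizes = r }
      S = record { _≤₁_ = λ x y → a' (h x) (h y) ; _≤₂_ = λ x y → b' (h x) (h y)
        ; lin₁ = pullback-linear la' h h-inj ; lin₂ = pullback-linear lb' h h-inj
        ; realizes = λ x y → proj₁ (r' _ _) ∘ proj₁ (iff x y) , proj₂ (iff x y) ∘ proj₂ (r' _ _) }
      a'' b'' : Poset.Carrier P → Poset.Carrier P → Set
      a'' x y = a' (h x) (h y)
      b'' x y = b' (h x) (h y)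
      sign : (Equiv a a'' × Equiv b b'') ⊎ (Equiv a b'' × Equiv b a'') → Σ Bool λ s → signed s X Y
      sign (inj₁ (e , e')) = false , h , h-inj , e , e'
      sign (inj₂ (e , e')) = true , h , h-inj , e , e'

    realized-bqo : IsBqo (EmbC (Hat 𝒟)) → Bqo (signed false)
    realized-bqo b = DoubleCover.cover-bqo (λ X Y → proj₁ X ≼P proj₁ Y) signed (λ {X} {Y} → signed-covers {X} {Y})
        (λ X → ≼B-refl (bichain-of X)) (λ {s} {X} {Y} {Z} → tr s X Y Z)
        (λ {X} {Y} {Z} p q → ≼B-trans {bichain-of X} {swapB (bichain-of Y)} {bichain-of Z} p (flipped (bichain-of Y) (bichain-of Z) q))
        (bqo⇒trees-good {r = λ X Y → proj₁ X ≼P proj₁ Y}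
          (bqo-transfer {s = EmbC (Hat 𝒟)} (λ (P , d , _) → P , singleton-sum 𝒟 P d) (λ _ _ → id) b))
      where
      tr : ∀ s X Y Z → signed false X Y → signed s Y Z → signed s X Z
      tr false X Y Z = ≼B-trans {bichain-of X} {bichain-of Y} {bichain-of Z}
      tr true X Y Z = ≼B-trans {bichain-of X} {bichain-of Y} {swapB (bichain-of Z)}
      flipped : ∀ B B' → B ≼B swapB B' → swapB B ≼B B'
      flipped B B' (h , i , f , g) = h , i , g , f

    -- If o(B) is a sum, then B is the corresponding sum of its restrictions to the blocks, as both orders of B refine o(B).
    module _ (B : Bichain) (S : Hat 𝒟 (o B)) where
      private module S = Blocks {𝒟} {o B} S
      open Bichain B

      restriction : Poset.Carrier S.I → RealizedPoset
      restriction i = S.block i , S.block∈𝒟 i , restrict _≤₁_ , restrict _≤₂_ , pullback-linear lin₁ ψᵢ ψᵢ-inj , pullback-linear lin₂ ψᵢ ψᵢ-inj ,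
          λ a b → proj₁ (S.ψ-within {i} {a} {b}) , proj₂ S.ψ-within
        where
        ψᵢ : Poset.Carrier (S.block i) → Carrier
        ψᵢ a = S.ψ (i , a)
        ψᵢ-inj : Injective ψᵢ
        ψᵢ-inj e = second (S.ψ-inj e)
          where
          second : ∀ {a b} → _≡_ {A = S.Point} (i , a) (i , b) → a ≡ b
          second refl = refl
        restrict : (Carrier → Carrier → Set) → Poset.Carrier (S.block i) → Poset.Carrier (S.block i) → Set
        restrict R a b = R (ψᵢ a) (ψᵢ b)

      bichain-code : LCh RealizedPoset
      bichain-code = S.coded restriction

    bichain-code-reflects : ∀ B S B' S' → Emb (signed false) (bichain-code B S) (bichain-code B' S') → B ≼B B'
    bichain-code-reflects B S B' S' f = embedding , embedding-inj ,
        (λ x y → fwd₁ x y , linear-reflects (Bichain.lin₁ B') embedding embedding-inj (Bichain.lin₁ B) fwd₁ x y) ,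
        (λ x y → fwd₂ x y , linear-reflects (Bichain.lin₂ B') embedding embedding-inj (Bichain.lin₂ B) fwd₂ x y)
      where
      module T = Blocks {𝒟} {o B} S
      module T' = Blocks {𝒟} {o B'} S'
      h : ∣ bichain-code B S ∣ → Poset.Carrier T'.I
      h s = proj₁ (fun f s)
      h-mono : ∀ s t → Chain._≺_ T.I-chain (proj₁ s) (proj₁ t) → Chain._≺_ T'.I-chain (h s) (h t)
      h-mono s t = mono f {s} {t}
      e : ∀ s → Poset.Carrier (T.block (proj₁ s)) → Poset.Carrier (T'.block (h s))
      e s = proj₁ (lab f s)
      e-inj : ∀ s → Injective (e s)
      e-inj s = proj₁ (proj₂ (lab f s))
      open BlockwiseEmbedding.Along {𝒟} {o B} {o B'} S S' h h-mono e e-inj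
      fwd₁ : ∀ x y → Bichain._≤₁_ B x y → Bichain._≤₁_ B' (embedding x) (embedding y)
      fwd₁ = preserves (Bichain._≤₁_ B) (Bichain._≤₁_ B') proj₁
        (IsLinear.antisym (Bichain.lin₁ B)) proj₁ (λ s a b → proj₁ (proj₁ (proj₂ (proj₂ (lab f s))) a b))
      fwd₂ : ∀ x y → Bichain._≤₂_ B x y → Bichain._≤₂_ B' (embedding x) (embedding y)
      fwd₂ = preserves (Bichain._≤₂_ B) (Bichain._≤₂_ B') proj₂
        (IsLinear.antisym (Bichain.lin₂ B)) proj₂ (λ s a b → proj₁ (proj₂ (proj₂ (proj₂ (lab f s))) a b))

    posets⇒bichains : IsBqo (EmbC (Hat 𝒟)) → IsBqo (Embo⁻¹ (Hat 𝒟))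
    posets⇒bichains b = coded-bqo {r = signed false} (λ X → ≼B-refl (bichain-of X))
      (λ {X} {Y} {Z} → ≼B-trans {bichain-of X} {bichain-of Y} {bichain-of Z}) (realized-bqo b)
      (λ (B , S) → bichain-code B S) (λ (B , S) (B' , S') → bichain-code-reflects B S B' S')

    module _ (P : Poset) (S : Hat 𝒟 P) where
      private module S = Blocks {𝒟} {P} S

      data LexRel (R : ∀ i → Poset.Carrier (S.block i) → Poset.Carrier (S.block i) → Set) : S.Point → S.Point → Set where
        within : ∀ {i a b} → R i a b → LexRel R (i , a) (i , b)
        beyond : ∀ {i j a b} → Chain._≺_ S.I-chain i j → LexRel R (i , a) (j , b)

      lex-linear : ∀ {R} → (∀ i → IsLinear (R i)) → IsLinear (LexRel R)
      lex-linear {R} lin = record { refl = λ (i , a) → within (IsLinear.refl (lin i) a) ; trans = tr ; antisym = as ; total = to }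
        where
        tr : ∀ {p q s} → LexRel R p q → LexRel R q s → LexRel R p s
        tr (within h) (within k) = within (IsLinear.trans (lin _) h k)
        tr (within h) (beyond k) = beyond k
        tr (beyond h) (within k) = beyond h
        tr (beyond h) (beyond k) = beyond (Chain.tra S.I-chain h k)
        as : ∀ {p q} → LexRel R p q → LexRel R q p → p ≡ q
        as (within h) (within k) = cong (_ ,_) (IsLinear.antisym (lin _) h k)
        as (within h) (beyond k) = ⊥-elim (proj₂ k refl)
        as (beyond h) (within k) = ⊥-elim (proj₂ h refl)
        as (beyond h) (beyond k) = ⊥-elim (proj₂ (Chain.tra S.I-chain h k) refl)
        to : ∀ p q → LexRel R p q ⊎ LexRel R q p
        to (i , a) (j , b) with Chain.tri S.I-chain i j
        ... | inj₁ l = inj₁ (beyond l)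
        ... | inj₂ (inj₂ l) = inj₂ (beyond l)
        ... | inj₂ (inj₁ refl) with IsLinear.total (lin i) a b
        ...   | inj₁ h = inj₁ (within h)
        ...   | inj₂ h = inj₂ (within h)

      private
        real : ∀ i → IsIntersectionOfTwoLinear (S.block i)
        real i = proj₁ (hyp (S.block i) (S.block∈𝒟 i))
        R₁ R₂ : ∀ i → Poset.Carrier (S.block i) → Poset.Carrier (S.block i) → Set
        R₁ i = proj₁ (real i)
        R₂ i = proj₁ (proj₂ (real i))

      -- Built from the realizers of the blocks, so that its intersection is the same
      -- lexicographical sum and the bichain lies in the required class.
      realizer : Bichain
      realizer = record
        { Carrier = Poset.Carrier P ; countable = Poset.countable P
        ; _≤₁_ = λ x y → LexRel R₁ (S.φ x) (S.φ y) ; _≤₂_ = λ x y → LexRel R₂ (S.φ x) (S.φ y)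
        ; lin₁ = pullback-linear (lex-linear λ i → proj₁ (proj₂ (proj₂ (real i)))) S.φ S.φ-inj
        ; lin₂ = pullback-linear (lex-linear λ i → proj₁ (proj₂ (proj₂ (proj₂ (real i))))) S.φ S.φ-inj }

      split-lex : ∀ {p q} → LexLe S.I S.block p q → LexRel R₁ p q × LexRel R₂ p q
      split-lex (inside h) = let a , b = proj₁ (proj₂ (proj₂ (proj₂ (proj₂ (real _)))) _ _) h in within a , within b
      split-lex (across l n) = beyond (l , n) , beyond (l , n)

      join-lex : ∀ {p q} → LexRel R₁ p q → LexRel R₂ p q → LexLe S.I S.block p q
      join-lex (within a) (within b) = inside (proj₂ (proj₂ (proj₂ (proj₂ (proj₂ (real _)))) _ _) (a , b))
      join-lex (within _) (beyond (l , n)) = ⊥-elim (n refl)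
      join-lex (beyond (l , n)) _ = across l n

      realizer-sum : Hat 𝒟 (o realizer)
      realizer-sum = let I , ch , i₀ , Q , d , φ , inj , surj , _ = S in I , ch , i₀ , Q , d , φ , inj , surj ,
        λ x y → (λ (p , q) → join-lex p q) , split-lex

      realizer-≤ : ∀ x y → (Poset._≤_ P x y → Poset._≤_ (o realizer) x y) × (Poset._≤_ (o realizer) x y → Poset._≤_ P x y)
      realizer-≤ x y = split-lex ∘ proj₁ (S.φ-≤ x y) , λ (p , q) → proj₂ (S.φ-≤ x y) (join-lex p q)

    bichains⇒posets : IsBqo (Embo⁻¹ (Hat 𝒟)) → IsBqo (EmbC (Hat 𝒟))
    bichains⇒posets = bqo-transfer {r = EmbC (Hat 𝒟)} {s = Embo⁻¹ (Hat 𝒟)} (λ (P , S) → realizer P S , realizer-sum P S)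
      λ (P , S) (P' , S') (h , inj , f , g) → h , inj , λ x y →
        (λ l → let p , q = proj₁ (realizer-≤ P S x y) l in proj₂ (realizer-≤ P' S' (h x) (h y)) (proj₁ (f x y) p , proj₁ (g x y) q)) ,
        (λ l → let p , q = proj₁ (realizer-≤ P' S' (h x) (h y)) l in proj₂ (realizer-≤ P S x y) (proj₂ (f x y) p , proj₂ (g x y) q))

  -- Minimal bad sequences and finite labelled chains

  module MinimalBadSequence {R : Set ℓ} (_≼_ : R → R → Set ℓ') (_⊏_ : R → R → Set ℓ″)
    (≼-trans : ∀ {x y z} → x ≼ y → y ≼ z → x ≼ z) (⊏-wf : WellFounded _⊏_) (⊏⇒≼ : ∀ {x y} → x ⊏ y → x ≼ y) where

    BadSeq : (ℕ → R) → Set ℓ'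
    BadSeq f = ∀ {i j} → i < j → ¬ (f i ≼ f j)

    Extends : ℕ → (ℕ → R) → R → Set (ℓ ⊔ ℓ')
    Extends n f v = Σ (ℕ → R) λ g → BadSeq g × (∀ i → i < n → g i ≡ f i) × g n ≡ v

    module _ (f₀ : ℕ → R) (bad₀ : BadSeq f₀) where

      least-next : ∀ n f → BadSeq f → Σ R λ v → Extends n f v × (∀ w → w ⊏ v → ¬ Extends n f w)
      least-next n f bad = minimal ⊏-wf (Extends n f) (f n , f , bad , (λ _ _ → refl) , refl)

      st : ℕ → Σ (ℕ → R) BadSeq
      st zero = f₀ , bad₀
      st (suc n) = let f , bad = st n ; _ , (g , bad' , _) , _ = least-next n f bad in g , bad'

      limit : ℕ → R
      limit n = proj₁ (st (suc n)) n

      agree : ∀ {m n} i → i < m → m ≤ n → proj₁ (st n) i ≡ proj₁ (st m) i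
      agree {m} {n} i i<m m≤n with m≤n⇒m<n∨m≡n m≤n
      ... | inj₂ refl = refl
      agree {m} {suc n} i i<m _ | inj₁ (s≤s p) =
        trans (proj₁ (proj₂ (proj₂ (proj₁ (proj₂ (least-next n (proj₁ (st n)) (proj₂ (st n))))))) i (<-≤-trans i<m p)) (agree i i<m p)

      limit-bad : BadSeq limit
      limit-bad {i} {j} i<j le = proj₂ (st (suc j)) i<j (subst (_≼ limit j) (sym (agree i (n<1+n i) (s≤s (<⇒≤ i<j)))) le)

      -- The limit up to place c 0, continued by g, would be a bad sequence with a smaller term at
      -- that place than the one chosen. Comparisons across the seam lift to the limit because g
      -- lies below it.
      limit-min : ∀ c g → Mono c → BadSeq g → ¬ (∀ k → g k ⊏ limit (c k))
      limit-min c g mc bg low = proj₂ (proj₂ (least-next n f (proj₂ (st n)))) (g 0)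
          (subst (g 0 ⊏_) (proj₂ (proj₂ (proj₂ (proj₁ (proj₂ (least-next n f (proj₂ (st n)))))))) (low 0))
          (G , G-bad , (λ i p → trans (G-low i p) (sym (agree i (n<1+n i) p))) , trans (G-high n ≤-refl) (cong g (n∸n≡0 n)))
        where
        n = c 0
        f = proj₁ (st n)
        G-of : ∀ i → Dec (i < n) → R
        G-of i (yes _) = limit i
        G-of i (no _) = g (i ∸ n)
        G : ℕ → R
        G i = G-of i (i <? n)
        G-low : ∀ i → i < n → G i ≡ limit i
        G-low i p with i <? n
        ... | yes _ = refl
        ... | no q = ⊥-elim (q p)
        G-high : ∀ i → n ≤ i → G i ≡ g (i ∸ n)
        G-high i p with i <? n
        ... | yes q = ⊥-elim (<-irrefl refl (<-≤-trans q p))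
        ... | no _ = refl
        G-bad : BadSeq G
        G-bad {i} {j} i<j le with i <? n | j <? n
        ... | yes _ | yes _ = limit-bad i<j le
        ... | no i≮n | yes j<n = i≮n (<-trans i<j j<n)
        ... | no i≮n | no _ = bg (∸-monoˡ-< i<j (≮⇒≥ i≮n)) le
        ... | yes i<n | no _ = limit-bad (<-≤-trans i<n (mono-≤ mc z≤n)) (≼-trans le (⊏⇒≼ (low (j ∸ n))))

  data FinTerm (Q : Set ℓ) : Set ℓ where
    nil : FinTerm Q
    lf : Q → FinTerm Q
    cat : FinTerm Q → FinTerm Q → FinTerm Q

  ⟪_⟫ : {Q : Set ℓ} → FinTerm Q → LCh Q
  ⟪ nil ⟫ = emptyL
  ⟪ lf q ⟫ = singleL q
  ⟪ cat s t ⟫ = ⟪ s ⟫ ⊕ ⟪ t ⟫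

  data Part {Q : Set ℓ} : FinTerm Q → FinTerm Q → Set ℓ where
    left : ∀ {s t} → Part s (cat s t)
    right : ∀ {s t} → Part t (cat s t)

  part-wf : {Q : Set ℓ} → WellFounded (Part {Q = Q})
  part-wf nil = acc λ ()
  part-wf (lf q) = acc λ ()
  part-wf (cat s t) = acc λ { left → part-wf s ; right → part-wf t }

  module Higman {Q : Set ℓ} {r : Q → Q → Set ℓ'} (rr : ∀ x → r x x) (rt : ∀ {x y z} → r x y → r y z → r x z) (good : GoodPairs r) where

    _≼ᶠ_ : FinTerm Q → FinTerm Q → Set ℓ'
    s ≼ᶠ t = Emb r ⟪ s ⟫ ⟪ t ⟫

    part≼ : ∀ {s t} → Part s t → s ≼ᶠ t
    part≼ (left {s} {t}) = emb-≡ rr (summand two (both ⟪ s ⟫ ⟪ t ⟫) false)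
    part≼ (right {s} {t}) = emb-≡ rr (summand two (both ⟪ s ⟫ ⟪ t ⟫) true)

    open MinimalBadSequence _≼ᶠ_ Part (emb-∘ rt) part-wf part≼

    data View : FinTerm Q → ℕ → Set ℓ where
      is-nil : View nil 0
      is-lf : ∀ q → View (lf q) 1
      is-cat : ∀ s t → View (cat s t) 2

    kind : FinTerm Q → ℕ
    kind nil = 0
    kind (lf _) = 1
    kind (cat _ _) = 2

    kind-bound : ∀ t → kind t < 3
    kind-bound nil = s≤s z≤n
    kind-bound (lf _) = s≤s (s≤s z≤n)
    kind-bound (cat _ _) = s≤s (s≤s (s≤s z≤n))

    view : ∀ t → View t (kind t)
    view nil = is-nil
    view (lf q) = is-lf q
    view (cat s t) = is-cat s t

    nils : ∀ {s t} → View s 0 → s ≼ᶠ t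
    nils is-nil = empty-emb

    label : ∀ {s} → View s 1 → Q
    label (is-lf q) = q

    label-≼ : ∀ {s t} (v : View s 1) (w : View t 1) → r (label v) (label w) → s ≼ᶠ t
    label-≼ (is-lf p) (is-lf q) h = emb id id λ _ → h

    fst-part snd-part : ∀ {s} → View s 2 → FinTerm Q
    fst-part (is-cat s t) = s
    snd-part (is-cat s t) = t

    fst-is : ∀ {s} (v : View s 2) → Part (fst-part v) s
    fst-is (is-cat s t) = left

    snd-is : ∀ {s} (v : View s 2) → Part (snd-part v) s
    snd-is (is-cat s t) = right

    cat-≼ : ∀ {s t} (v : View s 2) (w : View t 2) → fst-part v ≼ᶠ fst-part w → snd-part v ≼ᶠ snd-part w → s ≼ᶠ t
    cat-≼ (is-cat s t) (is-cat s' t') e e' = sum-emb two two (both ⟪ s ⟫ ⟪ t ⟫) (both ⟪ s' ⟫ ⟪ t' ⟫) id id λ { false → e ; true → e' }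

    terms-good : GoodPairs _≼ᶠ_
    terms-good x = byContra λ none → start x λ p q → none (_ , _ , p , q)
      where
      refute : ∀ f → BadSeq f → (∀ c g → Mono c → BadSeq g → ¬ (∀ k → Part (g k) (f (c k)))) → ⊥
      refute f bad min = by-kind (ramsey-finite (λ X → kind (f (X 0))) (λ X _ → 1 , λ Y _ a → cong (kind ∘ f) (a 0 (s≤s z≤n)))
          3 λ X _ → kind-bound (f (X 0)))
        where
        by-kind : ¬ Σ Pt λ N → Mono N × Σ ℕ λ v → ∀ X → Mono X → kind (f (N (X 0))) ≡ v
        by-kind (N , mN , v , h) = go v views
          where
          views : ∀ n → View (f (N n)) v
          views n = subst (View (f (N n))) (h (_+ n) (λ p → +-monoˡ-< n p)) (view (f (N n)))
          go : ∀ v → ¬ (∀ n → View (f (N n)) v)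
          go 0 vs = bad (mN {0} {1} (s≤s z≤n)) (nils (vs 0))
          go 1 vs = let i , j , i<j , le = good (λ n → label (vs n)) in bad (mN i<j) (label-≼ (vs i) (vs j) le)
          go 2 vs with ramsey₂ (λ i j → fst-part (vs i) ≼ᶠ fst-part (vs j))
          ... | M , mM , inj₂ k = min (N ∘ M) (λ n → fst-part (vs (M n))) (mN ∘ mM) k (λ n → fst-is (vs (M n)))
          ... | M , mM , inj₁ k = min (N ∘ M) (λ n → snd-part (vs (M n))) (mN ∘ mM)
                  (λ {i} {j} p e → bad (mN (mM p)) (cat-≼ (vs (M i)) (vs (M j)) (k p) e)) (λ n → snd-is (vs (M n)))
          go (suc (suc (suc _))) vs = case vs 0 of λ ()

      start : ∀ x → ¬ BadSeq x
      start x bad = refute (limit x bad) (limit-bad x bad) (limit-min x bad)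

    FinDenoted : LCh Q → Set (ℓ ⊔ ℓ')
    FinDenoted L = Σ (FinTerm Q) λ t → Emb r L ⟪ t ⟫ × Emb r ⟪ t ⟫ L

    fin-cut : ∀ M (P : ∣ M ∣ → Set) → (∀ {x y} → Lt M x y → P y → P x) →
      FinDenoted (Sub M P) → FinDenoted (Sub M (¬_ ∘ P)) → FinDenoted M
    fin-cut M P down (s , e , e') (t , f , f') = cat s t ,
      emb-∘ rt (emb-≡ rr (Cut.to M P down)) (sum-emb two two (both (Sub M P) (Sub M (¬_ ∘ P))) (both ⟪ s ⟫ ⟪ t ⟫) id id (λ { false → e ; true → f })) ,
      emb-∘ rt (sum-emb two two (both ⟪ s ⟫ ⟪ t ⟫) (both (Sub M P) (Sub M (¬_ ∘ P))) id id (λ { false → e' ; true → f' })) (emb-≡ rr (Cut.from M P down))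

    fin-single : ∀ {L} (m : ∣ L ∣) → (∀ x → x ≡ m) → FinDenoted L
    fin-single {L} m one = lf (proj₂ L m) ,
      emb (λ _ → tt) (λ {x} {y} l → ⊥-elim (Chain.irr (proj₁ L) m (subst₂ (Lt L) (one x) (one y) l)))
        (λ x → subst (λ z → r (proj₂ L z) (proj₂ L m)) (sym (one x)) (rr _)) ,
      emb (λ _ → m) (λ ()) (λ _ → rr _)

    -- The element of the largest code splits the chain into what is below it, itself and what is
    -- above it; both outer parts use fewer codes.
    fin-denoted : ∀ n (L : LCh Q) (c : ∣ L ∣ → ℕ) → Injective c → (∀ x → c x < n) → FinDenoted L
    fin-denoted zero L c inj bound = nil , none-emb (λ x → case bound x of λ ()) , empty-emb
    fin-denoted (suc n) L c inj bound with em (Σ ∣ L ∣ λ m → c m ≡ n)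
    ... | no none = fin-denoted n L c inj λ x → ≤∧≢⇒< (≤-pred (bound x)) λ e → none (x , e)
    ... | yes (m , e) = fin-cut L Below (Chain.tra (proj₁ L))
        (rest (Sub L Below) proj₁ (λ q → pairs-eq q) (λ (x , p) q → irr m (subst (_≺ m) q (sound p))))
        (fin-cut NotBelow At (λ { {x , p} {y , _} l refl → ⊥-elim (sound p l) })
          (fin-single ((m , holds (irr m)) , holds refl) λ ((x , p) , q) → pairs-eq (pairs-eq (sound q)))
          (rest (Sub NotBelow (¬_ ∘ At)) (proj₁ ∘ proj₁) (λ q → pairs-eq (pairs-eq q)) (λ (_ , q) → sound q)))
      where
      open Chain (proj₁ L)
      Below : ∣ L ∣ → Set
      Below x = x ≺ m
      NotBelow : LCh Q
      NotBelow = Sub L (¬_ ∘ Below)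
      At : ∣ NotBelow ∣ → Set
      At (x , _) = x ≡ m
      rest : ∀ M (f : ∣ M ∣ → ∣ L ∣) → Injective f → (∀ x → ¬ f x ≡ m) → FinDenoted M
      rest M f f-inj ne = fin-denoted n M (c ∘ f) (f-inj ∘ inj) λ x → ≤∧≢⇒< (≤-pred (bound (f x))) λ q → ne x (inj (trans q (sym e)))

    finite-chains-good : (x : ℕ → LCh Q) → (∀ n → Finite ∣ x n ∣) → Σ ℕ λ i → Σ ℕ λ j → i < j × Emb r (x i) (x j)
    finite-chains-good x fin = let i , j , i<j , le = terms-good (λ n → proj₁ (d n)) in
        i , j , i<j , emb-∘ rt (proj₁ (proj₂ (d i))) (emb-∘ rt le (proj₂ (proj₂ (d j))))
      where
      d : ∀ n → FinDenoted (x n)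
      d n = let k , f , inj = fin n in fin-denoted k (x n) (toℕ ∘ f) (inj ∘ toℕ-injective) (λ y → toℕ<n (f y))

  -- Finite posets and their incomparability graphs

  module MainFinite (𝒟 : Poset → Set)
    (hyp : ∀ P → 𝒟 P → IsIntersectionOfTwoLinear P × ProperModulesAreChains P × IncConnected P) where

    FiniteBlock : Set₁
    FiniteBlock = Σ Poset λ P → 𝒟 P × Finite (Poset.Carrier P)

    signed : Bool → FiniteBlock → FiniteBlock → Set
    signed false X Y = proj₁ X ≼P proj₁ Y
    signed true X Y = proj₁ X ≼P dual (proj₁ Y)

    IncLe : FiniteBlock → FiniteBlock → Set
    IncLe X Y = Inc (proj₁ X) ≼G Inc (proj₁ Y)

    -- The order of the second poset pulled back along h has the same incomparability graph as the
    -- first poset, so `same-inc` applies. The embedding it gives is h after a rearrangement of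
    -- twins.
    signed-covers : ∀ {X Y} → IncLe X Y → Σ Bool λ s → signed s X Y
    signed-covers {P , d , fin} {P' , d' , _} (h , h-inj , edge) = sign (same-inc _≤''_ (Poset.trans P') (λ x → Poset.refl P' (h x))
        (λ p q → h-inj (Poset.antisym P' p q)) (λ {x} {y} i → proj₁ (proj₂ (proj₁ (edge x y) ((λ { refl → I-irr i }) , i)))) comparable')
      where
      open FromInc P (proj₁ (proj₂ (hyp P d))) (proj₂ (proj₂ (hyp P d))) fin
      open PosetGraph P (proj₁ (proj₂ (hyp P d))) (proj₂ (proj₂ (hyp P d))) using (I-irr)
      _≤''_ : Poset.Carrier P → Poset.Carrier P → Set
      x ≤'' y = Poset._≤_ P' (h x) (h y)
      comparable' : ∀ {x y} → ¬ Incomparable P x y → x ≤'' y ⊎ y ≤'' x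
      comparable' {x} {y} n with em (x ≤'' y) | em (y ≤'' x)
      ... | yes p | _ = inj₁ p
      ... | no _ | yes q = inj₂ q
      ... | no p | no q = ⊥-elim (n (proj₂ (proj₂ (edge x y) ((λ e → p (subst (Poset._≤_ P' (h x)) e (Poset.refl P' (h x)))) , p , q))))
      sign : _ → Σ Bool λ s → signed s (P , d , fin) (P' , d' , _)
      sign (inj₁ (θ , iff)) = false , ≼P-intro P P' (h ∘ θ) iff
      sign (inj₂ (θ , iff)) = true , ≼P-intro P (dual P') (h ∘ θ) iff

    signed-trans : ∀ s X Y Z → signed false X Y → signed s Y Z → signed s X Z
    signed-trans false X Y Z = ≼P-trans {proj₁ X} {proj₁ Y} {proj₁ Z}
    signed-trans true X Y Z = ≼P-trans {proj₁ X} {proj₁ Y} {dual (proj₁ Z)}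

    signed-square : ∀ X Y Z → signed true X Y → signed true Y Z → signed false X Z
    signed-square X Y Z p (h , inj , iff) = ≼P-trans {proj₁ X} {dual (proj₁ Y)} {proj₁ Z} p (h , inj , λ x y → iff y x)

    singleton : FiniteBlock → Σ Poset (HatFin 𝒟)
    singleton (P , d , fin) = P , singleton-sum 𝒟 P d , fin

    module _ (P : Poset) (S : HatFin 𝒟 P) where
      private module S = Blocks {𝒟} {P} (proj₁ S)

      finite-block : Poset.Carrier S.I → FiniteBlock
      finite-block i = S.block i , S.block∈𝒟 i , proj₁ (proj₂ S) , (λ a → proj₁ (proj₂ (proj₂ S)) (S.ψ (i , a))) ,
        λ e → second (S.ψ-inj (proj₂ (proj₂ (proj₂ S)) e))
        where
        second : ∀ {a b} → _≡_ {A = S.Point} (i , a) (i , b) → a ≡ b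
        second refl = refl

      code : LCh FiniteBlock
      code = S.coded finite-block

      -- Every remaining index has a nonempty block, and a point chosen in each block embeds the
      -- indices in the finite P.
      code-finite : Finite ∣ code ∣
      code-finite = proj₁ (proj₂ S) , (λ (i , p) → proj₁ (proj₂ (proj₂ S)) (S.ψ (i , sound p))) ,
        λ e → pairs-eq (cong proj₁ (S.ψ-inj (proj₂ (proj₂ (proj₂ S)) e)))

    code-reflects : ∀ P S P' S' → Emb (signed false) (code P S) (code P' S') → P ≼P P'
    code-reflects P S P' S' f = embedding , embedding-inj , λ x y → fwd x y , reflects embedding-inj
        (λ s a b l → proj₁ T.ψ-within (proj₂ (e-iff s a b) (proj₂ T'.ψ-within l))) fwd x y
      where
      module T = Blocks {𝒟} {P} (proj₁ S)
      module T' = Blocks {𝒟} {P'} (proj₁ S')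
      h : ∣ code P S ∣ → Poset.Carrier T'.I
      h s = proj₁ (fun f s)
      h-mono : ∀ s t → Chain._≺_ T.I-chain (proj₁ s) (proj₁ t) → Chain._≺_ T'.I-chain (h s) (h t)
      h-mono s t = mono f {s} {t}
      e : ∀ s → Poset.Carrier (T.block (proj₁ s)) → Poset.Carrier (T'.block (h s))
      e s = proj₁ (lab f s)
      e-inj : ∀ s → Injective (e s)
      e-inj s = proj₁ (proj₂ (lab f s))
      e-iff : ∀ s a b → (Poset._≤_ (T.block (proj₁ s)) a b → Poset._≤_ (T'.block (h s)) (e s a) (e s b)) ×
                        (Poset._≤_ (T'.block (h s)) (e s a) (e s b) → Poset._≤_ (T.block (proj₁ s)) a b)
      e-iff s = proj₂ (proj₂ (lab f s))
      open BlockwiseEmbedding.Along {𝒟} {P} {P'} (proj₁ S) (proj₁ S') h h-mono e e-inj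
      fwd : ∀ x y → Poset._≤_ P x y → Poset._≤_ P' (embedding x) (embedding y)
      fwd = preserves (Poset._≤_ P) (Poset._≤_ P') id (Poset.antisym P) id
        (λ s a b l → proj₁ T'.ψ-within (proj₁ (e-iff s a b) (proj₂ T.ψ-within l)))

    inc⇒posets-bqo : IsBqo (EmbInc (HatFin 𝒟)) → IsBqo (EmbC (HatFin 𝒟))
    inc⇒posets-bqo b = coded-bqo {r = signed false} (λ X → ≼P-refl (proj₁ X)) (λ {X} {Y} {Z} → signed-trans false X Y Z) blocks
      (λ (P , S) → code P S) (λ (P , S) (P' , S') → code-reflects P S P' S')
      where
      blocks : Bqo (signed false)
      blocks = DoubleCover.cover-bqo IncLe signed (λ {X} {Y} → signed-covers {X} {Y}) (λ X → ≼P-refl (proj₁ X))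
        (λ {s} {X} {Y} {Z} → signed-trans s X Y Z) (λ {X} {Y} {Z} → signed-square X Y Z)
        (bqo⇒trees-good {r = IncLe} (bqo-transfer {s = EmbInc (HatFin 𝒟)} singleton (λ _ _ → id) b))

    inc⇒posets-wqo : IsWqo (EmbInc (HatFin 𝒟)) → IsWqo (EmbC (HatFin 𝒟))
    inc⇒posets-wqo w = good⇒wqo {r = EmbC (HatFin 𝒟)} λ x →
        let i , j , i<j , e = Higman.finite-chains-good {r = signed false} (λ X → ≼P-refl (proj₁ X)) (λ {X} {Y} {Z} → signed-trans false X Y Z)
              blocks (λ n → code (proj₁ (x n)) (proj₂ (x n))) (λ n → code-finite (proj₁ (x n)) (proj₂ (x n)))
        in i , j , i<j , code-reflects _ (proj₂ (x i)) _ (proj₂ (x j)) e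
      where
      inc-good : GoodPairs IncLe
      inc-good = wqo⇒good {r = IncLe} (wqo-transfer {s = EmbInc (HatFin 𝒟)} singleton (λ _ _ → id) w)
      blocks : GoodPairs (signed false)
      blocks x = let N , mN , h = signed-pair (λ s i j → signed s (x i) (x j)) (λ {i} {j} {k} → signed-square (x i) (x j) (x k))
                       (λ φ _ → let i , j , i<j , le = inc-good (x ∘ φ) in i , j , i<j , signed-covers {x (φ i)} {x (φ j)} le)
                 in N 0 , N 1 , mN (s≤s z≤n) , h (s≤s z≤n)

    inc-embedding : ∀ P P' → P ≼P P' → Inc P ≼G Inc P'
    inc-embedding P P' (h , inj , iff) = h , inj , λ x y →
      (λ (n , p , q) → n ∘ inj , p ∘ proj₂ (iff x y) , q ∘ proj₂ (iff y x)) ,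
      (λ (n , p , q) → (λ { refl → n refl }) , p ∘ proj₁ (iff x y) , q ∘ proj₁ (iff y x))

  mainTheorem : (𝒟 : Poset → Set) →
      (∀ P → 𝒟 P → IsIntersectionOfTwoLinear P × ProperModulesAreChains P × IncConnected P) →
      (IsBqo (EmbC (Hat 𝒟)) ⇔ IsBqo (Embo⁻¹ (Hat 𝒟))) ×
      ((IsWqo (EmbC (HatFin 𝒟)) ⇔ IsWqo (EmbInc (HatFin 𝒟))) ×
       (IsBqo (EmbC (HatFin 𝒟)) ⇔ IsBqo (EmbInc (HatFin 𝒟))))
  mainTheorem 𝒟 hyp = mk⇔ (Main.posets⇒bichains 𝒟 hyp) (Main.bichains⇒posets 𝒟 hyp) ,
      mk⇔ (wqo-transfer {r = EmbInc (HatFin 𝒟)} {s = EmbC (HatFin 𝒟)} id forget) (inc⇒posets-wqo 𝒟 hyp) ,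
      mk⇔ (bqo-transfer {r = EmbInc (HatFin 𝒟)} {s = EmbC (HatFin 𝒟)} id forget) (inc⇒posets-bqo 𝒟 hyp)
    where
    open MainFinite
    forget : ∀ X Y → EmbC (HatFin 𝒟) X Y → EmbInc (HatFin 𝒟) X Y
    forget (P , _) (P' , _) = inc-embedding 𝒟 hyp P P'

mainTheorem1 : ((ℓ : Level) → ExcludedMiddle ℓ) →
    (𝒟 : Poset → Set) →
    (∀ P → 𝒟 P → IsIntersectionOfTwoLinear P × ProperModulesAreChains P × IncConnected P) →
    (IsBqo (EmbC (Hat 𝒟)) ⇔ IsBqo (Embo⁻¹ (Hat 𝒟))) ×
    ((IsWqo (EmbC (HatFin 𝒟)) ⇔ IsWqo (EmbInc (HatFin 𝒟))) ×
    (IsBqo (EmbC (HatFin 𝒟)) ⇔ IsBqo (EmbInc (HatFin 𝒟))))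
mainTheorem1 = mainTheorem
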